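{- For every $n\ge1$, $\mathcal B(n)\subseteq\mathcal{AF}_n$, and the map $\Phi$ restricted to $\mathcal B(n)$ is a bijection from $\mathcal B(n)$ onto $\mathcal A(n)$.
   Context: Dyck paths: a Dyck path of semilength $n$ is a lattice path from $(0,0)$ to $(n,n)$ with unit north steps $\mathsf N$ and east steps $\mathsf E$ that never goes below $y=x$; $\mathcal D(n)$ is their set. Row $j$ is the strip $j-1\le y\le j$, column $i$ the strip $i-1\le x\le i$. For a path let $x_j$ be the $x$-coordinate of its north step in row $j$ and $h_i$ the $y$-coordinate of its east step in column $i$; set $h_0=0$. Area $\mathbf a(\pi)=\sum_j((j-1)-x_j)$. Bounce points: $b_0=0$, $b_k=h_{b_{k-1}+1}$ until $b_m=n$; bounce composition $\alpha_k=b_k-b_{k-1}$; $p_{n,\alpha}=\mathsf N^{\alpha_1}\mathsf E^{\alpha_1}\cdots\mathsf N^{\alpha_m}\mathsf E^{\alpha_m}$; bounce $\mathbf b(\pi)=\sum_{k=1}^m(n-b_k)$; $\mathcal C(n)=\{p_{n,\alpha}:\alpha\text{ composition of }n\}$. Let $\mathbf{ab}(\pi)=\mathbf a(\pi)+\mathbf b(\pi)$. $\mathcal B(n)$ (bounce-minimal paths) is the set of $\pi\in\mathcal D(n)$ such that $\mathbf b(\tau)\ge\mathbf b(\pi)$ for every $\tau\in\mathcal D(n)$ with $\mathbf{ab}(\tau)=\mathbf{ab}(\pi)$; $\mathcal A(n)$ (area-minimal paths) is the set of $\pi\in\mathcal D(n)$ such that $\mathbf a(\tau)\ge\mathbf a(\pi)$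 for every $\tau\in\mathcal D(n)$ with $\mathbf{ab}(\tau)=\mathbf{ab}(\pi)$. Operators act on the right on $\mathcal D(n)\cup\{\bot\}$, composed left to right, fixing $\bot$; $X^{ -k}=(X^{ -1})^k$, $X^0=\mathrm{id}$. $A_i$ / $A_i^{ -1}$ replace $x_i$ by $x_i\mp1$; $C_i$ / $C_i^{ -1}$ replace $h_i$ by $h_i\pm1$; result $\bot$ if not a Dyck path. For bounce points $b_0,\dots,b_m$ and $1\le i\le m-1$, with $s=b_{i+1}-h_{b_i}$: $\pi\cdot S_i=\bot$ if $h_{b_{i-1}}=b_i$, else $\pi\cdot A_{b_i}^{ -s}C_{b_i}^{s}$ ($S_i=\bot$ for $i\ge m$); each factor in a product uses the bounce points of the current path. For bounce composition $\alpha$ of length $\ell$, $1\le i<\ell$, $k\ge0$: $c_j=\max\{0,\alpha_i-\alpha_{i+j}\}$, $m$ the largest integer in $[0,\ell-i]$ with $\sum_{j\le m}c_j\le k$, $d=k-\sum_{j\le m}c_j$, and $\pi\cdot B_{i,k}=\pi\cdot S_i^{c_1}\cdots S_{i+m-1}^{c_m}S_{i+m}^{d}$. Partitions: $\mathrm{Par}_n$, conjugate $\lambda'$, $\bar\lambda_i$ the $i$-th largest distinct part, $\ell(\bar\lambda)$ the number of distinct parts, $m_\lambda(j)$ the multiplicity of $j$. With $\ell=\ell(\bar\lambda)$: $\mathcal I_{bnc}(\lambda)=\{(i,r):1\le i\le\ell-1,\ 1\le r\le m_\lambda(\bar\lambda_{\ell-i})\}$, $\mathrm{bnc}_\lambda(i,r)=1-r+\sum_{j=1}^{\ell-i}m_\lambda(\bar\lambda_j)$,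 $\mathrm{row}_\lambda(i,r)=r+\sum_{j=1}^i m_\lambda(\bar\lambda_j)\bar\lambda_j$. For $f:\mathcal I_{bnc}(\lambda')\to\mathbb Z_{\ge0}$: $p_{n,\lambda}\cdot A^f=p_{n,\lambda}\cdot\prod A_{\mathrm{row}_\lambda(i,r)}^{f(i,r)}$, $p_{n,\lambda'}\cdot B_f=p_{n,\lambda'}\cdot\prod B_{\mathrm{bnc}_{\lambda'}(i,r),f(i,r)}$, products over $(i,r)\in\mathcal I_{bnc}(\lambda')$ ordered by $i$ then $r$ ascending. $\mathcal F_n$ is the set of $(f,\lambda)$ with $\lambda\in\mathrm{Par}_n$, $\bar\lambda_i>f(i,1)\ge\cdots\ge f(i,m_{\lambda'}(\bar{\lambda'}_{\ell-i}))$ for $1\le i\le\ell-1$, and $p_{n,\lambda'}\cdot B_f\in\mathcal C(n)$. $\mathcal{AF}_n=\{p_{n,\lambda}\cdot A^f:(f,\lambda)\in\mathcal F_n\}$, $\mathcal{BF}_n=\{p_{n,\lambda'}\cdot B_f:(f,\lambda)\in\mathcal F_n\}$, and $\Phi:\mathcal{AF}_n\to\mathcal{BF}_n$ is the map $\Phi(p_{n,\lambda}\cdot A^f)=p_{n,\lambda'}\cdot B_f$. -}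

module Defs where

open import Data.Nat using (ℕ; zero; suc; _+_; _*_; _∸_; _≤_; _<_; _≤ᵇ_; _≡ᵇ_; _⊔_)
open import Data.Bool using (Bool; true; false; _∧_; if_then_else_; T)
open import Data.Nat.ListAction using (sum)
open import Data.List using (List; []; _∷_; _++_; length; map; replicate; applyUpTo; concat; concatMap; foldl)
open import Data.List.Relation.Unary.All using (All)
open import Data.List.Relation.Unary.Linked using (Linked)
open import Data.Maybe using (Maybe; just; nothing)
open import Data.Product using (Σ; _×_; _,_)
open import Relation.Binary.PropositionalEquality using (_≡_)

data Step : Set where
  N E : Step

Path : Set
Path = List Step

dyckGo : ℕ → ℕ → ℕ → Path → Bool
dyckGo n a b [] = (a ≡ᵇ n) ∧ (b ≡ᵇ n)
dyckGo n a b (N ∷ s) = dyckGo n (suc a) b s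
dyckGo n a b (E ∷ s) = (suc b ≤ᵇ a) ∧ dyckGo n a (suc b) s

isDyck : ℕ → Path → Bool
isDyck n p = dyckGo n 0 0 p

InD : ℕ → Path → Set
InD n p = T (isDyck n p)

-- x-coordinates of the north steps (row j = j-th north step), in order
xsGo : ℕ → Path → List ℕ
xsGo x [] = []
xsGo x (N ∷ s) = x ∷ xsGo x s
xsGo x (E ∷ s) = xsGo (suc x) s

xs : Path → List ℕ
xs = xsGo 0

-- y-coordinates of the east steps (column i = i-th east step), in order
hsGo : ℕ → Path → List ℕ
hsGo y [] = []
hsGo y (N ∷ s) = hsGo (suc y) s
hsGo y (E ∷ s) = y ∷ hsGo y s

hs : Path → List ℕ
hs = hsGo 0

nth : List ℕ → ℕ → ℕ
nth [] _ = 0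
nth (x ∷ l) zero = x
nth (x ∷ l) (suc i) = nth l i

-- x_j (1-indexed)
xAt : Path → ℕ → ℕ
xAt p j = nth (xs p) (j ∸ 1)

-- h_i (1-indexed), with h_0 = 0
hAt : Path → ℕ → ℕ
hAt p zero = 0
hAt p (suc i) = nth (hs p) i

areaGo : ℕ → List ℕ → ℕ
areaGo j [] = 0
areaGo j (x ∷ l) = (j ∸ x) + areaGo (suc j) l

area : Path → ℕ
area p = areaGo 0 (xs p)

bounceGo : ℕ → Path → ℕ → ℕ → List ℕ
bounceGo n p zero b = []
bounceGo n p (suc fuel) b =
  if n ≤ᵇ b then [] else (hAt p (suc b) ∷ bounceGo n p fuel (hAt p (suc b)))

bouncePts : ℕ → Path → List ℕ
bouncePts n p = 0 ∷ bounceGo n p n 0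

diffs : ℕ → List ℕ → List ℕ
diffs prev [] = []
diffs prev (b ∷ l) = (b ∸ prev) ∷ diffs b l

bounceComp : ℕ → Path → List ℕ
bounceComp n p = diffs 0 (bounceGo n p n 0)

bounce : ℕ → Path → ℕ
bounce n p = sum (map (n ∸_) (bounceGo n p n 0))

ab : ℕ → Path → ℕ
ab n p = area p + bounce n p

pathOf : List ℕ → Path
pathOf = concatMap (λ a → replicate a N ++ replicate a E)

IsComposition : ℕ → List ℕ → Set
IsComposition n α = All (0 <_) α × sum α ≡ n

InC : ℕ → Maybe Path → Set
InC n t = Σ (List ℕ) λ α → IsComposition n α × t ≡ just (pathOf α)

InB : ℕ → Path → Set
InB n p = InD n p × ((τ : Path) → InD n τ → ab n τ ≡ ab n p → bounce n p ≤ bounce n τ)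

InA : ℕ → Path → Set
InA n p = InD n p × ((τ : Path) → InD n τ → ab n τ ≡ ab n p → area p ≤ area τ)

-- Operators on 𝒟(n) ∪ {⊥}  (⊥ = nothing), acting on the right

Op : Set
Op = Maybe Path → Maybe Path

_⨾_ : Op → Op → Op
(f ⨾ g) t = g (f t)

idOp : Op
idOp t = t

pow : ℕ → Op → Op
pow zero X = idOp
pow (suc k) X = X ⨾ pow k X

eqL : List ℕ → List ℕ → Bool
eqL [] [] = true
eqL (a ∷ l) (b ∷ m) = (a ≡ᵇ b) ∧ eqL l m
eqL _ _ = false

setAt : List ℕ → ℕ → (ℕ → Maybe ℕ) → Maybe (List ℕ)
setAt l zero g = nothing
setAt [] (suc i) g = nothing
setAt (x ∷ l) (suc zero) g with g x
... | nothing = nothing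
... | just y = just (y ∷ l)
setAt (x ∷ l) (suc (suc i)) g with setAt l (suc i) g
... | nothing = nothing
... | just l' = just (x ∷ l')

fromXGo : ℕ → ℕ → List ℕ → Path
fromXGo n cur [] = replicate (n ∸ cur) E
fromXGo n cur (x ∷ l) = replicate (x ∸ cur) E ++ N ∷ fromXGo n (cur ⊔ x) l

fromHGo : ℕ → ℕ → List ℕ → Path
fromHGo n cur [] = replicate (n ∸ cur) N
fromHGo n cur (h ∷ l) = replicate (h ∸ cur) N ++ E ∷ fromHGo n (cur ⊔ h) l

-- replace x_i by g(x_i); ⊥ if there is no such Dyck path
modX : ℕ → ℕ → (ℕ → Maybe ℕ) → Op
modX n i g nothing = nothing
modX n i g (just p) with setAt (xs p) i g
... | nothing = nothing
... | just l =
  if eqL (xs (fromXGo n 0 l)) l ∧ isDyck n (fromXGo n 0 l)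
  then just (fromXGo n 0 l) else nothing

-- replace h_i by g(h_i); ⊥ if there is no such Dyck path
modH : ℕ → ℕ → (ℕ → Maybe ℕ) → Op
modH n i g nothing = nothing
modH n i g (just p) with setAt (hs p) i g
... | nothing = nothing
... | just l =
  if eqL (hs (fromHGo n 0 l)) l ∧ isDyck n (fromHGo n 0 l)
  then just (fromHGo n 0 l) else nothing

decM : ℕ → Maybe ℕ
decM zero = nothing
decM (suc k) = just k

incM : ℕ → Maybe ℕ
incM k = just (suc k)

A : ℕ → ℕ → Op
A n i = modX n i decM

Ainv : ℕ → ℕ → Op
Ainv n i = modX n i incM

C : ℕ → ℕ → Op
C n i = modH n i incM

Cinv : ℕ → ℕ → Op
Cinv n i = modH n i decM

S : ℕ → ℕ → Op
S n i nothing = nothing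
S n i (just p) =
  if (1 ≤ᵇ i) ∧ (suc (suc i) ≤ᵇ length (bouncePts n p))
  then (if hAt p (nth bs (i ∸ 1)) ≡ᵇ nth bs i
        then nothing
        else (pow s (Ainv n (nth bs i)) ⨾ pow s (C n (nth bs i))) (just p))
  else nothing
  where
  bs = bouncePts n p
  s = nth bs (suc i) ∸ hAt p (nth bs i)

-- the factors S_i^{c_1} ⋯ S_{i+m-1}^{c_m} S_{i+m}^{d}, as (index, exponent) pairs
plan : ℕ → ℕ → List ℕ → List (ℕ × ℕ)
plan i k [] = (i , k) ∷ []
plan i k (c ∷ cs) = if c ≤ᵇ k then (i , c) ∷ plan (suc i) (k ∸ c) cs else (i , k) ∷ []

runPlan : ℕ → List (ℕ × ℕ) → Op
runPlan n [] = idOp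
runPlan n ((j , e) ∷ l) = pow e (S n j) ⨾ runPlan n l

Bop : ℕ → ℕ → ℕ → Op
Bop n i k nothing = nothing
Bop n i k (just p) =
  if (1 ≤ᵇ i) ∧ (suc i ≤ᵇ length α)
  then runPlan n (plan i k cs) (just p)
  else nothing
  where
  α = bounceComp n p
  -- c_j = max{0, α_i - α_{i+j}},  j = 1, …, ℓ - i
  cs = applyUpTo (λ j → nth α (i ∸ 1) ∸ nth α (i + j)) (length α ∸ i)

IsPartition : ℕ → List ℕ → Set
IsPartition n λ' = sum λ' ≡ n × All (0 <_) λ' × Linked (λ a b → b ≤ a) λ'

countGe : ℕ → List ℕ → ℕ
countGe k [] = 0
countGe k (x ∷ l) = if k ≤ᵇ x then suc (countGe k l) else countGe k l

headOr0 : List ℕ → ℕ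
headOr0 [] = 0
headOr0 (x ∷ _) = x

conj : List ℕ → List ℕ
conj l = applyUpTo (λ k → countGe (suc k) l) (headOr0 l)

-- distinct parts of a (weakly decreasing) partition, largest first
distinct : List ℕ → List ℕ
distinct [] = []
distinct (x ∷ []) = x ∷ []
distinct (x ∷ y ∷ l) = if x ≡ᵇ y then distinct (y ∷ l) else x ∷ distinct (y ∷ l)

-- λ̄_i (1-indexed)
bar : List ℕ → ℕ → ℕ
bar l i = nth (distinct l) (i ∸ 1)

ellBar : List ℕ → ℕ
ellBar l = length (distinct l)

mult : List ℕ → ℕ → ℕ
mult [] j = 0
mult (x ∷ l) j = if x ≡ᵇ j then suc (mult l j) else mult l j

sumTo : ℕ → (ℕ → ℕ) → ℕ
sumTo zero g = 0
sumTo (suc k) g = sumTo k g + g (suc k)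

multAt : List ℕ → ℕ → ℕ
multAt l i = mult l (bar l (ellBar l ∸ i))

Ibnc : List ℕ → List (ℕ × ℕ)
Ibnc l = concat (applyUpTo (λ i → applyUpTo (λ r → (suc i , suc r)) (multAt l (suc i)))
                           (ellBar l ∸ 1))

bnc : List ℕ → ℕ → ℕ → ℕ
bnc l i r = (1 + sumTo (ellBar l ∸ i) (λ j → mult l (bar l j))) ∸ r

row : List ℕ → ℕ → ℕ → ℕ
row l i r = r + sumTo i (λ j → mult l (bar l j) * bar l j)

-- p_{n,λ} · A^f   (f : ℐ_bnc(λ') → ℕ, values outside ℐ_bnc(λ') are irrelevant)
Aof : ℕ → List ℕ → (ℕ → ℕ → ℕ) → Maybe Path
Aof n l f = foldl (λ t ir → pow (f (Data.Product.proj₁ ir) (Data.Product.proj₂ ir))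
                                (A n (row l (Data.Product.proj₁ ir) (Data.Product.proj₂ ir))) t)
                  (just (pathOf l)) (Ibnc (conj l))

Bof : ℕ → List ℕ → (ℕ → ℕ → ℕ) → Maybe Path
Bof n l f = foldl (λ t ir → Bop n (bnc (conj l) (Data.Product.proj₁ ir) (Data.Product.proj₂ ir))
                                  (f (Data.Product.proj₁ ir) (Data.Product.proj₂ ir)) t)
                  (just (pathOf (conj l))) (Ibnc (conj l))

InF : ℕ → (ℕ → ℕ → ℕ) → List ℕ → Set
InF n f l =
  IsPartition n l ×
  ((i : ℕ) → 1 ≤ i → i ≤ ellBar l ∸ 1 →
     (f i 1 < bar l i) ×
     ((r : ℕ) → 1 ≤ r → r < multAt (conj l) i → f i (suc r) ≤ f i r)) ×
  InC n (Bof n l f)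

InAF : ℕ → Path → Set
InAF n p = Σ (ℕ → ℕ → ℕ) λ f → Σ (List ℕ) λ l → InF n f l × Aof n l f ≡ just p

PhiRel : ℕ → Path → Path → Set
PhiRel n p q = Σ (ℕ → ℕ → ℕ) λ f → Σ (List ℕ) λ l →
  InF n f l × Aof n l f ≡ just p × Bof n l f ≡ just q

{-# OPTIONS --safe #-}

-- A Dyck path with bounce composition α is a sequence of blocks: in block k the rows are moved
-- left of p_α by a weakly decreasing list of amounts smaller than α_{k-1}.  Hence the pairs
-- (area, bounce) of Dyck paths are exactly (Σ C(α_k,2) + e , Σ (k-1) α_k) with
-- 0 ≤ e ≤ cap 1 α = Σ α_k (α_{k-1} - 1), where α_0 = 1.
--
-- Moving one unit between neighbouring parts of α trades area for bounce.  A state whose bounce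
-- cannot be lowered by one in this way has e + α_{k+1} < α_k for all k; a state whose area cannot
-- be lowered by one has e = 0, descents of α at most 1 (the last part being 1), and no part
-- preceded by a part smaller by 2 or more.  Both kinds of states are described by the same data:
-- the multiplicities of the parts 1, 2, … of the conjugate partition together with, for every
-- part i + 1, the numbers of parts i it has jumped over.  On the first side these numbers are the
-- amounts by which A^f moves rows, on the second side they are the exponents of B_f, each S
-- exchanging neighbours i + 1 and i.  So Φ swaps area and bounce on both kinds of states, and
-- minimality on one side gives minimality on the other.

module Submission where

open import Defs
open import Data.Bool using (Bool; true; false; _∧_; if_then_else_; T)
open import Data.Bool.Properties using (T-∧)
open import Data.Empty using (⊥-elim)
open import Data.List using (List; []; _∷_; _++_; length; map; replicate; reverse; applyUpTo; concat; foldl; _∷ʳ_)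
open import Data.List.Properties using (++-assoc; length-++; length-map; length-replicate; ++-identityʳ; ++-cancelˡ; unfold-reverse; length-reverse; reverse-injective; ∷-injective; reverse-++; map-++; map-∘; map-id; map-replicate; map-applyUpTo; foldl-++)
open import Data.List.Relation.Unary.All using (All; []; _∷_; all?)
import Data.List.Relation.Unary.All as All
import Data.List.Relation.Unary.All.Properties as All
open import Data.List.Relation.Unary.Any using (Any; here; there; any?)
open import Data.List.Relation.Unary.Linked using (Linked; []; [-]; _∷_)
open import Data.Maybe using (Maybe; just; nothing)
open import Data.Maybe.Properties using (just-injective)
open import Data.Nat
open import Data.Nat.ListAction using (sum)
open import Data.Nat.ListAction.Properties using (sum-++)
open import Data.Nat.Properties
open import Data.Nat.Tactic.RingSolver using (solve-∀)
open import Data.Product using (Σ; _×_; _,_; proj₁; proj₂)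
open import Data.Sum using (_⊎_; inj₁; inj₂)
open import Data.Unit using (⊤; tt)
open import Function.Bundles using (Equivalence)
open import Relation.Binary.Definitions using (tri<; tri≈; tri>)
open import Relation.Binary.PropositionalEquality
open import Relation.Nullary using (yes; no; ¬_)

-- The stuck conditions are used only as necessary conditions for minimality. Trades keep area plus
-- bounce fixed and change each by one, so every path also descends to a stuck path with the same
-- sum. Every stuck path, on either side, is one of the two paths of some `Data n`; hence a
-- competitor is pushed down to a datum and compared through its partner on the other side. Single
-- trades are possible because the excess is an undivided pool, bounded only in total by `cap`; the
-- search order, left to right for area and right to left for bounce, makes this bound survive the
-- trade. When a part u is followed later by a part of size at least u + 2, the obvious lowering of
-- the area by one can raise the bounce too much, and the surplus is removed by letting u travel to
-- the right. A separate obstacle is that Φ is given through a choice of (f, λ). The bound f(i,1) <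
-- λ̄_i keeps the bounce composition of the moved path equal to λ, so the path determines λ, and the
-- displacements of its rows then determine f on the index set.

Positive : List ℕ → Set
Positive = All (0 <_)

-- Statistics of compositions and unit trades

tri : ℕ → ℕ
tri zero = 0
tri (suc n) = n + tri n

tris : List ℕ → ℕ
tris [] = 0
tris (x ∷ α) = tri x + tris α

-- A part is counted once for each earlier part, which gives the sum of (k-1) α_k. The tail sums are
-- the numbers n - b_k, so this is the bounce.
wt : List ℕ → ℕ
wt [] = 0
wt (x ∷ α) = sum α + wt α

-- The excess of a path with bounce composition α over p_α is at most cap 1 α:
-- a row of block k can be moved left by at most α_{k-1} - 1.
cap : ℕ → List ℕ → ℕ
cap w [] = 0
cap w (a ∷ α) = a * (w ∸ 1) + cap a α

-- A certificate for linear arithmetic: with an explicit slack `x`, the capacity bounds below reduce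
-- to ring identities.
≤-by : ∀ {a b L R} x → L ≤ R → a + R + x ≡ b + L → a ≤ b
≤-by {a} {b} {L} {R} x L≤R eq = +-cancelʳ-≤ R a b
  (≤-trans (m≤m+n (a + R) x) (≤-trans (≤-reflexive eq) (+-monoʳ-≤ b L≤R)))

-- One unit of area is traded for one unit of bounce, at constant semilength.
record Trade (α : List ℕ) (e : ℕ) (α′ : List ℕ) (e′ : ℕ) : Set where
  constructor mkTrade
  field
    sum≡ : sum α′ ≡ sum α
    area≡ : suc (tris α′ + e′) ≡ tris α + e
    wt≡ : wt α′ ≡ suc (wt α)

-- Meant for a suffix `α` of a composition: `w` is the part before it and `pre` the capacity of the
-- blocks already passed, so a trade found deep inside can be carried back to the whole composition.
record Valid (pre w : ℕ) (α : List ℕ) (e : ℕ) : Set where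
  constructor mkValid
  field
    pos : Positive α
    cap≤ : e ≤ pre + cap w α

LessArea LessBounce : ℕ → ℕ → List ℕ → ℕ → Set
LessArea pre w α e = Σ (List ℕ) λ α′ → Σ ℕ λ e′ → Valid pre w α′ e′ × Trade α e α′ e′
LessBounce pre w α e = Σ (List ℕ) λ α′ → Σ ℕ λ e′ → Valid pre w α′ e′ × Trade α′ e′ α e

trade-∷ : ∀ {α e α′ e′} x → Trade α e α′ e′ → Trade (x ∷ α) e (x ∷ α′) e′
trade-∷ {α} {e} {α′} {e′} x (mkTrade s a w) = mkTrade (cong (x +_) s)
  (trans (cong suc (+-assoc (tri x) (tris α′) e′))
    (trans (sym (+-suc (tri x) (tris α′ + e′)))
      (trans (cong (tri x +_) a) (sym (+-assoc (tri x) (tris α) e)))))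
  (trans (cong₂ _+_ s w) (+-suc (sum α) (wt α)))

valid-∷ : ∀ {pre w α e x} → 0 < x → Valid (pre + x * (w ∸ 1)) x α e → Valid pre w (x ∷ α) e
valid-∷ {pre} {w} {α} {e} {x} px (mkValid p c) =
  mkValid (px ∷ p) (subst (e ≤_) (+-assoc pre (x * (w ∸ 1)) (cap x α)) c)

unvalid-∷ : ∀ {pre w α e x} → Valid pre w (x ∷ α) e → Valid (pre + x * (w ∸ 1)) x α e
unvalid-∷ {pre} {w} {α} {e} {x} (mkValid (_ ∷ p) c) =
  mkValid p (subst (e ≤_) (sym (+-assoc pre (x * (w ∸ 1)) (cap x α))) c)

lessArea-∷ : ∀ {pre w α e x} → 0 < x → LessArea (pre + x * (w ∸ 1)) x α e → LessArea pre w (x ∷ α) e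
lessArea-∷ {x = x} px (α′ , e′ , v , s) = x ∷ α′ , e′ , valid-∷ px v , trade-∷ x s

lessBounce-∷ : ∀ {pre w α e x} → 0 < x → LessBounce (pre + x * (w ∸ 1)) x α e → LessBounce pre w (x ∷ α) e
lessBounce-∷ {x = x} px (α′ , e′ , v , s) = x ∷ α′ , e′ , valid-∷ px v , trade-∷ x s

cap-mono : ∀ {v w} α → v ≤ w → cap v α ≤ cap w α
cap-mono [] v≤w = z≤n
cap-mono (a ∷ α) v≤w = +-monoˡ-≤ (cap a α) (*-monoʳ-≤ a (∸-monoˡ-≤ 1 v≤w))

-- Lowering the area

-- Moving a unit from `x` to its right neighbour y raises the weight by one; the area drops by
-- exactly one if the new excess is e + x - 2 - y. The second alternative says that this number
-- would be negative. A missing neighbour counts as 0.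
Stuck : ℕ → List ℕ → Set
Stuck e [] = ⊤
Stuck e (x ∷ α) = (x ≡ 1 ⊎ e + x ≤ suc (headOr0 α)) × Stuck e α

private
  slack-first : ∀ pre x y e e′ C C′ → C ≤ C′ → y + e′ ≡ e + x →
    e ≤ pre + ((2 + x) * 0 + (y * (1 + x) + C)) →
    e′ ≤ pre + ((1 + x) * 0 + ((1 + y) * x + C′))
  slack-first pre x y e e′ C C′ C≤C′ eq h =
    ≤-by 0 (+-mono-≤ h (+-mono-≤ C≤C′ (≤-reflexive eq))) (ring pre x y e e′ C C′)
    where
    ring : ∀ pre x y e e′ C C′ →
      e′ + (pre + ((2 + x) * 0 + (y * (1 + x) + C)) + (C′ + (e + x))) + 0
        ≡ pre + ((1 + x) * 0 + ((1 + y) * x + C′)) + (e + (C + (y + e′)))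
    ring = solve-∀

  slack-later : ∀ pre w x y e e′ C′ → y + e′ ≡ e + x → e + (2 + w) ≤ suc (2 + x) →
    e′ ≤ pre + ((1 + x) * (1 + w) + ((1 + y) * x + C′))
  slack-later pre w x y e e′ C′ eq h =
    ≤-by (pre + C′ + 2 * w + x * w + y * x + y) (+-mono-≤ h (≤-reflexive eq)) (ring pre w x y e e′ C′)
    where
    ring : ∀ pre w x y e e′ C′ →
      e′ + (suc (2 + x) + (e + x)) + (pre + C′ + 2 * w + x * w + y * x + y)
        ≡ pre + ((1 + x) * (1 + w) + ((1 + y) * x + C′)) + (e + (2 + w) + (y + e′))
    ring = solve-∀

  slack : ∀ pre w x y e e′ C C′ → w ≡ 1 ⊎ (2 ≤ w × e + w ≤ suc (2 + x)) → C ≤ C′ → y + e′ ≡ e + x →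
    e ≤ pre + ((2 + x) * (w ∸ 1) + (y * (1 + x) + C)) →
    e′ ≤ pre + ((1 + x) * (w ∸ 1) + ((1 + y) * x + C′))
  slack pre w x y e e′ C C′ (inj₁ refl) C≤ eq h = slack-first pre x y e e′ C C′ C≤ eq h
  slack pre (suc (suc w)) x y e e′ C C′ (inj₂ (_ , h′)) C≤ eq h = slack-later pre w x y e e′ C′ eq h′
  slack pre (suc zero) x y e e′ C C′ (inj₂ (s≤s () , _)) C≤ eq h

  area-transfer : ∀ x y e e′ t T → y + e′ ≡ e + x →
    suc (x + t + (y + T) + e′) ≡ suc x + (x + t) + T + e
  area-transfer x y e e′ t T eq = trans (l x y e′ t T) (trans (cong (λ q → suc (x + t + T + q)) eq) (r x e t T))
    where
    l : ∀ x y e′ t T → suc (x + t + (y + T) + e′) ≡ suc (x + t + T + (y + e′))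
    l = solve-∀
    r : ∀ x e t T → suc (x + t + T + (e + x)) ≡ suc x + (x + t) + T + e
    r = solve-∀

-- The area equation forces the new excess. Without a right neighbour the unit opens a new last part
-- 1.
transfer-right : ∀ pre w x α e → Valid pre w (suc (suc x) ∷ α) e →
  w ≡ 1 ⊎ (2 ≤ w × e + w ≤ suc (2 + x)) → headOr0 α ≤ e + x → LessArea pre w (suc (suc x) ∷ α) e
transfer-right pre w x [] e (mkValid _ c) hw h =
  suc x ∷ 1 ∷ [] , e + x ,
  mkValid (s≤s z≤n ∷ s≤s z≤n ∷ []) (slack pre w x 0 e (e + x) 0 0 hw z≤n refl c) ,
  mkTrade (+-suc (suc x) 0) (area-transfer x 0 e (e + x) (tri x) 0 refl) refl
transfer-right pre w x (y ∷ Q) e (mkValid (_ ∷ _ ∷ p) c) hw h with m≤n⇒∃[o]m+o≡n h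
... | e′ , eq =
  suc x ∷ suc y ∷ Q , e′ ,
  mkValid (s≤s z≤n ∷ s≤s z≤n ∷ p)
    (slack pre w x y e e′ (cap y Q) (cap (suc y) Q) hw (cap-mono Q (n≤1+n y)) eq c) ,
  mkTrade (+-suc (suc x) (y + sum Q))
    (trans (cong (λ q → suc (x + tri x + q + e′)) (+-assoc y (tri y) (tris Q)))
      (area-transfer x y e e′ (tri x) (tri y + tris Q) eq))
    refl

-- Shrinking the head loses capacity `w ∸ 1`. Scanning from the left makes this harmless: either `w`
-- is 1 and nothing is lost there, or the part `w` is already stuck against the head, which makes
-- `e` so small that the new capacity suffices by itself.
find-transfer : ∀ pre w α e → Valid pre w α e →
  w ≡ 1 ⊎ (2 ≤ w × e + w ≤ suc (headOr0 α)) → LessArea pre w α e ⊎ Stuck e α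
find-transfer pre w [] e v hw = inj₂ tt
find-transfer pre w (zero ∷ α) e (mkValid (() ∷ _) _) hw
find-transfer pre w (suc zero ∷ α) e v hw
  with find-transfer (pre + 1 * (w ∸ 1)) 1 α e (unvalid-∷ v) (inj₁ refl)
... | inj₁ r = inj₁ (lessArea-∷ (s≤s z≤n) r)
... | inj₂ s = inj₂ (inj₁ refl , s)
find-transfer pre w (suc (suc x) ∷ α) e v hw with headOr0 α ≤? e + x
... | yes h = inj₁ (transfer-right pre w x α e v hw h)
... | no ¬h
  with find-transfer (pre + suc (suc x) * (w ∸ 1)) (suc (suc x)) α e (unvalid-∷ v) (inj₂ (s≤s (s≤s z≤n) , bound))
  where
  bound : e + suc (suc x) ≤ suc (headOr0 α)
  bound = subst (_≤ suc (headOr0 α)) (sym (trans (+-suc e (suc x)) (cong suc (+-suc e x)))) (s≤s (≰⇒> ¬h))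
... | inj₁ r = inj₁ (lessArea-∷ (s≤s z≤n) r)
... | inj₂ s = inj₂ (inj₂ (subst (_≤ suc (headOr0 α)) (sym (trans (+-suc e (suc x)) (cong suc (+-suc e x)))) (s≤s (≰⇒> ¬h))) , s)

-- From the right: if the parts behind `x` are all 1, positive excess leaves no room for `x` above
-- 1. Since such a composition has capacity 0, a stuck state has no excess at all.
stuck-ones : ∀ e α → Positive α → Stuck (suc e) α → All (_≡ 1) α
stuck-ones e [] p s = []
stuck-ones e (x ∷ α) (px ∷ p) (sx , s) with stuck-ones e α p s
... | ones = go sx ∷ ones
  where
  head≤1 : ∀ {α} → All (_≡ 1) α → headOr0 α ≤ 1
  head≤1 [] = z≤n
  head≤1 (refl ∷ _) = ≤-refl
  go : x ≡ 1 ⊎ suc e + x ≤ suc (headOr0 α) → x ≡ 1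
  go (inj₁ q) = q
  go (inj₂ q) = ≤-antisym (≤-trans (m≤n+m x e) (≤-trans (s≤s⁻¹ q) (head≤1 ones))) px

cap-ones : ∀ α → All (_≡ 1) α → cap 1 α ≡ 0
cap-ones [] [] = refl
cap-ones (.1 ∷ α) (refl ∷ o) = cap-ones α o

-- Since headOr0 [] = 0, the first condition also forces the last part to be 1.
ND : List ℕ → Set
ND [] = ⊤
ND (x ∷ α) = x ≤ suc (headOr0 α) × All (_≤ suc x) α × ND α

private
  tri-+ : ∀ u t s → tri (u + t) + tri (u + s) + t * s ≡ tri u + tri (u + (t + s))
  tri-+ zero t s = go t s
    where
    go : ∀ t s → tri t + tri s + t * s ≡ tri (t + s)
    go zero s = +-identityʳ (tri s)
    go (suc t) s = trans (r t s (tri t) (tri s)) (cong (t + s +_) (go t s))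
      where
      r : ∀ t s T S → t + T + S + (s + t * s) ≡ t + s + (T + S + t * s)
      r = solve-∀
  tri-+ (suc u) t s = trans (l u t s (tri (u + t)) (tri (u + s))) (trans (cong (u + (u + (t + s)) +_) (tri-+ u t s)) (r u (tri u) (u + (t + s)) (tri (u + (t + s)))))
    where
    l : ∀ u t s T S → u + t + T + (u + s + S) + t * s ≡ u + (u + (t + s)) + (T + S + t * s)
    l = solve-∀
    r : ∀ u a b c → u + b + (a + c) ≡ u + a + (b + c)
    r = solve-∀

-- `V′` replaces `u ∷ V` in front of the untouched suffix `R`, the weight falls by `t`, and `gain`
-- is the excess that makes up for the triangular area lost.
record Swept (w u t : ℕ) (V R : List ℕ) : Set where
  constructor mkSwept
  field
    V′ : List ℕ
    gain : ℕ
    pos : Positive V′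
    sum≡ : sum V′ ≡ u + sum V
    wt≡ : wt (V′ ++ R) + t ≡ wt (u ∷ V ++ R)
    area≡ : tris V′ + gain ≡ tri u + tris V
    cap≤ : gain ≤ cap w (V′ ++ R)

-- The part u travels to the right through larger parts; passing y completely lowers
-- the weight by y - u, and a partial passage moves only some of the units.
sweep : ∀ w u t V R → 0 < u → All (u <_) V → t ≤ length V → Swept w u t V R
sweep w u zero [] R pu [] z≤n = mkSwept (u ∷ []) 0 (pu ∷ []) refl (+-identityʳ _) (+-identityʳ _) z≤n
sweep w u t (y ∷ V) R pu (u<y ∷ pV) t≤ with m≤n⇒∃[o]m+o≡n (<⇒≤ u<y)
... | d , refl with d ≤? t
...   | yes d≤t with m≤n⇒∃[o]m+o≡n d≤t
...     | t′ , refl with sweep (u + d) u t′ V R pu pV t′≤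
  where
  0<d : 0 < d
  0<d = +-cancelˡ-≤ u 1 d (subst (_≤ u + d) (sym (+-comm u 1)) u<y)
  t′≤ : t′ ≤ length V
  t′≤ = s≤s⁻¹ (≤-trans (+-monoˡ-≤ t′ 0<d) t≤)
...       | mkSwept V′ g p s w≡ a c = mkSwept (u + d ∷ V′) g (≤-trans pu (m≤m+n u d) ∷ p)
            (trans (cong (u + d +_) s) (swap (u + d) u (sum V)))
            weight
            (trans (+-assoc (tri (u + d)) (tris V′) g) (trans (cong (tri (u + d) +_) a) (swap (tri (u + d)) (tri u) (tris V))))
            (≤-trans c (m≤n+m _ _))
  where
  swap : ∀ a b c → a + (b + c) ≡ b + (a + c)
  swap = solve-∀
  sums : sum (V′ ++ R) ≡ u + sum (V ++ R)
  sums = trans (sum-++ V′ R) (trans (cong (_+ sum R) s) (trans (+-assoc u (sum V) (sum R)) (cong (u +_) (sym (sum-++ V R)))))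
  weight : sum (V′ ++ R) + wt (V′ ++ R) + (d + t′) ≡ u + d + sum (V ++ R) + (sum (V ++ R) + wt (V ++ R))
  weight = trans (cong (λ q → q + wt (V′ ++ R) + (d + t′)) sums)
    (trans (l u (sum (V ++ R)) (wt (V′ ++ R)) d t′)
      (cong (u + d + sum (V ++ R) +_) w≡))
    where
    l : ∀ u S W d t → u + S + W + (d + t) ≡ u + d + S + (W + t)
    l = solve-∀
sweep w u t (y ∷ V) R pu (u<y ∷ pV) t≤ | d , refl | no d≰t with m≤n⇒∃[o]m+o≡n (<⇒≤ (≰⇒> d≰t))
-- Here `y` is `u + (t + s)`: only `t` of its units move left. By `tri-+` this loses area `t * s`,
-- and that much excess fits into the second of the two blocks because `u` is positive.
... | s , refl = mkSwept (u + t ∷ u + s ∷ V) (t * s)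
        (≤-trans pu (m≤m+n u t) ∷ ≤-trans pu (m≤m+n u s) ∷ All.map (≤-<-trans z≤n) pV)
        (sums u t s (sum V))
        (weight u t s (sum (V ++ R)) (wt (V ++ R)))
        (trans (l (tri (u + t)) (tri (u + s)) (tris V) (t * s)) (trans (cong (_+ tris V) (tri-+ u t s)) (+-assoc (tri u) (tri (u + (t + s))) (tris V))))
        (≤-trans (bound pu) (≤-trans (m≤m+n ((u + s) * (u + t ∸ 1)) (cap (u + s) (V ++ R))) (m≤n+m _ ((u + t) * (w ∸ 1)))))
  where
  sums : ∀ u t s S → u + t + (u + s + S) ≡ u + (u + (t + s) + S)
  sums = solve-∀
  weight : ∀ u t s S W → u + s + S + (S + W) + t ≡ u + (t + s) + S + (S + W)
  weight = solve-∀
  l : ∀ a b c d → a + (b + c) + d ≡ a + b + d + c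
  l = solve-∀
  bound : 0 < u → t * s ≤ (u + s) * (u + t ∸ 1)
  bound (s≤s {n = u′} _) = subst (_≤ (u + s) * (u′ + t)) (*-comm s t) (*-mono-≤ (m≤n+m s u) (m≤n+m t u′))

record Peak (u : ℕ) (β : List ℕ) : Set where
  constructor mkPeak
  field
    Y Q R : List ℕ
    Y> : All (u <_) Y
    Q> : All (u <_) Q
    split : β ≡ Y ++ suc (suc u) ∷ Q ++ u ∷ R

-- Descents are at most 1 and the list ends in 1, so going down from above `u` cannot skip the value
-- `u`.
reach : ∀ u β → 0 < u → ND β → u < headOr0 β → Σ (List ℕ) λ Q → Σ (List ℕ) λ R → All (u <_) Q × β ≡ Q ++ u ∷ R
reach u (x ∷ β) pu (x≤ , _ , nd) u<x with m≤n⇒m<n∨m≡n (s≤s⁻¹ (≤-trans u<x x≤))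
... | inj₂ eq with head-∷ β pu eq
  where
  head-∷ : ∀ β → 0 < u → u ≡ headOr0 β → Σ (List ℕ) λ R → β ≡ u ∷ R
  head-∷ [] () refl
  head-∷ (y ∷ R) _ refl = R , refl
...   | R , refl = x ∷ [] , R , u<x ∷ [] , refl
reach u (x ∷ β) pu (x≤ , _ , nd) u<x | inj₁ u<y with reach u β pu nd u<y
... | Q , R , Q> , eq = x ∷ Q , R , u<x ∷ Q> , cong (x ∷_) eq

any-head : ∀ u β → ND β → Any (suc (suc u) ≤_) β → u < headOr0 β
any-head u (x ∷ β) nd (here h) = ≤-trans (n≤1+n _) h
any-head u (x ∷ β) (_ , al , _) (there a) = s≤s⁻¹ (All.lookupWith (λ z≤ z≥ → ≤-trans z≥ z≤) al a)

-- The last part that is at least `u + 2` is taken. Its successor is at most `u + 1` and descents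
-- are at most 1, so it equals `u + 2`; everything before it exceeds `u` by `any-head`.
find-peak : ∀ u β → 0 < u → ND β → Any (suc (suc u) ≤_) β → Peak u β
find-peak u (x ∷ β) pu nd@(x≤ , al , ndβ) an with any? (suc (suc u) ≤?_) β
... | yes an′ with find-peak u β pu ndβ an′
...   | mkPeak Y Q R Y> Q> eq = mkPeak (x ∷ Y) Q R (any-head u (x ∷ β) nd an ∷ Y>) Q> (cong (x ∷_) eq)
find-peak u (x ∷ β) pu (x≤ , al , ndβ) (there an) | no ¬an = ⊥-elim (¬an an)
find-peak u (x ∷ β) pu (x≤ , al , ndβ) (here 2+u≤x) | no ¬an with reach u β pu ndβ (s≤s⁻¹ (≤-trans 2+u≤x x≤))
... | Q , R , Q> , refl = mkPeak [] Q R [] Q> (cong (_∷ Q ++ u ∷ R) (≤-antisym (≤-trans x≤ (s≤s (top Q ¬an))) 2+u≤x))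
  where
  top : ∀ Q → ¬ Any (suc (suc u) ≤_) (Q ++ u ∷ R) → headOr0 (Q ++ u ∷ R) ≤ suc u
  top [] na = n≤1+n u
  top (q ∷ Q) na = s≤s⁻¹ (≰⇒> (λ h → na (here h)))

tris-++ : ∀ α β → tris (α ++ β) ≡ tris α + tris β
tris-++ [] β = refl
tris-++ (x ∷ α) β = trans (cong (tri x +_) (tris-++ α β)) (sym (+-assoc (tri x) (tris α) (tris β)))

wt-cong-++ : ∀ P {α β} → sum α ≡ sum β → ∀ k → wt α + k ≡ wt β → wt (P ++ α) + k ≡ wt (P ++ β)
wt-cong-++ [] s k w = w
wt-cong-++ (x ∷ P) {α} {β} s k w = trans (+-assoc (sum (P ++ α)) (wt (P ++ α)) k)
  (cong₂ _+_ (trans (sum-++ P α) (trans (cong (sum P +_) s) (sym (sum-++ P β)))) (wt-cong-++ P s k w))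

private
  wt-move : ∀ u Q R → wt (suc (suc u) ∷ Q ++ u ∷ R) + suc (length Q) ≡ wt (suc u ∷ Q ++ suc u ∷ R)
  wt-move u Q R = trans (l (sum (Q ++ u ∷ R)) (wt (Q ++ u ∷ R)) (length Q)) (cong₂ _+_ (s Q) (w Q))
    where
    l : ∀ a b c → a + b + suc c ≡ suc a + (b + c)
    l = solve-∀
    s : ∀ Q → suc (sum (Q ++ u ∷ R)) ≡ sum (Q ++ suc u ∷ R)
    s [] = refl
    s (q ∷ Q) = trans (sym (+-suc q _)) (cong (q +_) (s Q))
    w : ∀ Q → wt (Q ++ u ∷ R) + length Q ≡ wt (Q ++ suc u ∷ R)
    w [] = +-identityʳ _
    w (q ∷ Q) = trans (l (sum (Q ++ u ∷ R)) (wt (Q ++ u ∷ R)) (length Q)) (cong₂ _+_ (s Q) (w Q))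

-- Replacing the pair `u + 2`, `u` around `Q` by `u + 1`, `u + 1` lowers the area by one but raises
-- the weight by `length Q + 1`. Sweeping the leading `u` through the larger parts takes back
-- `length Q` of this; enough parts are available, since those of `Q` are among them.
lower-peak : ∀ pre w u β → 0 < u → Positive β → Peak u β → LessArea pre w (u ∷ β) 0
lower-peak pre w u _ pu pβ (mkPeak Y Q R Y> Q> refl)
  with sweep w u (length Q) (Y ++ suc u ∷ Q ++ suc u ∷ []) R pu
         (All.++⁺ Y> (≤-refl ∷ All.++⁺ Q> (≤-refl ∷ [])))
         (subst (length Q ≤_) (sym (len Y)) (≤-trans (m≤m+n (length Q) 1) (≤-trans (n≤1+n _) (m≤n+m _ (length Y)))))
  where
  len : ∀ Y → length (Y ++ suc u ∷ Q ++ suc u ∷ []) ≡ length Y + suc (length Q + 1)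
  len Y = trans (length-++ Y) (cong (λ q → length Y + suc q) (length-++ Q))
... | mkSwept V′ g p s w≡ a c = V′ ++ R , g ,
      mkValid (All.++⁺ p (tailPos Y pβ)) (≤-trans c (m≤n+m _ pre)) ,
      mkTrade sums areas weight
  where
  N₁ N₂ : List ℕ
  N₁ = suc u ∷ Q ++ suc u ∷ R
  N₂ = suc (suc u) ∷ Q ++ u ∷ R
  assoc : (Y ++ suc u ∷ Q ++ suc u ∷ []) ++ R ≡ Y ++ N₁
  assoc = trans (++-assoc Y (suc u ∷ Q ++ suc u ∷ []) R) (cong (λ q → Y ++ suc u ∷ q) (++-assoc Q (suc u ∷ []) R))
  tailPos : ∀ Y → Positive (Y ++ N₂) → Positive R
  tailPos Y ps with All.++⁻ʳ Y ps
  ... | _ ∷ ps′ with All.++⁻ʳ Q ps′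
  ...   | _ ∷ ps″ = ps″
  sumN : sum N₂ ≡ sum N₁
  sumN = trans (cong (suc (suc u) +_) (sum-++ Q (u ∷ R))) (trans (l u (sum Q) (sum R)) (cong (suc u +_) (sym (sum-++ Q (suc u ∷ R)))))
    where
    l : ∀ u q r → suc (suc u) + (q + (u + r)) ≡ suc u + (q + (suc u + r))
    l = solve-∀
  sums : sum (V′ ++ R) ≡ u + sum (Y ++ N₂)
  sums = trans (sum-++ V′ R) (trans (cong (_+ sum R) s) (trans (+-assoc u _ (sum R))
    (cong (u +_) (trans (sym (sum-++ (Y ++ suc u ∷ Q ++ suc u ∷ []) R)) (trans (cong sum assoc)
      (trans (sum-++ Y N₁) (trans (cong (sum Y +_) (sym sumN)) (sym (sum-++ Y N₂)))))))))
  trisN : suc (tris N₁) ≡ tris N₂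
  trisN = trans (cong (λ q → suc (tri (suc u) + q)) (tris-++ Q (suc u ∷ R)))
    (trans (l u (tri u) (tris Q) (tris R)) (cong (tri (suc (suc u)) +_) (sym (tris-++ Q (u ∷ R)))))
    where
    l : ∀ u T q r → suc (u + T + (q + (u + T + r))) ≡ suc u + (u + T) + (q + (T + r))
    l = solve-∀
  areas : suc (tris (V′ ++ R) + g) ≡ tri u + tris (Y ++ N₂) + 0
  areas = trans (cong (λ q → suc (q + g)) (tris-++ V′ R))
    (trans (l (tris V′) (tris R) g) (trans (cong (λ q → suc (q + tris R)) a)
    (trans (cong suc (+-assoc (tri u) _ (tris R)))
    (trans (cong (λ q → suc (tri u + q)) (trans (sym (tris-++ (Y ++ suc u ∷ Q ++ suc u ∷ []) R)) (trans (cong tris assoc) (tris-++ Y N₁))))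
    (trans (l′ (tri u) (tris Y) (tris N₁)) (cong (λ q → tri u + q + 0) (trans (cong (tris Y +_) trisN) (sym (tris-++ Y N₂)))))))))
    where
    l : ∀ a b c → suc (a + b + c) ≡ suc (a + c + b)
    l = solve-∀
    l′ : ∀ a b c → suc (a + (b + c)) ≡ a + (b + suc c) + 0
    l′ = solve-∀
  weight : wt (V′ ++ R) ≡ suc (wt (u ∷ Y ++ N₂))
  weight = +-cancelʳ-≡ (length Q) _ _ (trans w≡ (trans (cong (λ q → sum q + wt q) assoc)
    (trans (sym (wt-cong-++ (u ∷ Y) {N₂} {N₁} sumN (suc (length Q)) (wt-move u Q R)))
      (+-suc (wt (u ∷ Y ++ N₂)) (length Q)))))

find-peaks : ∀ pre w α → Positive α → Stuck 0 α → LessArea pre w α 0 ⊎ ND α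
find-peaks pre w [] p s = inj₂ tt
find-peaks pre w (x ∷ α) (px ∷ p) (sx , s) with find-peaks (pre + x * (w ∸ 1)) x α p s
... | inj₁ r = inj₁ (lessArea-∷ px r)
... | inj₂ nd with all? (_≤? suc x) α
...   | yes al = inj₂ (sx′ sx , al , nd)
  where
  sx′ : x ≡ 1 ⊎ 0 + x ≤ suc (headOr0 α) → x ≤ suc (headOr0 α)
  sx′ (inj₁ refl) = s≤s z≤n
  sx′ (inj₂ h) = h
...   | no ¬al = inj₁ (lower-peak pre w x α px p (find-peak x α px nd (any α ¬al)))
  where
  any : ∀ α → ¬ All (_≤ suc x) α → Any (suc (suc x) ≤_) α
  any [] na = ⊥-elim (na [])
  any (y ∷ α) na with y ≤? suc x
  ... | yes h = there (any α (λ al → na (h ∷ al)))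
  ... | no h = here (≰⇒> h)

lower-area : ∀ α e → Valid 0 1 α e → LessArea 0 1 α e ⊎ (e ≡ 0 × ND α)
lower-area α e v with find-transfer 0 1 α e v (inj₁ refl)
... | inj₁ r = inj₁ r
lower-area α (suc e) (mkValid p c) | inj₂ s
  with () ← subst (suc e ≤_) (cap-ones α (stuck-ones e α p s)) c
lower-area α zero (mkValid p c) | inj₂ s with find-peaks 0 1 α p s
... | inj₁ r = inj₁ r
... | inj₂ nd = inj₂ (refl , nd)

-- Lowering the bounce

-- Moving a unit from `y` left to `x` needs the new excess e + y - x; the condition says that it
-- would be negative.
Gapped : ℕ → List ℕ → Set
Gapped e [] = ⊤
Gapped e (x ∷ []) = ⊤
Gapped e (x ∷ α@(y ∷ _)) = e + y < x × Gapped e α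

private
  area-back : ∀ x y e e′ t T U → x + e′ ≡ e + suc y →
    suc (x + t + (T + U) + e′) ≡ suc (t + (y + T + U) + suc e)
  area-back x y e e′ t T U eq = trans (l x e′ t T U) (trans (cong (λ q → suc (t + T + U + q)) eq) (r y e t T U))
    where
    l : ∀ x e′ t T U → suc (x + t + (T + U) + e′) ≡ suc (t + T + U + (x + e′))
    l = solve-∀
    r : ∀ y e t T U → suc (t + T + U + (e + suc y)) ≡ suc (t + (y + T + U) + suc e)
    r = solve-∀

  slack-end : ∀ pre x y e e′ K → x + e′ ≡ e + suc y → 0 < x →
    e ≤ pre + (x * K + (suc y * (x ∸ 1) + 0)) → e′ ≤ pre + (suc x * K + (y * x + 0))
  slack-end pre (suc x) y e e′ K eq _ h = ≤-by K (+-mono-≤ h (≤-reflexive eq)) (r pre x y e e′ K)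
    where
    r : ∀ pre x y e e′ K → e′ + (pre + (suc x * K + (suc y * x + 0)) + (e + suc y)) + K
      ≡ pre + (suc (suc x) * K + (y * suc x + 0)) + (e + (suc x + e′))
    r = solve-∀

  slack-inner : ∀ pre x y e e′ K h C → suc x + e′ ≡ e + suc (suc y) → e + suc h < suc (suc y) →
    e′ ≤ pre + (suc (suc x) * K + (suc y * suc x + (suc h * y + C)))
  slack-inner pre x y e e′ K h C eq lt =
    ≤-by (pre + suc (suc x) * K + y * x + h * y + C + h + 2 * x) (+-mono-≤ lt (≤-reflexive eq)) (r pre x y e e′ K h C)
    where
    r : ∀ pre x y e e′ K h C →
      e′ + (suc (suc y) + (e + suc (suc y))) + (pre + suc (suc x) * K + y * x + h * y + C + h + 2 * x)
      ≡ pre + (suc (suc x) * K + (suc y * suc x + (suc h * y + C))) + (suc (e + suc h) + (suc x + e′))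
    r = solve-∀

  trade-back : ∀ x y e e′ Q → x + e′ ≡ e + suc y → Trade (suc x ∷ y ∷ Q) e′ (x ∷ suc y ∷ Q) e
  trade-back x y e e′ Q eq = mkTrade (+-suc x (y + sum Q))
    (sym (trans (suc-injective (area-back x y e e′ (tri x) (tri y) (tris Q) eq)) (+-suc _ e))) refl

-- Shrinking `y` reduces the capacity of the block after it. The scan runs from the right, so `y`
-- already exceeds `e` plus its successor; that bounds the new excess well below the capacity. A
-- last part 1 disappears, while a 1 with a successor would violate `Gapped`.
transfer-left : ∀ pre w x y Q e → Valid pre w (x ∷ y ∷ Q) e → Gapped e (y ∷ Q) → x ≤ e + y →
  LessBounce pre w (x ∷ y ∷ Q) e
transfer-left pre w x zero Q e (mkValid (_ ∷ () ∷ _) _) g h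
transfer-left pre w x (suc zero) [] e (mkValid (px ∷ _) c) g h with m≤n⇒∃[o]m+o≡n h
... | e′ , eq = suc x ∷ [] , e′ , mkValid (s≤s z≤n ∷ []) (slack-end pre x 0 e e′ (w ∸ 1) eq px c) ,
      mkTrade (+-suc x 0) (Trade.area≡ (trade-back x 0 e e′ [] eq)) refl
transfer-left pre w x (suc (suc y)) [] e (mkValid (px ∷ _) c) g h with m≤n⇒∃[o]m+o≡n h
... | e′ , eq = suc x ∷ suc y ∷ [] , e′ ,
      mkValid (s≤s z≤n ∷ s≤s z≤n ∷ []) (slack-end pre x (suc y) e e′ (w ∸ 1) eq px c) ,
      trade-back x (suc y) e e′ [] eq
transfer-left pre w x (suc y) (zero ∷ Q) e (mkValid (_ ∷ _ ∷ () ∷ _) _) g h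
transfer-left pre w x (suc zero) (suc q ∷ Q) e v (g , _) h with () ← s≤s⁻¹ (subst (_< 1) (+-suc e q) g)
transfer-left pre w zero (suc (suc y)) (suc q ∷ Q) e (mkValid (() ∷ _) _) g h
transfer-left pre w (suc x) (suc (suc y)) (suc q ∷ Q) e (mkValid (px ∷ _ ∷ pQ) c) (g , _) h with m≤n⇒∃[o]m+o≡n h
... | e′ , eq = suc (suc x) ∷ suc y ∷ suc q ∷ Q , e′ ,
      mkValid (s≤s z≤n ∷ s≤s z≤n ∷ pQ) (slack-inner pre x y e e′ (w ∸ 1) q (cap (suc q) Q) eq g) ,
      trade-back (suc x) (suc y) e e′ (suc q ∷ Q) eq

find-left : ∀ pre w α e → Valid pre w α e → LessBounce pre w α e ⊎ Gapped e α
find-left pre w [] e v = inj₂ tt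
find-left pre w (x ∷ []) e v = inj₂ tt
find-left pre w (x ∷ y ∷ Q) e v@(mkValid (px ∷ _) _)
  with find-left (pre + x * (w ∸ 1)) x (y ∷ Q) e (unvalid-∷ v)
... | inj₁ r = inj₁ (lessBounce-∷ px r)
... | inj₂ g with e + y <? x
...   | yes lt = inj₂ (lt , g)
...   | no ¬lt = inj₁ (transfer-left pre w x y Q e v g (≮⇒≥ ¬lt))

lower-bounce : ∀ α e → Valid 0 1 α e → LessBounce 0 1 α e ⊎ Gapped e α
lower-bounce α e = find-left 0 1 α e

T⇒≡ : ∀ {b} → T b → b ≡ true
T⇒≡ {true} _ = refl

T-∧⁺ : ∀ {a b} → T a → T b → T (a ∧ b)
T-∧⁺ ta tb = Equivalence.from T-∧ (ta , tb)

T-∧⁻ : ∀ {a b} → T (a ∧ b) → T a × T b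
T-∧⁻ = Equivalence.to T-∧

-- Paths and their lists of north-step abscissae

pathX : ℕ → List ℕ → Path
pathX n l = fromXGo n 0 l

VX : ℕ → ℕ → List ℕ → Set
VX c j [] = ⊤
VX c j (x ∷ l) = c ≤ x × x ≤ j × VX x (suc j) l

VX-weaken : ∀ {c c′ j} l → c ≤ c′ → VX c′ j l → VX c j l
VX-weaken [] _ _ = tt
VX-weaken (x ∷ l) h (h₁ , h₂ , v) = ≤-trans h h₁ , h₂ , v

dyckGo-end : ∀ n a b p → T (dyckGo n a b p) → b ≤ n × a ≤ n
dyckGo-end n a b [] t with T-∧⁻ {a ≡ᵇ n} t
... | t₁ , t₂ = ≤-reflexive (≡ᵇ⇒≡ b n t₂) , ≤-reflexive (≡ᵇ⇒≡ a n t₁)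
dyckGo-end n a b (N ∷ p) t with dyckGo-end n (suc a) b p t
... | h₁ , h₂ = h₁ , ≤-trans (n≤1+n a) h₂
dyckGo-end n a b (E ∷ p) t with T-∧⁻ {suc b ≤ᵇ a} t
... | _ , t₂ with dyckGo-end n a (suc b) p t₂
...   | h₁ , h₂ = ≤-trans (n≤1+n b) h₁ , h₂

xsGo-valid : ∀ n a b p → b ≤ a → T (dyckGo n a b p) → VX b a (xsGo b p)
xsGo-valid n a b [] h t = tt
xsGo-valid n a b (N ∷ p) h t = ≤-refl , h , xsGo-valid n (suc a) b p (≤-trans h (n≤1+n a)) t
xsGo-valid n a b (E ∷ p) h t with T-∧⁻ {suc b ≤ᵇ a} t
... | t₁ , t₂ = VX-weaken _ (n≤1+n b) (xsGo-valid n a (suc b) p (≤ᵇ⇒≤ (suc b) a t₁) t₂)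

xsGo-length : ∀ n a b p → T (dyckGo n a b p) → a + length (xsGo b p) ≡ n
xsGo-length n a b [] t = trans (+-identityʳ a) (≡ᵇ⇒≡ a n (proj₁ (T-∧⁻ {a ≡ᵇ n} t)))
xsGo-length n a b (N ∷ p) t = trans (+-suc a _) (xsGo-length n (suc a) b p t)
xsGo-length n a b (E ∷ p) t = xsGo-length n a (suc b) p (proj₂ (T-∧⁻ {suc b ≤ᵇ a} t))

fromXGo-E : ∀ n b j l → suc b ≤ n → VX (suc b) j l → fromXGo n b l ≡ E ∷ fromXGo n (suc b) l
fromXGo-E n b j [] h v with m≤n⇒∃[o]m+o≡n h
... | k , refl = cong (λ q → replicate q E) (trans (cong (_∸ b) (sym (+-suc b k))) (trans (m+n∸m≡n b (suc k)) (cong suc (sym (m+n∸m≡n b k)))))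
fromXGo-E n b j (x ∷ l) h (b<x , _) with m≤n⇒∃[o]m+o≡n b<x
... | k , refl = trans (cong₂ (λ u v → replicate u E ++ N ∷ fromXGo n v l)
        (trans (cong (_∸ b) (sym (+-suc b k))) (m+n∸m≡n b (suc k)))
        (trans (m≤n⇒m⊔n≡n (≤-trans (n≤1+n b) b<x)) (sym (m≤n⇒m⊔n≡n b<x))))
      (cong (λ u → E ∷ replicate u E ++ N ∷ fromXGo n (suc b ⊔ (suc b + k)) l) (sym (m+n∸m≡n b k)))

fromXGo-xsGo : ∀ n a b p → b ≤ a → T (dyckGo n a b p) → fromXGo n b (xsGo b p) ≡ p
fromXGo-xsGo n a b [] h t rewrite ≡ᵇ⇒≡ b n (proj₂ (T-∧⁻ {a ≡ᵇ n} t)) | n∸n≡0 n = refl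
fromXGo-xsGo n a b (N ∷ p) h t rewrite n∸n≡0 b | ⊔-idem b =
  cong (N ∷_) (fromXGo-xsGo n (suc a) b p (≤-trans h (n≤1+n a)) t)
fromXGo-xsGo n a b (E ∷ p) h t with T-∧⁻ {suc b ≤ᵇ a} t
... | t₁ , t₂ = trans (fromXGo-E n b a (xsGo (suc b) p) (proj₁ (dyckGo-end n a (suc b) p t₂))
                  (xsGo-valid n a (suc b) p (≤ᵇ⇒≤ (suc b) a t₁) t₂))
                (cong (E ∷_) (fromXGo-xsGo n a (suc b) p (≤ᵇ⇒≤ (suc b) a t₁) t₂))

dyckGo-Es : ∀ n a b k s → b + k ≤ a → T (dyckGo n a (b + k) s) → T (dyckGo n a b (replicate k E ++ s))
dyckGo-Es n a b zero s h t rewrite +-identityʳ b = t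
dyckGo-Es n a b (suc k) s h t = T-∧⁺ (≤⇒≤ᵇ (≤-trans (s≤s (m≤m+n b k)) (subst (_≤ a) (+-suc b k) h)))
  (dyckGo-Es n a (suc b) k s (subst (_≤ a) (+-suc b k) h) (subst (λ q → T (dyckGo n a q s)) (+-suc b k) t))

dyckGo-Ns : ∀ n a b k s → T (dyckGo n (k + a) b s) → T (dyckGo n a b (replicate k N ++ s))
dyckGo-Ns n a b zero s t = t
dyckGo-Ns n a b (suc k) s t = dyckGo-Ns n (suc a) b k s (subst (λ q → T (dyckGo n q b s)) (sym (+-suc k a)) t)

xsGo-Es : ∀ b k s → xsGo b (replicate k E ++ s) ≡ xsGo (b + k) s
xsGo-Es b zero s = cong (λ q → xsGo q s) (sym (+-identityʳ b))
xsGo-Es b (suc k) s = trans (xsGo-Es (suc b) k s) (cong (λ q → xsGo q s) (sym (+-suc b k)))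

fromXGo-dyck : ∀ n j c l → c ≤ j → VX c j l → j + length l ≡ n → T (dyckGo n j c (fromXGo n c l))
fromXGo-dyck n j c [] h v eq rewrite trans (sym (+-identityʳ j)) eq =
  subst (λ q → T (dyckGo n n c q)) (++-identityʳ (replicate (n ∸ c) E))
    (dyckGo-Es n n c (n ∸ c) [] (≤-reflexive (m+[n∸m]≡n h))
      (subst (λ q → T (dyckGo n n q [])) (sym (m+[n∸m]≡n h)) (T-∧⁺ (≡⇒≡ᵇ n n refl) (≡⇒≡ᵇ n n refl))))
fromXGo-dyck n j c (x ∷ l) h (c≤x , x≤j , v) eq =
  dyckGo-Es n j c (x ∸ c) _ (subst (_≤ j) (sym (m+[n∸m]≡n c≤x)) x≤j)
    (subst₂ (λ q r → T (dyckGo n (suc j) q (fromXGo n r l))) (sym (m+[n∸m]≡n c≤x)) (sym (m≤n⇒m⊔n≡n c≤x))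
      (fromXGo-dyck n (suc j) x l (≤-trans x≤j (n≤1+n j)) v (trans (sym (+-suc j (length l))) eq)))

xsGo-fromXGo : ∀ n j c l → VX c j l → xsGo c (fromXGo n c l) ≡ l
xsGo-fromXGo n j c [] v = trans (cong (xsGo c) (sym (++-identityʳ (replicate (n ∸ c) E)))) (xsGo-Es c (n ∸ c) [])
xsGo-fromXGo n j c (x ∷ l) (c≤x , x≤j , v) = trans (xsGo-Es c (x ∸ c) _)
  (trans (cong₂ (λ q r → xsGo q (N ∷ fromXGo n r l)) (m+[n∸m]≡n c≤x) (m≤n⇒m⊔n≡n c≤x))
    (cong (x ∷_) (xsGo-fromXGo n (suc j) x l v)))

record ValidX (n : ℕ) (l : List ℕ) : Set where
  constructor mkVX
  field
    valid : VX 0 0 l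
    len : length l ≡ n

xs-valid : ∀ {n p} → InD n p → ValidX n (xs p)
xs-valid {n} {p} d = mkVX (xsGo-valid n 0 0 p z≤n d) (xsGo-length n 0 0 p d)

pathX-xs : ∀ {n p} → InD n p → pathX n (xs p) ≡ p
pathX-xs {n} {p} d = fromXGo-xsGo n 0 0 p z≤n d

xs-pathX : ∀ {n l} → ValidX n l → xs (pathX n l) ≡ l
xs-pathX {n} {l} (mkVX v _) = xsGo-fromXGo n 0 0 l v

pathX-dyck : ∀ {n l} → ValidX n l → InD n (pathX n l)
pathX-dyck {n} {l} (mkVX v e) = fromXGo-dyck n 0 0 l z≤n v e

eqL-refl : ∀ l → T (eqL l l)
eqL-refl [] = tt
eqL-refl (x ∷ l) = T-∧⁺ (≡⇒≡ᵇ x x refl) (eqL-refl l)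

eqL-sound : ∀ l m → T (eqL l m) → l ≡ m
eqL-sound [] [] t = refl
eqL-sound (x ∷ l) (y ∷ m) t with T-∧⁻ {x ≡ᵇ y} t
... | t₁ , t₂ = cong₂ _∷_ (≡ᵇ⇒≡ x y t₁) (eqL-sound l m t₂)

modX-just : ∀ {n i g p l} → ValidX n l → setAt (xs p) i g ≡ just l → modX n i g (just p) ≡ just (pathX n l)
modX-just {n} {i} {g} {p} {l} v eq with setAt (xs p) i g | eq
... | just .l | refl
  rewrite T⇒≡ (T-∧⁺ (subst (λ q → T (eqL q l)) (sym (xs-pathX v)) (eqL-refl l)) (pathX-dyck v)) = refl

modX-inv : ∀ {n i g p p′} → modX n i g (just p) ≡ just p′ → InD n p′ × setAt (xs p) i g ≡ just (xs p′)
modX-inv {n} {i} {g} {p} eq with setAt (xs p) i g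
... | just l with eqL (xs (fromXGo n 0 l)) l in e₁ | isDyck n (fromXGo n 0 l) in e₂
modX-inv {n} refl | just l | true | true =
  subst T (sym e₂) tt , cong just (sym (eqL-sound (xs (fromXGo n 0 l)) l (subst T (sym e₁) tt)))

-- Bounce points

cntLe : ℕ → List ℕ → ℕ
cntLe k [] = 0
cntLe k (x ∷ l) = if x ≤ᵇ k then suc (cntLe k l) else cntLe k l

cntLe-≤ : ∀ {k x} l → x ≤ k → cntLe k (x ∷ l) ≡ suc (cntLe k l)
cntLe-≤ l h rewrite T⇒≡ (≤⇒≤ᵇ h) = refl

cntLe-> : ∀ {k x} l → k < x → cntLe k (x ∷ l) ≡ cntLe k l
cntLe-> {k} {x} l h with x ≤ᵇ k in eq
... | false = refl
... | true = ⊥-elim (<⇒≱ h (≤ᵇ⇒≤ x k (subst T (sym eq) tt)))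

cntLe-none : ∀ k l → All (k <_) l → cntLe k l ≡ 0
cntLe-none k [] [] = refl
cntLe-none k (x ∷ l) (h ∷ a) = trans (cntLe-> l h) (cntLe-none k l a)

cntLe-all : ∀ k l m → All (_≤ k) l → cntLe k (l ++ m) ≡ length l + cntLe k m
cntLe-all k [] m [] = refl
cntLe-all k (x ∷ l) m (h ∷ a) = trans (cntLe-≤ (l ++ m) h) (cong suc (cntLe-all k l m a))

VX-All : ∀ {c j} l → VX c j l → All (c ≤_) l
VX-All [] _ = []
VX-All (x ∷ l) (h , _ , v) = h ∷ All.map (≤-trans h) (VX-All l v)

-- The height of an east step is the number of north steps at or left of its column's left edge.
-- Hence bounce points can be computed from the abscissae alone.
hsGo-nth : ∀ n a b p i → b ≤ a → T (dyckGo n a b p) → i + b < n →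
  nth (hsGo a p) i ≡ a + cntLe (b + i) (xsGo b p)
hsGo-nth n a b [] i h t lt =
  ⊥-elim (<⇒≱ lt (≤-trans (≤-reflexive (sym (≡ᵇ⇒≡ b n (proj₂ (T-∧⁻ {a ≡ᵇ n} t))))) (m≤n+m b i)))
hsGo-nth n a b (N ∷ p) i h t lt = trans (hsGo-nth n (suc a) b p i (≤-trans h (n≤1+n a)) t lt)
  (trans (sym (+-suc a _)) (cong (a +_) (sym (cntLe-≤ (xsGo b p) (m≤m+n b i)))))
hsGo-nth n a b (E ∷ p) zero h t lt with T-∧⁻ {suc b ≤ᵇ a} t
... | t₁ , t₂ rewrite +-identityʳ b =
  sym (trans (cong (a +_) (cntLe-none b _ (VX-All _ (xsGo-valid n a (suc b) p (≤ᵇ⇒≤ (suc b) a t₁) t₂)))) (+-identityʳ a))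
hsGo-nth n a b (E ∷ p) (suc i) h t lt with T-∧⁻ {suc b ≤ᵇ a} t
... | t₁ , t₂ = trans (hsGo-nth n a (suc b) p i (≤ᵇ⇒≤ (suc b) a t₁) t₂ (subst (_< n) (sym (+-suc i b)) lt))
  (cong (λ q → a + cntLe q (xsGo (suc b) p)) (sym (+-suc b i)))

hAt-cntLe : ∀ {n p} b → InD n p → b < n → hAt p (suc b) ≡ cntLe b (xs p)
hAt-cntLe {n} {p} b d lt = hsGo-nth n 0 0 p b z≤n d (subst (_< n) (sym (+-identityʳ b)) lt)

psums : ℕ → List ℕ → List ℕ
psums b [] = []
psums b (a ∷ α) = (b + a) ∷ psums (b + a) α

-- The bounce points of a path with abscissae X that lie beyond b are the partial sums of α.
BP : ℕ → List ℕ → ℕ → List ℕ → Set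
BP n X b [] = b ≡ n
BP n X b (a ∷ α) = 0 < a × cntLe b X ≡ b + a × BP n X (b + a) α

BP-sum : ∀ n X b α → BP n X b α → b + sum α ≡ n
BP-sum n X b [] eq = trans (+-identityʳ b) eq
BP-sum n X b (a ∷ α) (_ , _ , bp) = trans (sym (+-assoc b a (sum α))) (BP-sum n X (b + a) α bp)

bounceGo-BP : ∀ {n p} → InD n p → ∀ fuel b α → BP n (xs p) b α → sum α ≤ fuel → bounceGo n p fuel b ≡ psums b α
bounceGo-BP d zero b [] bp h = refl
bounceGo-BP d zero b (suc a ∷ α) (_ , _ , bp) ()
bounceGo-BP {n} d (suc fuel) b [] refl h rewrite T⇒≡ (≤⇒≤ᵇ (≤-refl {b})) = refl
bounceGo-BP {n} {p} d (suc fuel) b (a ∷ α) (pa , c , bp) h with n ≤ᵇ b in eq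
... | true = ⊥-elim (<⇒≱ b<n (≤ᵇ⇒≤ n b (subst T (sym eq) tt)))
  where
  b<n : b < n
  b<n = subst (b <_) (BP-sum n (xs p) b (a ∷ α) (pa , c , bp)) (m<m+n b (≤-trans pa (m≤m+n a (sum α))))
... | false rewrite hAt-cntLe {n} {p} b d (subst (b <_) (BP-sum n (xs p) b (a ∷ α) (pa , c , bp)) (m<m+n b (≤-trans pa (m≤m+n a (sum α))))) | c =
  cong (b + a ∷_) (bounceGo-BP d fuel (b + a) α bp (s≤s⁻¹ (≤-trans (+-monoˡ-≤ (sum α) pa) h)))

bounceGo-psums : ∀ {n p α} → InD n p → BP n (xs p) 0 α → bounceGo n p n 0 ≡ psums 0 α
bounceGo-psums {n} {p} {α} d bp = bounceGo-BP d n 0 α bp (≤-reflexive (BP-sum n (xs p) 0 α bp))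

diffs-psums : ∀ b α → diffs b (psums b α) ≡ α
diffs-psums b [] = refl
diffs-psums b (a ∷ α) = cong₂ _∷_ (m+n∸m≡n b a) (diffs-psums (b + a) α)

bounceComp-BP : ∀ {n p α} → InD n p → BP n (xs p) 0 α → bounceComp n p ≡ α
bounceComp-BP {α = α} d bp = trans (cong (diffs 0) (bounceGo-psums d bp)) (diffs-psums 0 α)

bounce-BP : ∀ {n p α} → InD n p → BP n (xs p) 0 α → bounce n p ≡ wt α
bounce-BP {n} {p} {α} d bp = trans (cong (λ q → sum (map (n ∸_) q)) (bounceGo-psums d bp)) (go 0 α (BP-sum n (xs p) 0 α bp))
  where
  go : ∀ b α → b + sum α ≡ n → sum (map (n ∸_) (psums b α)) ≡ wt α
  go b [] eq = refl
  go b (a ∷ α) eq = cong₂ _+_ (trans (cong (_∸ (b + a)) (sym eq′)) (m+n∸m≡n (b + a) (sum α))) (go (b + a) α eq′)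
    where
    eq′ : b + a + sum α ≡ n
    eq′ = trans (+-assoc b a (sum α)) eq

-- Block decomposition

-- The bound is strict, so passing `suc g` on expresses weak decrease after the first entry.
Desc : ℕ → List ℕ → Set
Desc c [] = ⊤
Desc c (g ∷ G) = g < c × Desc (suc g) G

-- A row moved left by less than the length of the preceding block stays strictly right of the
-- previous bounce point, so it remains in its block. The start value 1 forbids any move in the
-- first block.
Chain : ℕ → List (List ℕ) → Set
Chain w [] = ⊤
Chain w (G ∷ Gs) = 0 < length G × Desc w G × Chain (length G) Gs

toX : ℕ → List (List ℕ) → List ℕ
toX b [] = []
toX b (G ∷ Gs) = map (b ∸_) G ++ toX (b + length G) Gs

lengths : List (List ℕ) → List ℕ
lengths = map length

total : List (List ℕ) → ℕ
total Gs = sum (map sum Gs)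

Desc-weaken : ∀ {c c′} G → c ≤ c′ → Desc c G → Desc c′ G
Desc-weaken [] _ _ = tt
Desc-weaken (g ∷ G) h (h₁ , d) = ≤-trans h₁ h , d

Desc-All : ∀ {c} G → Desc c G → All (_< c) G
Desc-All [] _ = []
Desc-All (g ∷ G) (h , d) = h ∷ All.map (λ q → ≤-trans q h) (Desc-All G d)

Chain-positive : ∀ w Gs → Chain w Gs → Positive (lengths Gs)
Chain-positive w [] _ = []
Chain-positive w (G ∷ Gs) (p , _ , c) = p ∷ Chain-positive _ Gs c

toX-length : ∀ b Gs → length (toX b Gs) ≡ sum (lengths Gs)
toX-length b [] = refl
toX-length b (G ∷ Gs) = trans (length-++ (map (b ∸_) G)) (cong₂ _+_ (length-map (b ∸_) G) (toX-length _ Gs))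

VX-block : ∀ c w b j G L → Desc w G → c + w ≤ suc b → c ≤ b → b ≤ j →
  (∀ c′ → c′ ≤ b → VX c′ (j + length G) L) → VX c j (map (b ∸_) G ++ L)
VX-block c w b j [] L d h cb bj k = subst (λ q → VX c q L) (+-identityʳ j) (k c cb)
VX-block c w b j (g ∷ G) L (g<w , d) h cb bj k =
  m+n≤o⇒m≤o∸n c c+g≤b , ≤-trans (m∸n≤m b g) bj ,
  VX-block (b ∸ g) (suc g) b (suc j) G L d (≤-reflexive (trans (+-suc (b ∸ g) g) (cong suc (m∸n+n≡m (≤-trans (m≤n+m g c) c+g≤b)))))
    (m∸n≤m b g) (≤-trans bj (n≤1+n j)) (λ c′ h′ → subst (λ q → VX c′ q L) (+-suc j (length G)) (k c′ h′))
  where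
  c+g≤b : c + g ≤ b
  c+g≤b = s≤s⁻¹ (≤-trans (subst (_≤ c + w) (+-suc c g) (+-monoʳ-≤ c g<w)) h)

VX-toX : ∀ c w b Gs → Chain w Gs → c + w ≤ suc b → c ≤ b → VX c b (toX b Gs)
VX-toX c w b [] _ _ _ = tt
VX-toX c w b (G ∷ Gs) (pG , d , ch) h cb = VX-block c w b b G _ d h cb ≤-refl
  (λ c′ h′ → VX-toX c′ (length G) (b + length G) Gs ch (≤-trans (+-monoˡ-≤ (length G) h′) (n≤1+n _)) (≤-trans h′ (m≤m+n b _)))

toX-valid : ∀ {n Gs} → Chain 1 Gs → sum (lengths Gs) ≡ n → ValidX n (toX 0 Gs)
toX-valid {n} {Gs} ch eq = mkVX (VX-toX 0 1 0 Gs ch ≤-refl z≤n) (trans (toX-length 0 Gs) eq)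

toX-> : ∀ v b Gs → Chain v Gs → 0 < v → All (b <_) (toX (b + v) Gs)
toX-> v b [] _ _ = []
toX-> v b (G ∷ Gs) (pG , d , ch) pv = All.++⁺
  (All.map⁺ (All.map (λ {g} g<v → m+n≤o⇒m≤o∸n (suc b) (subst (_≤ b + v) (+-suc b g) (+-monoʳ-≤ b g<v))) (Desc-All G d)))
  (All.map (≤-<-trans (m≤m+n b v)) (toX-> (length G) (b + v) Gs ch pG))

BP-chain : ∀ n w L b Gs → Chain w Gs → length L ≡ b → All (_≤ b) L → b + sum (lengths Gs) ≡ n →
  BP n (L ++ toX b Gs) b (lengths Gs)
BP-chain n w L b [] _ _ _ eq = trans (sym (+-identityʳ b)) eq
BP-chain n w L b (G ∷ Gs) (pG , d , ch) len al eq = pG , count ,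
  subst (λ q → BP n q (b + length G) (lengths Gs)) (++-assoc L (map (b ∸_) G) _)
    (BP-chain n (length G) (L ++ map (b ∸_) G) (b + length G) Gs ch
      (trans (length-++ L) (cong₂ _+_ len (length-map (b ∸_) G)))
      (All.map (λ h → ≤-trans h (m≤m+n b _)) all≤)
      (trans (+-assoc b (length G) _) eq))
  where
  all≤ : All (_≤ b) (L ++ map (b ∸_) G)
  all≤ = All.++⁺ al (All.map⁺ (All.universal (m∸n≤m b) G))
  count : cntLe b (L ++ map (b ∸_) G ++ toX (b + length G) Gs) ≡ b + length G
  count = trans (cong (cntLe b) (sym (++-assoc L (map (b ∸_) G) _)))
    (trans (cntLe-all b (L ++ map (b ∸_) G) _ all≤)
    (trans (cong₂ _+_ (trans (length-++ L) (cong₂ _+_ len (length-map (b ∸_) G)))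
                      (cntLe-none b _ (toX-> (length G) b Gs ch pG)))
      (+-identityʳ (b + length G))))

BP-toX : ∀ {n Gs} → Chain 1 Gs → sum (lengths Gs) ≡ n → BP n (toX 0 Gs) 0 (lengths Gs)
BP-toX {n} {Gs} ch eq = BP-chain n 1 [] 0 Gs ch refl [] eq

-- `t` rows of the block have been passed; their share `tri t` is added on the left to avoid a
-- subtraction.
area-block : ∀ b t G L → All (_≤ b) G →
  areaGo (b + t) (map (b ∸_) G ++ L) + tri t ≡ tri (t + length G) + sum G + areaGo (b + (t + length G)) L
area-block b t [] L _ rewrite +-identityʳ t | +-identityʳ (tri t) = +-comm (areaGo (b + t) L) (tri t)
area-block b t (g ∷ G) L (g≤b ∷ al) with m≤n⇒∃[o]m+o≡n g≤b
... | c , refl = begin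
  (g + c + t ∸ (g + c ∸ g)) + areaGo (suc (g + c + t)) M + tri t
    ≡⟨ cong₂ (λ q r → q + areaGo r M + tri t) height (sym (+-suc (g + c) t)) ⟩
  t + g + areaGo (g + c + suc t) M + tri t
    ≡⟨ ring₁ t g (areaGo (g + c + suc t) M) (tri t) ⟩
  g + (areaGo (g + c + suc t) M + tri (suc t))
    ≡⟨ cong (g +_) (area-block (g + c) (suc t) G L al) ⟩
  g + (tri (suc t + length G) + sum G + areaGo (g + c + (suc t + length G)) L)
    ≡⟨ cong (λ q → g + (tri q + sum G + areaGo (g + c + q) L)) (sym (+-suc t (length G))) ⟩
  g + (tri (t + suc (length G)) + sum G + areaGo (g + c + (t + suc (length G))) L)
    ≡⟨ ring₂ g (tri (t + suc (length G))) (sum G) _ ⟩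
  tri (t + suc (length G)) + (g + sum G) + areaGo (g + c + (t + suc (length G))) L ∎
  where
  open ≡-Reasoning
  M = map (g + c ∸_) G ++ L
  height : g + c + t ∸ (g + c ∸ g) ≡ t + g
  height = trans (cong (g + c + t ∸_) (m+n∸m≡n g c)) (trans (cong (_∸ c) (ring g c t)) (m+n∸m≡n c (t + g)))
    where
    ring : ∀ g c t → g + c + t ≡ c + (t + g)
    ring = solve-∀
  ring₁ : ∀ t g a T → t + g + a + T ≡ g + (a + (t + T))
  ring₁ = solve-∀
  ring₂ : ∀ g a b c → g + (a + b + c) ≡ a + (g + b) + c
  ring₂ = solve-∀

area-toX : ∀ w b Gs → Chain w Gs → w ≤ suc b → areaGo b (toX b Gs) ≡ tris (lengths Gs) + total Gs
area-toX w b [] _ _ = refl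
area-toX w b (G ∷ Gs) (pG , d , ch) h = begin
  areaGo b (map (b ∸_) G ++ toX (b + length G) Gs)
    ≡⟨ cong (λ q → areaGo q (map (b ∸_) G ++ toX (b + length G) Gs)) (sym (+-identityʳ b)) ⟩
  areaGo (b + 0) (map (b ∸_) G ++ toX (b + length G) Gs)
    ≡⟨ sym (+-identityʳ _) ⟩
  areaGo (b + 0) (map (b ∸_) G ++ toX (b + length G) Gs) + 0
    ≡⟨ area-block b 0 G _ (All.map (λ q → s≤s⁻¹ (≤-trans q h)) (Desc-All G d)) ⟩
  tri (length G) + sum G + areaGo (b + length G) (toX (b + length G) Gs)
    ≡⟨ cong (tri (length G) + sum G +_) (area-toX (length G) (b + length G) Gs ch (≤-trans (m≤n+m _ b) (n≤1+n _))) ⟩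
  tri (length G) + sum G + (tris (lengths Gs) + total Gs)
    ≡⟨ ring (tri (length G)) (sum G) (tris (lengths Gs)) (total Gs) ⟩
  tri (length G) + tris (lengths Gs) + (sum G + total Gs) ∎
  where
  open ≡-Reasoning
  ring : ∀ a b c d → a + b + (c + d) ≡ a + c + (b + d)
  ring = solve-∀

total≤cap : ∀ w Gs → Chain w Gs → total Gs ≤ cap w (lengths Gs)
total≤cap w [] _ = z≤n
total≤cap w (G ∷ Gs) (_ , d , ch) = +-mono-≤ (go G (Desc-All G d)) (total≤cap (length G) Gs ch)
  where
  go : ∀ G → All (_< w) G → sum G ≤ length G * (w ∸ 1)
  go [] [] = z≤n
  go (g ∷ G) (h ∷ al) = +-mono-≤ (∸-monoˡ-≤ 1 h) (go G al)

split-block : ∀ c w b j l → b < c + w → VX c j l → Σ (List ℕ) λ G → Σ (List ℕ) λ l′ →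
  l ≡ map (b ∸_) G ++ l′ × Desc w G × VX (suc b) (j + length G) l′
split-block c w b j [] h v = [] , [] , refl , tt , tt
split-block c w b j (x ∷ l) h (c≤x , x≤j , v) with x ≤? b
... | no x≰b = [] , x ∷ l , refl , tt , subst (λ q → VX (suc b) q (x ∷ l)) (sym (+-identityʳ j)) (≰⇒> x≰b , x≤j , v)
... | yes x≤b with m≤n⇒∃[o]m+o≡n x≤b
...   | g , refl with split-block x (suc g) (x + g) (suc j) l (≤-reflexive (sym (+-suc x g))) v
...     | G , l′ , refl , d , v′ = g ∷ G , l′ , cong (_∷ map (x + g ∸_) G ++ l′) (sym (m+n∸n≡m x g)) ,
            (+-cancelˡ-≤ c (suc g) w (subst (_≤ c + w) (sym (+-suc c g)) (≤-trans (s≤s (+-monoˡ-≤ g c≤x)) h)) , d) ,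
            subst (λ q → VX (suc (x + g)) q l′) (sym (+-suc j (length G))) v′

blocks : ∀ m c w b l → length l ≤ m → b < c + w → VX c b l → Σ (List (List ℕ)) λ Gs → Chain w Gs × l ≡ toX b Gs
blocks m c w b [] h lt v = [] , tt , refl
blocks (suc m) c w b (x ∷ l) h lt v with split-block c w b b (x ∷ l) lt v
-- The row just above the bounce point `b` has abscissa at most `b` by the Dyck condition, so a
-- block is never empty.
... | [] , .(x ∷ l) , refl , _ , v′ = ⊥-elim (<⇒≱ (proj₁ v′) (proj₁ (proj₂ v)))
... | g ∷ G , l′ , eq , d , v′ with blocks m (suc b) (suc (length G)) (b + suc (length G)) l′ shorter (s≤s (≤-refl)) v′
  where
  shorter : length l′ ≤ m
  shorter = s≤s⁻¹ (≤-trans (s≤s (≤-trans (m≤n+m (length l′) (length (map (b ∸_) G))) (≤-reflexive (sym (length-++ (map (b ∸_) G))))))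
    (≤-trans (≤-reflexive (cong length (sym eq))) h))
...   | Gs , ch , refl = (g ∷ G) ∷ Gs , (s≤s z≤n , d , ch) , eq

record Blocks (n : ℕ) (p : Path) : Set where
  constructor mkBlocks
  field
    Gs : List (List ℕ)
    chain : Chain 1 Gs
    xs≡ : xs p ≡ toX 0 Gs
    sum≡ : sum (lengths Gs) ≡ n

dyck-blocks : ∀ {n p} → InD n p → Blocks n p
dyck-blocks {n} {p} d with xs-valid {n} {p} d
... | mkVX v len with blocks (length (xs p)) 0 1 0 (xs p) ≤-refl (s≤s z≤n) v
...   | Gs , ch , eq = mkBlocks Gs ch eq (trans (sym (toX-length 0 Gs)) (trans (cong length (sym eq)) len))

pathG : ℕ → List (List ℕ) → Path
pathG n Gs = pathX n (toX 0 Gs)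

module _ {n Gs} (ch : Chain 1 Gs) (eq : sum (lengths Gs) ≡ n) where

  pathG-dyck : InD n (pathG n Gs)
  pathG-dyck = pathX-dyck (toX-valid ch eq)

  xs-pathG : xs (pathG n Gs) ≡ toX 0 Gs
  xs-pathG = xs-pathX (toX-valid ch eq)

  pathG-BP : BP n (xs (pathG n Gs)) 0 (lengths Gs)
  pathG-BP = subst (λ q → BP n q 0 (lengths Gs)) (sym xs-pathG) (BP-toX ch eq)

  pathG-bounce : bounce n (pathG n Gs) ≡ wt (lengths Gs)
  pathG-bounce = bounce-BP pathG-dyck pathG-BP

  pathG-bounceComp : bounceComp n (pathG n Gs) ≡ lengths Gs
  pathG-bounceComp = bounceComp-BP pathG-dyck pathG-BP

  pathG-area : area (pathG n Gs) ≡ tris (lengths Gs) + total Gs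
  pathG-area = trans (cong (areaGo 0) xs-pathG) (area-toX 1 0 Gs ch ≤-refl)

blocks-pathG : ∀ {n p} → InD n p → Σ (List (List ℕ)) λ Gs → Chain 1 Gs × sum (lengths Gs) ≡ n × p ≡ pathG n Gs
blocks-pathG {n} {p} d with dyck-blocks {n} {p} d
... | mkBlocks Gs ch eq s = Gs , ch , s , trans (sym (pathX-xs {n} {p} d)) (cong (pathX n) eq)

-- Realising every admissible excess

fill : ∀ a w e → e ≤ a * w → Σ (List ℕ) λ G → length G ≡ a × Desc (suc w) G × sum G ≡ e
fill zero w .zero z≤n = [] , refl , tt , refl
fill (suc a) w e h with e ≤? w
... | yes e≤w = e ∷ replicate a 0 , cong suc (length-replicate a) , (s≤s e≤w , zeros-desc a e) , trans (cong (e +_) (zeros-sum a)) (+-identityʳ e)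
  where
  zeros-desc : ∀ a e → Desc (suc e) (replicate a 0)
  zeros-desc zero e = tt
  zeros-desc (suc a) e = s≤s z≤n , zeros-desc a 0
  zeros-sum : ∀ a → sum (replicate a 0) ≡ 0
  zeros-sum zero = refl
  zeros-sum (suc a) = zeros-sum a
... | no e≰w with m≤n⇒∃[o]m+o≡n (<⇒≤ (≰⇒> e≰w))
...   | e′ , refl with fill a w e′ (+-cancelˡ-≤ w e′ (a * w) h)
...     | G , len , d , s = w ∷ G , cong suc len , (≤-refl , d) , cong (w +_) s

-- Greedy filling from the left: the capacity of a block depends on `α` only, not on what other
-- blocks hold. This justifies treating the excess as one number.
realize : ∀ w α e → 0 < w → Positive α → e ≤ cap w α →
  Σ (List (List ℕ)) λ Gs → Chain w Gs × lengths Gs ≡ α × total Gs ≡ e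
realize w [] .zero pw p z≤n = [] , tt , refl , refl
realize (suc w) (a ∷ α) e pw (pa ∷ p) h with e ≤? a * w
... | yes e≤ with fill a w e e≤ | realize a α 0 pa p z≤n
...   | G , refl , d , s | Gs , ch , refl , t = G ∷ Gs , (pa , d , ch) , refl , trans (cong₂ _+_ s t) (+-identityʳ e)
realize (suc w) (a ∷ α) e pw (pa ∷ p) h | no e≰ with m≤n⇒∃[o]m+o≡n (<⇒≤ (≰⇒> e≰))
... | e′ , refl with fill a w (a * w) ≤-refl | realize a α e′ pa p (+-cancelˡ-≤ (a * w) e′ _ h)
...   | G , refl , d , s | Gs , ch , refl , t = G ∷ Gs , (pa , d , ch) , refl , cong₂ _+_ s t

-- Composition paths

zeroBlocks : List ℕ → List (List ℕ)
zeroBlocks = map (λ a → replicate a 0)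

lengths-zeroBlocks : ∀ α → lengths (zeroBlocks α) ≡ α
lengths-zeroBlocks [] = refl
lengths-zeroBlocks (a ∷ α) = cong₂ _∷_ (length-replicate a) (lengths-zeroBlocks α)

Desc-zeros : ∀ c a → 0 < c → Desc c (replicate a 0)
Desc-zeros c zero _ = tt
Desc-zeros c (suc a) h = h , Desc-zeros 1 a (s≤s z≤n)

chain-zeroBlocks : ∀ w α → 0 < w → Positive α → Chain w (zeroBlocks α)
chain-zeroBlocks w [] pw [] = tt
chain-zeroBlocks w (a ∷ α) pw (pa ∷ p) rewrite length-replicate a {0} =
  pa , Desc-zeros w a pw , chain-zeroBlocks a α pa p

sum-zeros : ∀ a → sum (replicate a 0) ≡ 0
sum-zeros zero = refl
sum-zeros (suc a) = sum-zeros a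

total-zeroBlocks : ∀ α → total (zeroBlocks α) ≡ 0
total-zeroBlocks [] = refl
total-zeroBlocks (a ∷ α) = cong₂ _+_ (sum-zeros a) (total-zeroBlocks α)

zeros-≡ : ∀ G → sum G ≡ 0 → G ≡ replicate (length G) 0
zeros-≡ [] _ = refl
zeros-≡ (zero ∷ G) eq = cong (0 ∷_) (zeros-≡ G eq)

zeroBlocks-≡ : ∀ Gs → total Gs ≡ 0 → Gs ≡ zeroBlocks (lengths Gs)
zeroBlocks-≡ [] _ = refl
zeroBlocks-≡ (G ∷ Gs) eq = cong₂ _∷_ (zeros-≡ G (m+n≡0⇒m≡0 (sum G) eq)) (zeroBlocks-≡ Gs (m+n≡0⇒n≡0 (sum G) eq))

pathOf-dyckGo : ∀ n b α → b + sum α ≡ n → T (dyckGo n b b (pathOf α))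
pathOf-dyckGo n b [] eq rewrite trans (sym (+-identityʳ b)) eq = T-∧⁺ (≡⇒≡ᵇ n n refl) (≡⇒≡ᵇ n n refl)
pathOf-dyckGo n b (a ∷ α) eq rewrite ++-assoc (replicate a N) (replicate a E) (pathOf α) =
  dyckGo-Ns n b b a _ (dyckGo-Es n (a + b) b a _ (≤-reflexive (+-comm b a))
    (subst (λ q → T (dyckGo n q (b + a) (pathOf α))) (+-comm b a)
      (pathOf-dyckGo n (b + a) α (trans (+-assoc b a (sum α)) eq))))

pathOf-dyck : ∀ {n α} → sum α ≡ n → InD n (pathOf α)
pathOf-dyck {n} {α} = pathOf-dyckGo n 0 α

xsGo-Ns : ∀ b k s → xsGo b (replicate k N ++ s) ≡ replicate k b ++ xsGo b s
xsGo-Ns b zero s = refl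
xsGo-Ns b (suc k) s = cong (b ∷_) (xsGo-Ns b k s)

xsGo-pathOf : ∀ b α → xsGo b (pathOf α) ≡ toX b (zeroBlocks α)
xsGo-pathOf b [] = refl
xsGo-pathOf b (a ∷ α) = trans (cong (xsGo b) (++-assoc (replicate a N) (replicate a E) (pathOf α)))
  (trans (xsGo-Ns b a _) (cong₂ _++_ (sym (map-replicate (b ∸_) a 0))
    (trans (xsGo-Es b a (pathOf α)) (trans (xsGo-pathOf (b + a) α)
      (cong (λ q → toX (b + q) (zeroBlocks α)) (sym (length-replicate a)))))))

pathG-zeroBlocks : ∀ {n α} → Positive α → sum α ≡ n → pathG n (zeroBlocks α) ≡ pathOf α
pathG-zeroBlocks {n} {α} p eq = trans (cong (pathX n) (sym (xsGo-pathOf 0 α))) (pathX-xs {n} {pathOf α} (pathOf-dyck {n} {α} eq))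

module _ {n α} (p : Positive α) (eq : sum α ≡ n) where
  private
    ch : Chain 1 (zeroBlocks α)
    ch = chain-zeroBlocks 1 α (s≤s z≤n) p
    eq′ : sum (lengths (zeroBlocks α)) ≡ n
    eq′ = trans (cong sum (lengths-zeroBlocks α)) eq

  pathOf-BP : BP n (xs (pathOf α)) 0 α
  pathOf-BP = subst₂ (λ q r → BP n (xs q) 0 r) (pathG-zeroBlocks p eq) (lengths-zeroBlocks α) (pathG-BP ch eq′)

  pathOf-bounce : bounce n (pathOf α) ≡ wt α
  pathOf-bounce = bounce-BP {n} {pathOf α} (pathOf-dyck {n} {α} eq) pathOf-BP

  pathOf-area : area (pathOf α) ≡ tris α
  pathOf-area = trans (cong area (sym (pathG-zeroBlocks p eq))) (trans (pathG-area ch eq′)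
    (trans (cong₂ _+_ (cong tris (lengths-zeroBlocks α)) (total-zeroBlocks α)) (+-identityʳ _)))

pathOf-injective : ∀ {n α β} → Positive α → sum α ≡ n → Positive β → sum β ≡ n → pathOf α ≡ pathOf β → α ≡ β
pathOf-injective {n} {α} {β} pα sα pβ sβ eq =
  trans (sym (bounceComp-BP {n} {pathOf α} (pathOf-dyck {n} {α} sα) (pathOf-BP pα sα)))
    (trans (cong (bounceComp n) eq) (bounceComp-BP {n} {pathOf β} (pathOf-dyck {n} {β} sβ) (pathOf-BP pβ sβ)))

-- Minimal paths are stuck, and every path descends to a stuck one

record State (n : ℕ) (p : Path) (α : List ℕ) (e : ℕ) : Set where
  constructor mkState
  field
    inD : InD n p
    sum≡ : sum α ≡ n
    bounce≡ : bounce n p ≡ wt α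
    area≡ : area p ≡ tris α + e

valid-state : ∀ {n} α e → Valid 0 1 α e → sum α ≡ n → Σ Path λ p → State n p α e
valid-state {n} α e (mkValid pos c) eq with realize 1 α e (s≤s z≤n) pos c
... | Gs , ch , refl , refl = pathG n Gs , mkState (pathG-dyck ch eq) eq (pathG-bounce ch eq) (pathG-area ch eq)

chain-valid : ∀ Gs → Chain 1 Gs → Valid 0 1 (lengths Gs) (total Gs)
chain-valid Gs ch = mkValid (Chain-positive 1 Gs ch) (total≤cap 1 Gs ch)

trade-ab : ∀ {α e α′ e′} → Trade α e α′ e′ → tris α′ + e′ + wt α′ ≡ tris α + e + wt α
trade-ab {α} {e} {α′} {e′} (mkTrade _ a w) = trans (cong (tris α′ + e′ +_) w) (trans (+-suc _ (wt α)) (cong (_+ wt α) a))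

InA-ND : ∀ {n τ} → InA n τ → Σ (List ℕ) λ α → τ ≡ pathOf α × Positive α × sum α ≡ n × ND α
InA-ND {n} {τ} (d , min) with blocks-pathG {n} {τ} d
... | Gs , ch , eq , refl with lower-area (lengths Gs) (total Gs) (chain-valid Gs ch)
...   | inj₂ (t0 , nd) = lengths Gs , trans (cong (pathG n) (zeroBlocks-≡ Gs t0)) (pathG-zeroBlocks pos eq) , pos , eq , nd
  where
  pos : Positive (lengths Gs)
  pos = Chain-positive 1 Gs ch
...   | inj₁ (α′ , e′ , v , t) with valid-state {n} α′ e′ v (trans (Trade.sum≡ t) eq)
...     | τ′ , mkState d′ _ b a = ⊥-elim (<⇒≱ lower (min τ′ d′ same))
  where
  same : area τ′ + bounce n τ′ ≡ area (pathG n Gs) + bounce n (pathG n Gs)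
  same = trans (cong₂ _+_ a b) (trans (trade-ab t) (sym (cong₂ _+_ (pathG-area ch eq) (pathG-bounce ch eq))))
  lower : area τ′ < area (pathG n Gs)
  lower = ≤-reflexive (trans (cong suc a) (trans (Trade.area≡ t) (sym (pathG-area ch eq))))

InB-Gapped : ∀ {n π} → InB n π → Σ (List (List ℕ)) λ Gs →
  Chain 1 Gs × sum (lengths Gs) ≡ n × π ≡ pathG n Gs × Gapped (total Gs) (lengths Gs)
InB-Gapped {n} {π} (d , min) with blocks-pathG {n} {π} d
... | Gs , ch , eq , refl with lower-bounce (lengths Gs) (total Gs) (chain-valid Gs ch)
...   | inj₂ g = Gs , ch , eq , refl , g
...   | inj₁ (α′ , e′ , v , t) with valid-state {n} α′ e′ v (trans (sym (Trade.sum≡ t)) eq)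
...     | τ′ , mkState d′ _ b a = ⊥-elim (<⇒≱ lower (min τ′ d′ same))
  where
  same : area τ′ + bounce n τ′ ≡ area (pathG n Gs) + bounce n (pathG n Gs)
  same = trans (cong₂ _+_ a b) (trans (sym (trade-ab t)) (sym (cong₂ _+_ (pathG-area ch eq) (pathG-bounce ch eq))))
  lower : bounce n τ′ < bounce n (pathG n Gs)
  lower = ≤-reflexive (trans (cong suc b) (trans (sym (Trade.wt≡ t)) (sym (pathG-bounce ch eq))))

-- The area itself is the recursion measure, since each trade lowers it by exactly one.
descend-area : ∀ m α e → tris α + e ≡ m → Valid 0 1 α e →
  Σ (List ℕ) λ α′ → Positive α′ × sum α′ ≡ sum α × ND α′ × tris α′ ≤ m × tris α′ + wt α′ ≡ m + wt α
descend-area m α e eq v with lower-area α e v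
... | inj₂ (refl , nd) = α , Valid.pos v , refl , nd , ≤-reflexive eq′ , cong (_+ wt α) eq′
  where
  eq′ : tris α ≡ m
  eq′ = trans (sym (+-identityʳ (tris α))) eq
descend-area zero α e eq v | inj₁ (α′ , e′ , v′ , t) with () ← trans (Trade.area≡ t) eq
descend-area (suc m) α e eq v | inj₁ (α′ , e′ , v′ , t)
  with descend-area m α′ e′ (suc-injective (trans (Trade.area≡ t) eq)) v′
... | α″ , p , s , nd , le , eq″ = α″ , p , trans s (Trade.sum≡ t) , nd , ≤-trans le (n≤1+n m) ,
      trans eq″ (trans (cong (m +_) (Trade.wt≡ t)) (+-suc m (wt α)))

area-min : ∀ {n τ} → InD n τ → Σ (List ℕ) λ α →
  Positive α × sum α ≡ n × ND α × tris α ≤ area τ × tris α + wt α ≡ ab n τ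
area-min {n} {τ} d with blocks-pathG {n} {τ} d
... | Gs , ch , eq , refl with descend-area _ (lengths Gs) (total Gs) refl (chain-valid Gs ch)
...   | α , p , s , nd , le , eq′ = α , p , trans s eq , nd , subst (tris α ≤_) (sym (pathG-area ch eq)) le ,
        trans eq′ (sym (cong₂ _+_ (pathG-area ch eq) (pathG-bounce ch eq)))

descend-bounce : ∀ m α e → wt α ≡ m → Valid 0 1 α e → Σ (List ℕ) λ α′ → Σ ℕ λ e′ →
  Valid 0 1 α′ e′ × sum α′ ≡ sum α × Gapped e′ α′ × wt α′ ≤ m × tris α′ + e′ + wt α′ ≡ tris α + e + m
descend-bounce m α e eq v with lower-bounce α e v
... | inj₂ g = α , e , v , refl , g , ≤-reflexive eq , cong (tris α + e +_) eq
descend-bounce zero α e eq v | inj₁ (α′ , e′ , v′ , t) with () ← trans (sym (Trade.wt≡ t)) eq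
descend-bounce (suc m) α e eq v | inj₁ (α′ , e′ , v′ , t)
  with descend-bounce m α′ e′ (suc-injective (trans (sym (Trade.wt≡ t)) eq)) v′
... | α″ , e″ , v″ , s , g , le , eq″ = α″ , e″ , v″ , trans s (sym (Trade.sum≡ t)) , g , ≤-trans le (n≤1+n m) ,
      trans eq″ (trans (cong (_+ m) (sym (Trade.area≡ t))) (sym (+-suc (tris α + e) m)))

bounce-min : ∀ {n τ} → InD n τ → Σ (List (List ℕ)) λ Gs → Chain 1 Gs × sum (lengths Gs) ≡ n ×
  Gapped (total Gs) (lengths Gs) × bounce n (pathG n Gs) ≤ bounce n τ × ab n (pathG n Gs) ≡ ab n τ
bounce-min {n} {τ} d with blocks-pathG {n} {τ} d
... | Gs , ch , eq , refl with descend-bounce _ (lengths Gs) (total Gs) refl (chain-valid Gs ch)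
...   | α , e , v , s , g , le , eq′ with realize 1 α e (s≤s z≤n) (Valid.pos v) (Valid.cap≤ v)
...     | Hs , ch′ , refl , refl = Hs , ch′ , trans s eq , g ,
          subst₂ _≤_ (sym (pathG-bounce ch′ (trans s eq))) (sym (pathG-bounce ch eq)) le ,
          trans (cong₂ _+_ (pathG-area ch′ (trans s eq)) (pathG-bounce ch′ (trans s eq)))
            (trans eq′ (sym (cong₂ _+_ (pathG-area ch eq) (pathG-bounce ch eq))))

-- A level (p , k) stands for the weakly decreasing exponents p ++ replicate k 0
-- of one group of the operators A^f and B_f.
Level : Set
Level = List ℕ × ℕ

-- z is the number of zero exponents of the previous level.
Adm : ℕ → List Level → Set
Adm z [] = ⊤
Adm z ((p , k) ∷ D) = 0 < z × Desc z p × Positive p × 0 < length p + k × Adm k D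

tot : List Level → ℕ
tot [] = 0
tot ((p , k) ∷ D) = length p + (k + tot D)

-- Each part is the total width of the levels from its own on, so the width `length p + k` of a
-- level is the gap between consecutive parts, that is, a multiplicity in the conjugate partition.
lam : List Level → List ℕ
lam [] = []
lam (L ∷ D) = tot (L ∷ D) ∷ lam D

blks : List Level → List (List ℕ)
blks [] = []
blks ((p , k) ∷ D) = (p ++ replicate (k + tot D) 0) ∷ blks D

exc : List Level → ℕ
exc [] = 0
exc ((p , k) ∷ D) = sum p + exc D

bottom : ℕ → Level
bottom m = [] , m

lengths-blks : ∀ D → lengths (blks D) ≡ lam D
lengths-blks [] = refl
lengths-blks ((p , k) ∷ D) = cong₂ _∷_ (trans (length-++ p) (cong (length p +_) (length-replicate (k + tot D)))) (lengths-blks D)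

total-blks : ∀ D → total (blks D) ≡ exc D
total-blks [] = refl
total-blks ((p , k) ∷ D) = cong₂ _+_ (trans (sum-++ p _) (trans (cong (sum p +_) (sum-zeros (k + tot D))) (+-identityʳ (sum p)))) (total-blks D)

Desc-++zeros : ∀ c p k → 0 < c → Desc c p → Desc c (p ++ replicate k 0)
Desc-++zeros c [] k h d = Desc-zeros c k h
Desc-++zeros c (g ∷ p) k h (h′ , d) = h′ , Desc-++zeros (suc g) p k (s≤s z≤n) d

chain-blks : ∀ z w D → z ≤ w → Adm z D → Chain w (blks D)
chain-blks z w [] h a = tt
chain-blks z w ((p , k) ∷ D) h (pz , d , pp , s , a) rewrite length-++ p {replicate (k + tot D) 0} | length-replicate (k + tot D) {0} =
  ≤-trans s (+-monoʳ-≤ (length p) (m≤m+n k (tot D))) ,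
  Desc-weaken _ h (Desc-++zeros z p (k + tot D) pz d) ,
  chain-blks k _ D (≤-trans (m≤m+n k (tot D)) (m≤n+m _ (length p))) a

-- The rows of the first block cannot move, hence the bottom level has only zeros; their number `m`
-- is the multiplicity of 1 in the conjugate.
record Data (n : ℕ) : Set where
  constructor mkData
  field
    m : ℕ
    D : List Level
    m>0 : 0 < m
    adm : Adm m D
    sum≡ : sum (lam (bottom m ∷ D)) ≡ n
  levels : List Level
  levels = bottom m ∷ D

chain-levels : ∀ {n} (d : Data n) → Chain 1 (blks (Data.levels d))
chain-levels (mkData m D m>0 a _) = chain-blks 1 1 (bottom m ∷ D) ≤-refl (s≤s z≤n , tt , [] , m>0 , a)

sum-levels : ∀ {n} (d : Data n) → sum (lengths (blks (Data.levels d))) ≡ n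
sum-levels d = trans (cong sum (lengths-blks (Data.levels d))) (Data.sum≡ d)

-- From blocks to levels

strip : ∀ c G → Desc c G → Σ (List ℕ) λ p → Σ ℕ λ r → G ≡ p ++ replicate r 0 × Positive p × Desc c p
strip c [] d = [] , 0 , refl , [] , tt
strip c (zero ∷ G) (h , d) = [] , suc (length G) , cong (0 ∷_) (zs G d) , [] , tt
  where
  zs : ∀ G → Desc 1 G → G ≡ replicate (length G) 0
  zs [] _ = refl
  zs (zero ∷ G) (_ , d) = cong (0 ∷_) (zs G d)
  zs (suc g ∷ G) (s≤s () , _)
strip c (suc g ∷ G) (h , d) with strip (suc (suc g)) G d
... | p , r , eq , pp , dp = suc g ∷ p , r , cong (suc g ∷_) eq , s≤s z≤n ∷ pp , h , dp

length≤sum : ∀ p → Positive p → length p ≤ sum p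
length≤sum [] [] = z≤n
length≤sum (x ∷ p) (px ∷ pp) = +-mono-≤ px (length≤sum p pp)

Desc-sum : ∀ c z p → Desc c p → 0 < z → sum p < z → Desc z p
Desc-sum c z [] d _ _ = tt
Desc-sum c z (g ∷ p) (_ , d) _ h = ≤-<-trans (m≤m+n g (sum p)) h , d

headOr0-lam : ∀ D → headOr0 (lam D) ≡ tot D
headOr0-lam [] = refl
headOr0-lam (_ ∷ D) = refl

Gapped-tail : ∀ e x α → Gapped e (x ∷ α) → Gapped e α
Gapped-tail e x [] _ = tt
Gapped-tail e x (y ∷ α) (_ , g) = g

private
  -- If G = p ++ 0^r, the gap between |G| and the next block length l leaves more zeros than the excess t of the later blocks.
  gap : ∀ e l p r t → Positive p → sum p + t ≤ e → e + l < length p + r → Σ ℕ λ k → r ≡ k + l × t < k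
  gap e l p r t pp le lt with m≤n⇒∃[o]m+o≡n lt
  ... | o , eq = suc (t + (o + δ)) , req , s≤s (m≤m+n _ _)
    where
    δ : ℕ
    δ = e ∸ (length p + t)
    e≡ : length p + t + δ ≡ e
    e≡ = m+[n∸m]≡n (≤-trans (+-monoˡ-≤ t (length≤sum p pp)) le)
    req : r ≡ suc (t + (o + δ)) + l
    req = +-cancelˡ-≡ (length p) r _ (trans (sym eq) (trans (cong (λ q → suc (q + l + o)) (sym e≡))
      (ring (length p) t δ l o)))
      where
      ring : ∀ p t d l o → suc (p + t + d + l + o) ≡ p + (suc (t + (o + d)) + l)
      ring = solve-∀

-- Of the `r` zeros in the block, as many as the next block is long belong to later levels and `k`
-- to this one. The recursive call is passed as `rec` because `k` is known only after `gap`.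
levels-rest : ∀ e p r Gs → Positive p → 0 < length p + r → Gapped e (length p + r ∷ lengths Gs) → sum p + total Gs ≤ e →
  (∀ k → total Gs < k → Σ (List Level) λ D → Adm k D × Gs ≡ blks D) →
  Σ ℕ λ k → Σ (List Level) λ D → Adm k D × Gs ≡ blks D × r ≡ k + tot D × 0 < length p + k
levels-rest e p r [] pp s g le rec = r , [] , tt , refl , sym (+-identityʳ r) , s
levels-rest e p r Gs@(G ∷ _) pp s (lt , _) le rec with gap e (length G) p r (total Gs) pp le lt
... | k , req , lt′ with rec k lt′
...   | D , a , eq = k , D , a , eq ,
        trans req (cong (k +_) (trans (cong (λ q → headOr0 (lengths q)) eq) (trans (cong headOr0 (lengths-blks D)) (headOr0-lam D)))) ,
        ≤-trans (≤-<-trans z≤n lt′) (m≤n+m k (length p))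

-- `Chain` bounds the amounts by the previous block length, whereas `Adm` wants them below the
-- number `z` of zeros of the previous level. By `gap` the whole remaining excess is below `z`, and
-- so is every single amount.
levels-of : ∀ e w z Gs → Chain w Gs → Gapped e (lengths Gs) → total Gs ≤ e → total Gs < z →
  Σ (List Level) λ D → Adm z D × Gs ≡ blks D
levels-of e w z [] ch g le lt = [] , tt , refl
levels-of e w z (G ∷ Gs) (pG , d , ch) g le lt with strip w G d
... | p , r , refl , pp , dp
  with levels-rest e p r Gs pp (subst (0 <_) lenG pG) (subst (λ q → Gapped e (q ∷ lengths Gs)) lenG g) (subst (λ q → q + total Gs ≤ e) sumG le)
         (λ k → levels-of e _ k Gs ch (Gapped-tail e _ (lengths Gs) g) (m+n≤o⇒n≤o (sum (p ++ replicate r 0)) le))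
  where
  lenG : length (p ++ replicate r 0) ≡ length p + r
  lenG = trans (length-++ p) (cong (length p +_) (length-replicate r))
  sumG : sum (p ++ replicate r 0) ≡ sum p
  sumG = trans (sum-++ p _) (trans (cong (sum p +_) (sum-zeros r)) (+-identityʳ (sum p)))
...   | k , D , a , refl , refl , s = (p , k) ∷ D ,
        (≤-<-trans z≤n lt , Desc-sum w z p dp (≤-<-trans z≤n lt) (≤-<-trans sum≤ lt) , pp , s , a) , refl
  where
  sum≤ : sum p ≤ total ((p ++ replicate (k + tot D) 0) ∷ blks D)
  sum≤ = ≤-trans (m≤m+n (sum p) _) (≤-trans (≤-reflexive (sym (sum-++ p (replicate (k + tot D) 0)))) (m≤m+n _ _))

gapped-data : ∀ {n} Gs → 0 < n → Chain 1 Gs → sum (lengths Gs) ≡ n → Gapped (total Gs) (lengths Gs) →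
  Σ (Data n) λ d → Gs ≡ blks (Data.levels d)
gapped-data {n} [] () ch refl g
gapped-data {n} (G ∷ Gs) pn (pG , d , ch) eq g with strip 1 G d
... | suc _ ∷ _ , _ , _ , _ , s≤s () , _
... | zero ∷ _ , _ , _ , () ∷ _ , _
... | [] , r , refl , pp , dp
  with levels-rest (total Gs) [] r Gs [] (subst (0 <_) (length-replicate r) pG)
         (subst₂ (λ q t → Gapped t (q ∷ lengths Gs)) (length-replicate r) tot≡ g) ≤-refl
         (λ k → levels-of (total Gs) _ k Gs ch (subst (λ t → Gapped t (lengths Gs)) tot≡ (Gapped-tail _ _ (lengths Gs) g)) ≤-refl)
  where
  tot≡ : sum (replicate r 0) + total Gs ≡ total Gs
  tot≡ = cong (_+ total Gs) (sum-zeros r)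
...   | k , D , a , refl , refl , s = mkData k D s a
        (trans (cong₂ _+_ (sym (length-replicate (k + tot D))) (cong sum (sym (lengths-blks D)))) eq) , refl

-- Words

-- Starting from i^z ++ R, each g in turn inserts a part i + 1 after the first g parts i, so the
-- weakly decreasing list gs creates the new parts from right to left.
insG : ℕ → List ℕ → ℕ → List ℕ → List ℕ
insG i R z [] = replicate z i ++ R
insG i R z (g ∷ gs) = insG i (suc i ∷ replicate (z ∸ g) i ++ R) g gs

-- Only the `z` leading copies of `i` are open to insertions. The `k` zero exponents put parts
-- `suc i` in front, and these are the open ones for the next level.
word : ℕ → ℕ → List ℕ → List Level → List ℕ
word i z R [] = replicate z i ++ R
word i z R ((p , k) ∷ D) = word (suc i) k (insG i R z p) D

replicate-+ : ∀ {A : Set} m n (x : A) → replicate (m + n) x ≡ replicate m x ++ replicate n x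
replicate-+ zero n x = refl
replicate-+ (suc m) n x = cong (x ∷_) (replicate-+ m n x)

replicate-∸ : ∀ {g z} i (R : List ℕ) → g ≤ z → replicate z i ++ R ≡ replicate g i ++ replicate (z ∸ g) i ++ R
replicate-∸ {g} {z} i R h = trans (cong (λ q → replicate q i ++ R) (sym (m+[n∸m]≡n h)))
  (trans (cong (_++ R) (replicate-+ g (z ∸ g) i)) (++-assoc (replicate g i) (replicate (z ∸ g) i) R))

insG-zeros : ∀ i R z p k → insG i R z (p ++ replicate k 0) ≡ replicate k (suc i) ++ insG i R z p
insG-zeros i R z p zero = cong (insG i R z) (++-identityʳ p)
insG-zeros i R z [] (suc k) = trans (insG-zeros i _ 0 [] k) (trans (sym (++-assoc (replicate k (suc i)) (suc i ∷ []) _))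
  (cong (_++ replicate z i ++ R) (trans (sym (replicate-+ k 1 (suc i))) (cong (λ q → replicate q (suc i)) (+-comm k 1)))))
insG-zeros i R z (g ∷ p) (suc k) = insG-zeros i _ g p (suc k)

-- The last exponent creates the leftmost `suc i`, so appending to the list inserts left of all
-- earlier insertions.
insG-snoc : ∀ i R z p c V → c ≤ z → All (c ≤_) p → insG i R z p ≡ replicate c i ++ V →
  insG i R z (p ∷ʳ c) ≡ replicate c i ++ suc i ∷ V
insG-snoc i R z [] c V c≤z [] eq = cong (λ q → replicate c i ++ suc i ∷ q)
  (++-cancelˡ (replicate c i) _ _ (trans (sym (replicate-∸ i R c≤z)) eq))
insG-snoc i R z (g ∷ p) c V c≤z (h ∷ al) eq = insG-snoc i _ g p c V h al eq

-- Decoding words without defects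

Desc-snoc : ∀ z p c → Desc z p → c < z → All (c ≤_) p → Desc z (p ∷ʳ c)
Desc-snoc z [] c d h al = h , tt
Desc-snoc z (g ∷ p) c (h′ , d) h (c≤g ∷ al) = h′ , Desc-snoc (suc g) p c d (s≤s c≤g) al

-- `c` copies of `i` have been read and `V` is unread. A `suc i` met next gets exponent `c`, which
-- has to be below `z`; `c<z` provides this, because descents of at most 1 force a further `i`
-- before the letters fall below `i`.
record Parsed (i c : ℕ) (V : List ℕ) : Set where
  constructor mkParsed
  field
    R : List ℕ
    z : ℕ
    p : List ℕ
    eq : replicate c i ++ V ≡ insG i R z p
    c≤z : c ≤ z
    c<z : i ≤ headOr0 V → c < z
    desc : Desc z p
    p≥c : All (c ≤_) p
    nd : ND (replicate z i ++ R)
    R≤i : All (_≤ i) R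
    head< : headOr0 R < i
    pos : Positive R

ND-replicate : ∀ c i R → ND R → All (_≤ suc i) R → i ≤ suc (headOr0 R) → ND (replicate c i ++ R)
ND-replicate zero i R nd al h = nd
ND-replicate (suc c) i R nd al h = hd c , All.++⁺ (All.replicate⁺ c (n≤1+n i)) al , ND-replicate c i R nd al h
  where
  hd : ∀ c → i ≤ suc (headOr0 (replicate c i ++ R))
  hd zero = h
  hd (suc c) = n≤1+n i

-- The first letter below `i` ends the zone: after it no letter exceeds `i`, as no part is followed
-- by one larger by 2 or more.
parse : ∀ i c V → 0 < i → ND V → All (_≤ suc i) V → Positive V → i ≤ suc (headOr0 V) → Parsed i c V
parse i c [] pi nd al pos h = mkParsed [] c [] refl ≤-refl (λ q → ⊥-elim (<⇒≱ pi q)) tt []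
  (ND-replicate c i [] tt [] h) [] pi []
parse i c (x ∷ V) pi (xh , xa , nd) (x≤ ∷ al) (px ∷ pos) h with <-cmp x i
... | tri< x<i _ _ = mkParsed (x ∷ V) c [] refl ≤-refl (λ q → ⊥-elim (<⇒≱ x<i q)) tt []
  (ND-replicate c i (x ∷ V) (xh , xa , nd) (x≤ ∷ al) h) (<⇒≤ x<i ∷ All.map (λ q → ≤-trans q x<i) xa) x<i (px ∷ pos)
... | tri≈ _ refl _ with parse i (suc c) V pi nd al pos xh
...   | mkParsed R z p eq cz _ d pc nd′ Ri hR pR = mkParsed R z p (trans (shift c) eq) (≤-trans (n≤1+n c) cz) (λ _ → cz) d
        (All.map (≤-trans (n≤1+n c)) pc) nd′ Ri hR pR
  where
  shift : ∀ c → replicate c i ++ i ∷ V ≡ i ∷ replicate c i ++ V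
  shift zero = refl
  shift (suc c) = cong (i ∷_) (shift c)
parse i c (x ∷ V) pi (xh , xa , nd) (x≤ ∷ al) (px ∷ pos) h | tri> _ _ i<x with ≤-antisym x≤ i<x
... | refl with parse i c V pi nd al pos (≤-trans (n≤1+n i) xh)
...   | mkParsed R z p eq cz c<z d pc nd′ Ri hR pR = mkParsed R z (p ∷ʳ c) (sym (insG-snoc i R z p c V cz pc (sym eq)))
        cz (λ _ → c<z (s≤s⁻¹ xh)) (Desc-snoc z p c d (c<z (s≤s⁻¹ xh)) pc) (All.++⁺ pc (≤-refl ∷ [])) nd′ Ri hR pR

record Decoded (i z : ℕ) (R : List ℕ) (D : List Level) : Set where
  constructor mkDecoded
  field
    m : ℕ
    D′ : List Level
    m>0 : 0 < m
    adm : Adm m D′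
    eq : word i z R D ≡ word 1 m [] D′

ND-tail : ∀ z i R → ND (replicate z i ++ R) → ND R
ND-tail zero i R nd = nd
ND-tail (suc z) i R (_ , _ , nd) = ND-tail z i R nd

ND-last : ∀ z i R → 0 < z → ND (replicate z i ++ R) → i ≤ suc (headOr0 R)
ND-last (suc zero) i R _ (h , _) = h
ND-last (suc (suc z)) i R _ (_ , _ , nd) = ND-last (suc z) i R (s≤s z≤n) nd

-- Levels are recovered from the largest part downwards, those above being collected in `D`. After
-- the leading copies of `suc i` the next letter is exactly `i`, again since descents are at most 1.
-- Parsing starts with count 1 for this letter, which makes the exponents found positive; the
-- leading copies are the zero exponents.
decode : ∀ i z R D → 0 < z → ND (replicate z (suc i) ++ R) → Positive R → All (_≤ suc i) R → headOr0 R < suc i → Adm z D →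
  Decoded (suc i) z R D
decode zero z [] D pz nd pos al h a = mkDecoded z D pz a refl
decode zero z (x ∷ R) D pz nd (px ∷ pos) al h a = ⊥-elim (<⇒≱ px (s≤s⁻¹ h))
decode (suc i) z [] D pz nd pos al h a = ⊥-elim (<⇒≱ (s≤s (s≤s z≤n)) (ND-last z (suc (suc i)) [] pz nd))
decode (suc i) z (x ∷ R) D pz nd (px ∷ pos) (x≤ ∷ al) h a
  with ≤-antisym (s≤s⁻¹ h) (s≤s⁻¹ (ND-last z (suc (suc i)) (x ∷ R) pz nd)) | ND-tail z _ (x ∷ R) nd
... | refl | xh , xa , ndR with parse (suc i) 1 R (s≤s z≤n) ndR al pos xh
...   | mkParsed R₀ z₀ p eq 1≤z _ d p≥1 nd′ Ri hR pR
  with decode i z₀ R₀ ((p , z) ∷ D) 1≤z nd′ pR Ri hR (1≤z , d , p≥1 , ≤-trans pz (m≤n+m z (length p)) , a)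
...     | mkDecoded m D′ m>0 a′ eq′ = mkDecoded m D′ m>0 a′
            (trans (cong (λ q → word (suc (suc i)) z q D) eq) eq′)

decode-ND : ∀ α → 0 < sum α → Positive α → ND α → Σ ℕ λ m → Σ (List Level) λ D → 0 < m × Adm m D × α ≡ word 1 m [] D
decode-ND [] () pos nd
decode-ND (zero ∷ V) _ (() ∷ pos) nd
decode-ND (suc i ∷ V) _ (px ∷ pos) (xh , xa , nd) with parse (suc i) 1 V px nd xa pos xh
... | mkParsed R z [] eq 1≤z _ d p≥1 nd′ Ri hR pR with decode i z R [] 1≤z nd′ pR Ri hR tt
...   | mkDecoded m D m>0 a eq′ = m , D , m>0 , a , trans eq eq′
-- The word begins with `suc i`, so every larger part has jumped over at least that letter: the top
-- level has no zero exponent.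
decode-ND (suc i ∷ V) _ (px ∷ pos) (xh , xa , nd) | mkParsed R z p@(_ ∷ _) eq 1≤z _ d p≥1 nd′ Ri hR pR
  with decode i z R ((p , 0) ∷ []) 1≤z nd′ pR Ri hR (1≤z , d , p≥1 , s≤s z≤n , tt)
... | mkDecoded m D m>0 a eq′ = m , D , m>0 , a , trans eq eq′

-- Weights of words

-- The effect of `k` exchanges of neighbours `suc i`, `i`: each raises the weight by one and leaves
-- the multiset of parts alone.
record Shift (k : ℕ) (α β : List ℕ) : Set where
  constructor mkShift
  field
    sum≡ : sum β ≡ sum α
    tris≡ : tris β ≡ tris α
    wt≡ : wt α + k ≡ wt β

shift-refl : ∀ {α} → Shift 0 α α
shift-refl = mkShift refl refl (+-identityʳ _)

shift-trans : ∀ {j k α β γ} → Shift j α β → Shift k β γ → Shift (j + k) α γ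
shift-trans {j} {k} {α} (mkShift s t w) (mkShift s′ t′ w′) =
  mkShift (trans s′ s) (trans t′ t) (trans (sym (+-assoc (wt α) j k)) (trans (cong (_+ k) w) w′))

shift-≡ : ∀ {k α α′ β} → α ≡ α′ → Shift k α′ β → Shift k α β
shift-≡ refl s = s

shift-++ : ∀ {k α β} P → Shift k α β → Shift k (P ++ α) (P ++ β)
shift-++ {k} {α} {β} P (mkShift s t w) = mkShift
  (trans (sum-++ P β) (trans (cong (sum P +_) s) (sym (sum-++ P α))))
  (trans (tris-++ P β) (trans (cong (tris P +_) t) (sym (tris-++ P α))))
  (wt-cong-++ P (sym s) k w)

shift-swap : ∀ i W → Shift 1 (suc i ∷ i ∷ W) (i ∷ suc i ∷ W)
shift-swap i W = mkShift (+-suc i (i + sum W)) (swap (tri i) (i + tri i) (tris W)) (+-comm _ 1)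
  where
  swap : ∀ a b c → a + (b + c) ≡ b + (a + c)
  swap = solve-∀

shift-pass : ∀ i g W → Shift g (suc i ∷ replicate g i ++ W) (replicate g i ++ suc i ∷ W)
shift-pass i zero W = shift-refl
shift-pass i (suc g) W = shift-trans (shift-swap i (replicate g i ++ W)) (shift-++ (i ∷ []) (shift-pass i g W))

replicate-snoc : ∀ a (x : ℕ) Y → replicate (suc a) x ++ Y ≡ replicate a x ++ x ∷ Y
replicate-snoc zero x Y = refl
replicate-snoc (suc a) x Y = cong (x ∷_) (replicate-snoc a x Y)

insG-shift : ∀ i R z gs → Desc (suc z) gs →
  Shift (sum gs) (replicate (length gs) (suc i) ++ replicate z i ++ R) (insG i R z gs)
insG-shift i R z [] d = shift-refl
insG-shift i R z (g ∷ gs) (s≤s h , d) =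
  shift-trans (shift-≡ start (shift-++ (replicate (length gs) (suc i)) (shift-pass i g _)))
    (insG-shift i _ g gs d)
  where
  start : replicate (suc (length gs)) (suc i) ++ replicate z i ++ R
    ≡ replicate (length gs) (suc i) ++ suc i ∷ replicate g i ++ replicate (z ∸ g) i ++ R
  start = trans (replicate-snoc (length gs) (suc i) _) (cong (λ q → replicate (length gs) (suc i) ++ suc i ∷ q) (replicate-∸ i R h))

top : ℕ → List Level → List ℕ
top i [] = []
top i ((p , k) ∷ D) = top (suc i) D ++ replicate (length p + k) (suc i)

Desc-suc : ∀ {c} p → Desc c p → Desc (suc c) p
Desc-suc p = Desc-weaken p (n≤1+n _)

word-shift : ∀ i z R D → Adm z D → Shift (exc D) (top i D ++ replicate z i ++ R) (word i z R D)
word-shift i z R [] _ = shift-refl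
word-shift i z R ((p , k) ∷ D) (_ , d , _ , _ , a) = shift-trans
  (shift-≡ start (shift-++ (top (suc i) D) (shift-++ (replicate k (suc i)) (insG-shift i R z p (Desc-suc p d)))))
  (word-shift (suc i) k _ D a)
  where
  start : (top (suc i) D ++ replicate (length p + k) (suc i)) ++ replicate z i ++ R
    ≡ top (suc i) D ++ replicate k (suc i) ++ replicate (length p) (suc i) ++ replicate z i ++ R
  start = trans (++-assoc (top (suc i) D) _ _) (cong (top (suc i) D ++_)
    (trans (cong (λ q → replicate q (suc i) ++ replicate z i ++ R) (+-comm (length p) k))
      (trans (cong (_++ replicate z i ++ R) (replicate-+ k (length p) (suc i))) (++-assoc (replicate k (suc i)) _ _))))

insG-All : ∀ {P : ℕ → Set} i R z gs → P i → P (suc i) → All P R → All P (insG i R z gs)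
insG-All i R z [] pi ps al = All.++⁺ (All.replicate⁺ z pi) al
insG-All i R z (g ∷ gs) pi ps al = insG-All i _ g gs pi ps (ps ∷ All.++⁺ (All.replicate⁺ (z ∸ g) pi) al)

word-positive : ∀ i z R D → Positive R → Positive (word (suc i) z R D)
word-positive i z R [] p = All.++⁺ (All.replicate⁺ z (s≤s z≤n)) p
word-positive i z R ((q , k) ∷ D) p = word-positive (suc i) k _ D (insG-All (suc i) R z q (s≤s z≤n) (s≤s z≤n) p)

-- The conjugate partition

cw : List Level → List ℕ
cw [] = []
cw ((p , k) ∷ D) = map suc (cw D) ++ replicate (length p + k) 1

top-cw : ∀ i D → top i D ≡ map (i +_) (cw D)
top-cw i [] = refl
top-cw i ((p , k) ∷ D) = trans (cong₂ _++_
    (trans (top-cw (suc i) D) (trans (map-cong′ (cw D)) (map-∘ (cw D))))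
    (trans (cong (replicate (length p + k)) (sym (+-comm i 1))) (sym (map-replicate (i +_) (length p + k) 1))))
  (sym (map-++ (i +_) (map suc (cw D)) (replicate (length p + k) 1)))
  where
  map-cong′ : ∀ l → map (suc i +_) l ≡ map (λ x → i + suc x) l
  map-cong′ [] = refl
  map-cong′ (x ∷ l) = cong₂ _∷_ (sym (+-suc i x)) (map-cong′ l)

cw-bottom : ∀ m D → cw (bottom m ∷ D) ≡ top 1 D ++ replicate m 1
cw-bottom m D = cong (_++ replicate m 1) (sym (top-cw 1 D))

private
  ones : ∀ s → sum (replicate s 1) ≡ s × tris (replicate s 1) ≡ 0 × wt (replicate s 1) ≡ tri s
  ones zero = refl , refl , refl
  ones (suc s) with ones s
  ... | h₁ , h₂ , h₃ = cong suc h₁ , h₂ , cong₂ _+_ h₁ h₃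

  sum-sucs : ∀ c s → sum (map suc c ++ replicate s 1) ≡ sum c + (length c + s)
  sum-sucs [] s = proj₁ (ones s)
  sum-sucs (x ∷ c) s = trans (cong (suc x +_) (sum-sucs c s)) (ring x (sum c) (length c) s)
    where
    ring : ∀ x a b s → suc x + (a + (b + s)) ≡ x + a + suc (b + s)
    ring = solve-∀

  tris-sucs : ∀ c s → tris (map suc c ++ replicate s 1) ≡ sum c + tris c
  tris-sucs [] s = proj₁ (proj₂ (ones s))
  tris-sucs (x ∷ c) s = trans (cong (x + tri x +_) (tris-sucs c s)) (ring x (tri x) (sum c) (tris c))
    where
    ring : ∀ x t a b → x + t + (a + b) ≡ x + a + (t + b)
    ring = solve-∀

  wt-sucs : ∀ c s → wt (map suc c ++ replicate s 1) ≡ wt c + tri (length c + s)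
  wt-sucs [] s = proj₂ (proj₂ (ones s))
  wt-sucs (x ∷ c) s = trans (cong₂ _+_ (sum-sucs c s) (wt-sucs c s)) (ring (sum c) (length c + s) (wt c) (tri (length c + s)))
    where
    ring : ∀ a b c d → a + b + (c + d) ≡ a + c + (b + d)
    ring = solve-∀

  tot-comm : ∀ p k t → t + (p + k) ≡ p + (k + t)
  tot-comm = solve-∀

cw-length : ∀ D → length (cw D) ≡ tot D
cw-length [] = refl
cw-length ((p , k) ∷ D) = trans (length-++ (map suc (cw D)))
  (trans (cong₂ _+_ (trans (length-map suc (cw D)) (cw-length D)) (length-replicate (length p + k))) (tot-comm (length p) k (tot D)))

cw-sum : ∀ D → sum (cw D) ≡ sum (lam D)
cw-sum [] = refl
cw-sum ((p , k) ∷ D) = trans (sum-sucs (cw D) (length p + k))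
  (trans (cong₂ _+_ (cw-sum D) (trans (cong (_+ (length p + k)) (cw-length D)) (tot-comm (length p) k (tot D)))) (+-comm (sum (lam D)) _))

-- The classical identity between the sum of (k-1) λ_k and the sum of the binomials C(λ'_j, 2),
-- proved by adding one row of λ at a time. Together with `cw-wt` it is the source of the exchange
-- of area and bounce.
cw-tris : ∀ D → tris (cw D) ≡ wt (lam D)
cw-tris [] = refl
cw-tris ((p , k) ∷ D) = trans (tris-sucs (cw D) (length p + k)) (cong₂ _+_ (cw-sum D) (cw-tris D))

cw-wt : ∀ D → wt (cw D) ≡ tris (lam D)
cw-wt [] = refl
cw-wt ((p , k) ∷ D) = trans (wt-sucs (cw D) (length p + k))
  (trans (cong₂ _+_ (cw-wt D) (cong tri (trans (cong (_+ (length p + k)) (cw-length D)) (tot-comm (length p) k (tot D))))) (+-comm (tris (lam D)) _))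

wordOf : ℕ → List Level → List ℕ
wordOf m D = word 1 m [] D

wordOf-shift : ∀ m D → Adm m D → Shift (exc D) (cw (bottom m ∷ D)) (wordOf m D)
wordOf-shift m D a = subst (λ q → Shift (exc D) q (wordOf m D))
  (trans (cong (top 1 D ++_) (++-identityʳ (replicate m 1))) (sym (cw-bottom m D))) (word-shift 1 m [] D a)

-- Recovering the levels from the word

-- For each part i + 1 of the word, the number of parts i to its left (counting from c).
before : ℕ → ℕ → List ℕ → List ℕ
before i c [] = []
before i c (x ∷ V) with x ≟ suc i | x ≟ i
... | yes _ | _ = c ∷ before i c V
... | no _ | yes _ = before i (suc c) V
... | no _ | no _ = before i c V

before-hit : ∀ i c V → before i c (suc i ∷ V) ≡ c ∷ before i c V
before-hit i c V with suc i ≟ suc i | suc i ≟ i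
... | yes _ | _ = refl
... | no ¬p | _ = ⊥-elim (¬p refl)

before-count : ∀ i c V → before i c (i ∷ V) ≡ before i (suc c) V
before-count i c V with i ≟ suc i | i ≟ i
... | yes p | _ = ⊥-elim (m≢1+n+m i {0} p)
... | no _ | yes _ = refl
... | no _ | no ¬p = ⊥-elim (¬p refl)

before-other : ∀ i c x V → x ≢ suc i → x ≢ i → before i c (x ∷ V) ≡ before i c V
before-other i c x V n₁ n₂ with x ≟ suc i | x ≟ i
... | yes p | _ = ⊥-elim (n₁ p)
... | no _ | yes p = ⊥-elim (n₂ p)
... | no _ | no _ = refl

before-counts : ∀ i c z V → before i c (replicate z i ++ V) ≡ before i (c + z) V
before-counts i c zero V = cong (λ q → before i q V) (sym (+-identityʳ c))
before-counts i c (suc z) V = trans (before-count i c _) (trans (before-counts i (suc c) z V) (cong (λ q → before i q V) (sym (+-suc c z))))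

before-hits : ∀ i c k V → before i c (replicate k (suc i) ++ V) ≡ replicate k c ++ before i c V
before-hits i c zero V = refl
before-hits i c (suc k) V = trans (before-hit i c _) (cong (c ∷_) (before-hits i c k V))

before-skip : ∀ i c P x W → x ≢ suc i → x ≢ i → before i c (P ++ x ∷ W) ≡ before i c (P ++ W)
before-skip i c [] x W n₁ n₂ = before-other i c x W n₁ n₂
before-skip i c (y ∷ P) x W n₁ n₂ with y ≟ suc i | y ≟ i
... | yes _ | _ = cong (c ∷_) (before-skip i c P x W n₁ n₂)
... | no _ | yes _ = before-skip i (suc c) P x W n₁ n₂
... | no _ | no _ = before-skip i c P x W n₁ n₂

before-none : ∀ i c V → All (_≤ i) V → before i c V ≡ []
before-none i c [] [] = refl
before-none i c (x ∷ V) (h ∷ al) with x ≟ suc i | x ≟ i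
... | yes refl | _ = ⊥-elim (<⇒≱ h ≤-refl)
... | no _ | yes _ = before-none i (suc c) V al
... | no _ | no _ = before-none i c V al

before-insG : ∀ i R z gs → Desc (suc z) gs → before i 0 (insG i R z gs) ≡ reverse gs ++ before i z R
before-insG i R z [] d = before-counts i 0 z R
before-insG i R z (g ∷ gs) (s≤s h , d) = trans (before-insG i _ g gs d)
  (trans (cong (reverse gs ++_) (trans (before-hit i g _) (cong (g ∷_) (trans (before-counts i g (z ∸ g) R) (cong (λ q → before i q R) (m+[n∸m]≡n h))))))
  (trans (sym (++-assoc (reverse gs) (g ∷ []) _)) (cong (_++ before i z R) (sym (unfold-reverse g gs)))))

before-insG-higher : ∀ j i c R z gs → j < i → Desc (suc z) gs → before j c (insG i R z gs) ≡ before j c (replicate z i ++ R)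
before-insG-higher j i c R z [] lt d = refl
before-insG-higher j i c R z (g ∷ gs) lt (s≤s h , d) = trans (before-insG-higher j i c _ g gs lt d)
  (trans (before-skip j c (replicate g i) (suc i) _ (λ q → <⇒≢ (s≤s lt) (sym q)) (λ q → <⇒≢ (≤-trans lt (n≤1+n i)) (sym q)))
    (cong (before j c) (sym (replicate-∸ i R h))))

before-word : ∀ j i z R D → j < i → Adm z D → before j 0 (word i z R D) ≡ before j 0 (replicate z i ++ R)
before-word j i z R [] lt a = refl
before-word j i z R ((p , k) ∷ D) lt (_ , d , _ , _ , a) = trans (before-word j (suc i) k _ D (≤-trans lt (n≤1+n i)) a)
  (trans (skips k) (before-insG-higher j i 0 R z p lt (Desc-suc p d)))
  where
  skips : ∀ k → before j 0 (replicate k (suc i) ++ insG i R z p) ≡ before j 0 (insG i R z p)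
  skips zero = refl
  skips (suc k) = trans (before-other j 0 (suc i) _ (λ q → <⇒≢ (s≤s lt) (sym q)) (λ q → <⇒≢ (≤-trans lt (n≤1+n i)) (sym q))) (skips k)

-- Exponents create parts from right to left, hence the reversal. Later levels insert only parts
-- above `suc i`, which `before i` does not see.
before-level : ∀ i z R p k D → All (_≤ i) R → Adm z ((p , k) ∷ D) →
  before i 0 (word i z R ((p , k) ∷ D)) ≡ reverse (p ++ replicate k 0)
before-level i z R p k D al (_ , d , _ , _ , a) = trans (before-word i (suc i) k _ D ≤-refl a)
  (trans (before-hits i 0 k _) (trans (cong (replicate k 0 ++_) (trans (before-insG i R z p (Desc-suc p d))
    (trans (cong (reverse p ++_) (before-none i z R al)) (++-identityʳ (reverse p)))))
  (sym (trans (reverse-++ p (replicate k 0)) (cong (_++ reverse p) (reverse-replicate k))))))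
  where
  reverse-replicate : ∀ k → reverse (replicate k 0) ≡ replicate k 0
  reverse-replicate zero = refl
  reverse-replicate (suc k) = trans (unfold-reverse 0 (replicate k 0)) (trans (cong (_++ 0 ∷ []) (reverse-replicate k))
    (trans (sym (replicate-+ k 1 0)) (cong (λ q → replicate q 0) (+-comm k 1))))

zeros-split : ∀ p k p′ k′ → Positive p → Positive p′ → p ++ replicate k 0 ≡ p′ ++ replicate k′ 0 → p ≡ p′ × k ≡ k′
zeros-split [] k [] k′ _ _ eq = refl , trans (sym (length-replicate k)) (trans (cong length eq) (length-replicate k′))
zeros-split [] (suc k) (x ∷ p′) k′ _ (px ∷ _) eq = ⊥-elim (<⇒≢ px (proj₁ (∷-injective eq)))
zeros-split (x ∷ p) k [] (suc k′) (px ∷ _) _ eq = ⊥-elim (<⇒≢ px (sym (proj₁ (∷-injective eq))))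
zeros-split (x ∷ p) k (y ∷ p′) k′ (_ ∷ pp) (_ ∷ pp′) eq with ∷-injective eq
... | refl , eq′ with zeros-split p k p′ k′ pp pp′ eq′
...   | refl , refl = refl , refl

word-levels : ∀ i z z′ R R′ D D′ → All (_≤ i) R → All (_≤ i) R′ → Adm z D → Adm z′ D′ →
  word i z R D ≡ word i z′ R′ D′ → D ≡ D′
word-levels i z z′ R R′ [] [] al al′ a a′ eq = refl
word-levels i z z′ R R′ [] ((p , k) ∷ D) al al′ a a′@(_ , _ , _ , s , _) eq = ⊥-elim (<⇒≢ s (empty (trans (sym none) (trans (cong (before i 0) eq) (before-level i z′ R′ p k D al′ a′)))))
  where
  none : before i 0 (replicate z i ++ R) ≡ []
  none = trans (before-counts i 0 z R) (before-none i z R al)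
  empty : [] ≡ reverse (p ++ replicate k 0) → 0 ≡ length p + k
  empty e = trans (cong length e) (trans (length-reverse (p ++ replicate k 0)) (trans (length-++ p) (cong (length p +_) (length-replicate k))))
word-levels i z z′ R R′ ((p , k) ∷ D) [] al al′ a@(_ , _ , _ , s , _) a′ eq = ⊥-elim (<⇒≢ s (empty (trans (sym none) (trans (cong (before i 0) (sym eq)) (before-level i z R p k D al a)))))
  where
  none : before i 0 (replicate z′ i ++ R′) ≡ []
  none = trans (before-counts i 0 z′ R′) (before-none i z′ R′ al′)
  empty : [] ≡ reverse (p ++ replicate k 0) → 0 ≡ length p + k
  empty e = trans (cong length e) (trans (length-reverse (p ++ replicate k 0)) (trans (length-++ p) (cong (length p +_) (length-replicate k))))
word-levels i z z′ R R′ ((p , k) ∷ D) ((p′ , k′) ∷ D′) al al′ a@(_ , _ , pp , _ , aD) a′@(_ , _ , pp′ , _ , aD′) eq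
  with zeros-split p k p′ k′ pp pp′ (reverse-injective (trans (sym (before-level i z R p k D al a)) (trans (cong (before i 0) eq) (before-level i z′ R′ p′ k′ D′ al′ a′))))
... | refl , refl = cong ((p , k) ∷_) (word-levels (suc i) k k (insG i R z p) (insG i R′ z′ p) D D′
        (insG-All i R z p (n≤1+n i) ≤-refl (All.map (λ h → ≤-trans h (n≤1+n i)) al))
        (insG-All i R′ z′ p (n≤1+n i) ≤-refl (All.map (λ h → ≤-trans h (n≤1+n i)) al′)) aD aD′ eq)

wordOf-levels : ∀ m m′ D D′ → Adm m D → Adm m′ D′ → wordOf m D ≡ wordOf m′ D′ → D ≡ D′
wordOf-levels m m′ D D′ = word-levels 1 m m′ [] [] D D′ [] []

sum-lam-bottom : ∀ m m′ D → sum (lam (bottom m ∷ D)) ≡ sum (lam (bottom m′ ∷ D)) → m ≡ m′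
sum-lam-bottom m m′ D eq = +-cancelʳ-≡ (tot D) m m′ (+-cancelʳ-≡ (sum (lam D)) (m + tot D) (m′ + tot D) eq)

-- Partitions as lists of runs (value , multiplicity)

Runs : Set
Runs = List (ℕ × ℕ)

expand : Runs → List ℕ
expand [] = []
expand ((v , m) ∷ rs) = replicate m v ++ expand rs

SD : ℕ → Runs → Set
SD c [] = ⊤
SD c ((v , m) ∷ rs) = v < c × 0 < v × 0 < m × SD v rs

vals mults : Runs → List ℕ
vals = map proj₁
mults = map proj₂

hd : Runs → ℕ
hd [] = 0
hd ((v , _) ∷ _) = v

partition-runs : ∀ l → Positive l → Linked (λ a b → b ≤ a) l → Σ Runs λ rs → SD (suc (headOr0 l)) rs × l ≡ expand rs
partition-runs [] _ _ = [] , tt , refl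
partition-runs (x ∷ []) (px ∷ _) _ = (x , 1) ∷ [] , (≤-refl , px , s≤s z≤n , tt) , refl
partition-runs (x ∷ y ∷ l) (px ∷ p) (y≤x ∷ lk) with partition-runs (y ∷ l) p lk
... | (v , suc m) ∷ rs , (v< , pv , pm , sd) , eq with x ≟ v
...   | yes refl = (v , suc (suc m)) ∷ rs , (≤-refl , pv , s≤s z≤n , sd) , cong (x ∷_) eq
...   | no x≢v = (x , 1) ∷ (v , suc m) ∷ rs , (≤-refl , px , s≤s z≤n , ≤∧≢⇒< (≤-trans (s≤s⁻¹ v<) y≤x) (λ q → x≢v (sym q)) , pv , pm , sd) , cong (x ∷_) eq

≡ᵇ-refl : ∀ v → (v ≡ᵇ v) ≡ true
≡ᵇ-refl v = T⇒≡ (≡⇒≡ᵇ v v refl)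

≡ᵇ-false : ∀ {v w} → v ≢ w → (v ≡ᵇ w) ≡ false
≡ᵇ-false {v} {w} ne with v ≡ᵇ w in eq
... | false = refl
... | true = ⊥-elim (ne (≡ᵇ⇒≡ v w (subst T (sym eq) tt)))

distinct-run : ∀ m v l → distinct (replicate (suc m) v ++ l) ≡ distinct (v ∷ l)
distinct-run zero v l = refl
distinct-run (suc m) v l rewrite ≡ᵇ-refl v = distinct-run m v l

distinct-new : ∀ v rs → SD v rs → distinct (v ∷ expand rs) ≡ v ∷ distinct (expand rs)
distinct-new v [] _ = refl
distinct-new v ((v′ , suc m′) ∷ rs) (v′<v , _) rewrite ≡ᵇ-false {v} {v′} (λ q → <⇒≢ v′<v (sym q)) = refl

distinct-expand : ∀ c rs → SD c rs → distinct (expand rs) ≡ vals rs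
distinct-expand c [] _ = refl
distinct-expand c ((v , suc m) ∷ rs) (_ , _ , _ , sd) = trans (distinct-run m v (expand rs))
  (trans (distinct-new v rs sd) (cong (v ∷_) (distinct-expand v rs sd)))

mult-replicate-≡ : ∀ m v l → mult (replicate m v ++ l) v ≡ m + mult l v
mult-replicate-≡ zero v l = refl
mult-replicate-≡ (suc m) v l rewrite ≡ᵇ-refl v = cong suc (mult-replicate-≡ m v l)

mult-replicate-≢ : ∀ m v w l → v ≢ w → mult (replicate m v ++ l) w ≡ mult l w
mult-replicate-≢ zero v w l ne = refl
mult-replicate-≢ (suc m) v w l ne rewrite ≡ᵇ-false ne = mult-replicate-≢ m v w l ne

mult-above : ∀ c rs x → SD c rs → c ≤ x → mult (expand rs) x ≡ 0
mult-above c [] x _ _ = refl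
mult-above c ((v , m) ∷ rs) x (v<c , _ , _ , sd) h =
  trans (mult-replicate-≢ m v x _ (<⇒≢ (≤-trans v<c h))) (mult-above v rs x sd (≤-trans (<⇒≤ v<c) h))

nth-vals< : ∀ c rs j → SD c rs → j < length rs → nth (vals rs) j < c
nth-vals< c ((v , m) ∷ rs) zero (h , _) lt = h
nth-vals< c ((v , m) ∷ rs) (suc j) (h , _ , _ , sd) (s≤s lt) = <-trans (nth-vals< v rs j sd lt) h

mult-nth : ∀ c rs j → SD c rs → j < length rs → mult (expand rs) (nth (vals rs) j) ≡ nth (mults rs) j
mult-nth c ((v , m) ∷ rs) zero (_ , _ , _ , sd) lt = trans (mult-replicate-≡ m v (expand rs))
  (trans (cong (m +_) (mult-above v rs v sd ≤-refl)) (+-identityʳ m))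
mult-nth c ((v , m) ∷ rs) (suc j) (_ , _ , _ , sd) (s≤s lt) =
  trans (mult-replicate-≢ m v _ (expand rs) (λ q → <⇒≢ (nth-vals< v rs j sd lt) (sym q))) (mult-nth v rs j sd lt)

ellBar-expand : ∀ c rs → SD c rs → ellBar (expand rs) ≡ length rs
ellBar-expand c rs sd = trans (cong length (distinct-expand c rs sd)) (length-map proj₁ rs)

bar-expand : ∀ c rs → SD c rs → ∀ i → bar (expand rs) i ≡ nth (vals rs) (i ∸ 1)
bar-expand c rs sd i = cong (λ q → nth q (i ∸ 1)) (distinct-expand c rs sd)

mult-bar : ∀ c rs → SD c rs → ∀ j → j < length rs → mult (expand rs) (bar (expand rs) (suc j)) ≡ nth (mults rs) j
mult-bar c rs sd j lt = trans (cong (mult (expand rs)) (bar-expand c rs sd (suc j))) (mult-nth c rs j sd lt)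

-- Conjugates of run lists

-- Conjugation exchanges the two coordinates: values become partial sums of multiplicities, offset
-- by `M`, and multiplicities become gaps between values, in reverse order.
cr : ℕ → Runs → Runs
cr M [] = []
cr M ((v , m) ∷ rs) = cr (M + m) rs ++ (M + m , v ∸ hd rs) ∷ []

gaps : Runs → List ℕ
gaps [] = []
gaps ((v , m) ∷ rs) = (v ∸ hd rs) ∷ gaps rs

cr-above : ∀ c M rs → SD c rs → All (λ r → M < proj₁ r) (cr M rs)
cr-above c M [] _ = []
cr-above c M ((v , m) ∷ rs) (_ , _ , pm , sd) =
  All.++⁺ (All.map (≤-<-trans (m≤m+n M m)) (cr-above v (M + m) rs sd)) (m<m+n M pm ∷ [])

SD-snoc : ∀ c rs v m → SD c rs → All (λ r → v < proj₁ r) rs → v < c → 0 < v → 0 < m → SD c (rs ++ (v , m) ∷ [])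
SD-snoc c [] v m sd al h pv pm = h , pv , pm , tt
SD-snoc c ((w , k) ∷ rs) v m (h₁ , h₂ , h₃ , sd) (a ∷ al) h pv pm = h₁ , h₂ , h₃ , SD-snoc w rs v m sd al a pv pm

hd< : ∀ v rs → 0 < v → SD v rs → hd rs < v
hd< v [] pv _ = pv
hd< v (_ ∷ rs) _ (h , _) = h

SD-cr : ∀ c c′ M rs → SD c′ rs → M + sum (mults rs) < c → SD c (cr M rs)
SD-cr c c′ M [] _ _ = tt
SD-cr c c′ M ((v , m) ∷ rs) (_ , pv , pm , sd) h = SD-snoc c (cr (M + m) rs) (M + m) (v ∸ hd rs)
  (SD-cr c v (M + m) rs sd (subst (_< c) (sym (+-assoc M m _)) h)) (cr-above v (M + m) rs sd)
  (≤-<-trans (+-monoʳ-≤ M (m≤m+n m _)) h) (≤-<-trans z≤n (m<m+n M pm)) (m<n⇒0<n∸m (hd< v rs pv sd))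

expand-++ : ∀ rs rs′ → expand (rs ++ rs′) ≡ expand rs ++ expand rs′
expand-++ [] rs′ = refl
expand-++ ((v , m) ∷ rs) rs′ = trans (cong (replicate m v ++_) (expand-++ rs rs′)) (sym (++-assoc (replicate m v) _ _))

applyUpTo-++ : ∀ {A : Set} (f : ℕ → A) a b → applyUpTo f (a + b) ≡ applyUpTo f a ++ applyUpTo (λ k → f (a + k)) b
applyUpTo-++ f zero b = refl
applyUpTo-++ f (suc a) b = cong (f 0 ∷_) (applyUpTo-++ (λ k → f (suc k)) a b)

applyUpTo-cong : ∀ {A : Set} {f g : ℕ → A} n → (∀ k → k < n → f k ≡ g k) → applyUpTo f n ≡ applyUpTo g n
applyUpTo-cong zero h = refl
applyUpTo-cong (suc n) h = cong₂ _∷_ (h 0 (s≤s z≤n)) (applyUpTo-cong n (λ k lt → h (suc k) (s≤s lt)))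

applyUpTo-const : ∀ {A : Set} (x : A) n → applyUpTo (λ _ → x) n ≡ replicate n x
applyUpTo-const x zero = refl
applyUpTo-const x (suc n) = cong (x ∷_) (applyUpTo-const x n)

countGe-replicate : ∀ k m v l → k ≤ v → countGe k (replicate m v ++ l) ≡ m + countGe k l
countGe-replicate k zero v l h = refl
countGe-replicate k (suc m) v l h rewrite T⇒≡ (≤⇒≤ᵇ h) = cong suc (countGe-replicate k m v l h)

countGe-0 : ∀ k l → All (_< k) l → countGe k l ≡ 0
countGe-0 k [] [] = refl
countGe-0 k (x ∷ l) (h ∷ al) with k ≤ᵇ x in eq
... | false = countGe-0 k l al
... | true = ⊥-elim (<⇒≱ h (≤ᵇ⇒≤ k x (subst T (sym eq) tt)))

SD-expand : ∀ c rs → SD c rs → All (_< c) (expand rs)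
SD-expand c [] _ = []
SD-expand c ((v , m) ∷ rs) (h , _ , _ , sd) = All.++⁺ (All.replicate⁺ m h) (All.map (λ q → <-trans q h) (SD-expand v rs sd))

SD-hd : ∀ c rs → SD c rs → SD (suc (hd rs)) rs
SD-hd c [] _ = tt
SD-hd c (_ ∷ rs) (_ , r) = ≤-refl , r

conj-runs : ∀ c M rs → SD c rs → applyUpTo (λ k → M + countGe (suc k) (expand rs)) (hd rs) ≡ expand (cr M rs)
conj-runs c M [] _ = refl
conj-runs c M ((v , m) ∷ rs) (_ , pv , pm , sd) = trans
  (trans (cong (applyUpTo F) (sym (m+[n∸m]≡n (<⇒≤ (hd< v rs pv sd))))) (applyUpTo-++ F (hd rs) (v ∸ hd rs)))
  (trans (cong₂ _++_ low high) (sym (expand-++ (cr (M + m) rs) _)))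
  where
  F : ℕ → ℕ
  F k = M + countGe (suc k) (replicate m v ++ expand rs)
  low : applyUpTo F (hd rs) ≡ expand (cr (M + m) rs)
  low = trans (applyUpTo-cong (hd rs) (λ k lt → trans
      (cong (M +_) (countGe-replicate (suc k) m v (expand rs) (≤-trans lt (<⇒≤ (hd< v rs pv sd)))))
      (sym (+-assoc M m _))))
    (conj-runs v (M + m) rs sd)
  high : applyUpTo (λ k → F (hd rs + k)) (v ∸ hd rs) ≡ replicate (v ∸ hd rs) (M + m) ++ []
  high = trans (applyUpTo-cong (v ∸ hd rs) (λ k lt → cong (M +_) (trans
      (countGe-replicate (suc (hd rs + k)) m v (expand rs)
        (subst (suc (hd rs + k) ≤_) (m+[n∸m]≡n (<⇒≤ (hd< v rs pv sd))) (subst (_≤ hd rs + (v ∸ hd rs)) (+-suc (hd rs) k) (+-monoʳ-≤ (hd rs) lt))))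
      (trans (cong (m +_) (countGe-0 _ _ (All.map (λ q → ≤-trans q (s≤s (m≤m+n (hd rs) k))) (SD-expand _ rs (SD-hd v rs sd))))) (+-identityʳ m)))))
    (trans (applyUpTo-const (M + m) (v ∸ hd rs)) (sym (++-identityʳ _)))

headOr0-expand : ∀ c rs → SD c rs → headOr0 (expand rs) ≡ hd rs
headOr0-expand c [] _ = refl
headOr0-expand c ((v , suc m) ∷ rs) _ = refl

conj-expand : ∀ c rs → SD c rs → conj (expand rs) ≡ expand (cr 0 rs)
conj-expand c rs sd = trans (cong (applyUpTo (λ k → countGe (suc k) (expand rs))) (headOr0-expand c rs sd)) (conj-runs c 0 rs sd)

cr-length : ∀ M rs → length (cr M rs) ≡ length rs
cr-length M [] = refl
cr-length M ((v , m) ∷ rs) = trans (length-++ (cr (M + m) rs)) (trans (+-comm _ 1) (cong suc (cr-length (M + m) rs)))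

cr-mults : ∀ M rs → mults (cr M rs) ≡ reverse (gaps rs)
cr-mults M [] = refl
cr-mults M ((v , m) ∷ rs) = trans (map-++ proj₂ (cr (M + m) rs) _)
  (trans (cong (_++ (v ∸ hd rs) ∷ []) (cr-mults (M + m) rs)) (sym (unfold-reverse (v ∸ hd rs) (gaps rs))))

gaps-length : ∀ rs → length (gaps rs) ≡ length rs
gaps-length [] = refl
gaps-length (_ ∷ rs) = cong suc (gaps-length rs)

nth-++ˡ : ∀ l m j → j < length l → nth (l ++ m) j ≡ nth l j
nth-++ˡ (x ∷ l) m zero _ = refl
nth-++ˡ (x ∷ l) m (suc j) (s≤s lt) = nth-++ˡ l m j lt

nth-++ʳ : ∀ l m j → nth (l ++ m) (length l + j) ≡ nth m j
nth-++ʳ [] m j = refl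
nth-++ʳ (x ∷ l) m j = nth-++ʳ l m j

nth-reverse : ∀ l j → j < length l → nth (reverse l) (length l ∸ suc j) ≡ nth l j
nth-reverse (x ∷ l) zero _ rewrite unfold-reverse x l =
  trans (cong (nth (reverse l ++ x ∷ [])) (trans (sym (length-reverse l)) (sym (+-identityʳ _)))) (nth-++ʳ (reverse l) (x ∷ []) 0)
nth-reverse (x ∷ l) (suc j) (s≤s lt) rewrite unfold-reverse x l =
  trans (nth-++ˡ (reverse l) (x ∷ []) _ (subst (length l ∸ suc j <_) (sym (length-reverse l)) (∸-monoʳ-< (s≤s z≤n) lt))) (nth-reverse l j lt)

-- Operator sequences indexed by the runs of a partition

groups : ∀ {B : Set} → (ℕ → ℕ → B) → List ℕ → List B
groups h [] = []
groups h (g ∷ gs) = applyUpTo (h 0) g ++ groups (λ i → h (suc i)) gs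

groups-concat : ∀ {B : Set} (h : ℕ → ℕ → B) gs → concat (applyUpTo (λ i → applyUpTo (h i) (nth gs i)) (length gs)) ≡ groups h gs
groups-concat h [] = refl
groups-concat h (g ∷ gs) = cong (applyUpTo (h 0) g ++_) (groups-concat (λ i → h (suc i)) gs)

groups-cong : ∀ {B : Set} {h k : ℕ → ℕ → B} gs → (∀ i r → i < length gs → r < nth gs i → h i r ≡ k i r) → groups h gs ≡ groups k gs
groups-cong [] e = refl
groups-cong (g ∷ gs) e = cong₂ _++_ (applyUpTo-cong g (λ r lt → e 0 r (s≤s z≤n) lt)) (groups-cong gs (λ i r lt lt′ → e (suc i) r (s≤s lt) lt′))

map-groups : ∀ {B B′ : Set} (f : B → B′) (h : ℕ → ℕ → B) gs → map f (groups h gs) ≡ groups (λ i r → f (h i r)) gs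
map-groups f h [] = refl
map-groups f h (g ∷ gs) = trans (map-++ f (applyUpTo (h 0) g) _) (cong₂ _++_ (map-applyUpTo (h 0) f g) (map-groups f (λ i → h (suc i)) gs))

foldl-map : ∀ {B X Y : Set} (s : B → Y → B) (h : X → Y) b l → foldl (λ t x → s t (h x)) b l ≡ foldl s b (map h l)
foldl-map s h b [] = refl
foldl-map s h b (x ∷ l) = foldl-map s h (s b (h x)) l

sumTo-cong : ∀ k {g h : ℕ → ℕ} → (∀ j → j < k → g (suc j) ≡ h (suc j)) → sumTo k g ≡ sumTo k h
sumTo-cong zero e = refl
sumTo-cong (suc k) e = cong₂ _+_ (sumTo-cong k (λ j lt → e j (≤-trans lt (n≤1+n k)))) (e k ≤-refl)

sumTo-suc : ∀ k g → sumTo (suc k) g ≡ g 1 + sumTo k (λ j → g (suc j))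
sumTo-suc zero g = +-comm 0 (g 1)
sumTo-suc (suc k) g = trans (cong (_+ g (suc (suc k))) (sumTo-suc k g)) (+-assoc (g 1) _ _)

offs : Runs → ℕ → ℕ
offs rs zero = 0
offs [] (suc i) = 0
offs ((v , m) ∷ rs) (suc i) = m * v + offs rs i

sumTo-offs : ∀ rs k → sumTo k (λ j → nth (mults rs) (j ∸ 1) * nth (vals rs) (j ∸ 1)) ≡ offs rs k
sumTo-offs rs zero = refl
sumTo-offs [] (suc k) = trans (+-identityʳ _) (go k)
  where
  go : ∀ k → sumTo k (λ j → 0) ≡ 0
  go zero = refl
  go (suc k) = trans (+-identityʳ _) (go k)
sumTo-offs ((v , m) ∷ rs) (suc k) = trans (sumTo-suc k _)
  (cong (m * v +_) (trans (sumTo-cong k (λ j _ → refl)) (sumTo-offs rs k)))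

sumTo-++ : ∀ l m k → k ≤ length l → sumTo k (λ j → nth (l ++ m) (j ∸ 1)) ≡ sumTo k (λ j → nth l (j ∸ 1))
sumTo-++ l m k h = sumTo-cong k (λ j lt → nth-++ˡ l m j (≤-trans lt h))

sumTo-length : ∀ l → sumTo (length l) (λ j → nth l (j ∸ 1)) ≡ sum l
sumTo-length [] = refl
sumTo-length (x ∷ l) = trans (sumTo-suc (length l) _) (cong (x +_) (trans (sumTo-cong (length l) (λ j _ → refl)) (sumTo-length l)))

gaps-telescope : ∀ c rs → SD c rs → sum (gaps rs) ≡ hd rs
gaps-telescope c [] _ = refl
gaps-telescope c ((v , m) ∷ rs) (_ , pv , _ , sd) = trans (cong (v ∸ hd rs +_) (gaps-telescope v rs sd)) (m∸n+n≡m (<⇒≤ (hd< v rs pv sd)))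

sum-reverse : ∀ l → sum (reverse l) ≡ sum l
sum-reverse [] = refl
sum-reverse (x ∷ l) rewrite unfold-reverse x l = trans (sum-++ (reverse l) (x ∷ [])) (trans (cong₂ _+_ (sum-reverse l) (+-identityʳ x)) (+-comm (sum l) x))

-- Reversed gaps telescope from the smallest value upwards; this turns the index `bnc` into a part
-- of the partition.
sumTo-gaps : ∀ c rs i → SD c rs → i < length rs →
  sumTo (length rs ∸ i) (λ j → nth (reverse (gaps rs)) (j ∸ 1)) ≡ nth (vals rs) i
sumTo-gaps c rs@((v , m) ∷ rs′) zero sd _ = trans
  (cong (λ q → sumTo q (λ j → nth (reverse (gaps rs)) (j ∸ 1))) (sym (trans (length-reverse (gaps rs)) (gaps-length rs))))
  (trans (sumTo-length (reverse (gaps rs))) (trans (sum-reverse (gaps rs)) (gaps-telescope c rs sd)))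
sumTo-gaps c ((v , m) ∷ rs) (suc i) (_ , _ , _ , sd) (s≤s lt) rewrite unfold-reverse (v ∸ hd rs) (gaps rs) =
  trans (sumTo-++ (reverse (gaps rs)) _ (length rs ∸ i) (≤-trans (m∸n≤m (length rs) i) (≤-reflexive (sym (trans (length-reverse (gaps rs)) (gaps-length rs))))))
    (sumTo-gaps v rs i sd lt)

-- Uniqueness of the Φ-image concerns every pair (f, λ) representing a path, so the index set is
-- computed for arbitrary runs, not only for the distinct parts produced by levels. Splitting off
-- the first run absorbs `ellBar ∸ 1`: the groups are indexed by `rs`.
module RunList (c v m : ℕ) (rs : Runs) (sd : SD c ((v , m) ∷ rs)) where

  all : Runs
  all = (v , m) ∷ rs

  l : List ℕ
  l = expand all

  private
    c′ : ℕ
    c′ = suc (sum (mults all))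

    sd′ : SD c′ (cr 0 all)
    sd′ = SD-cr c′ c 0 all sd ≤-refl

    ell : ellBar (conj l) ≡ suc (length rs)
    ell = trans (cong ellBar (conj-expand c all sd)) (trans (ellBar-expand c′ (cr 0 all) sd′) (cr-length 0 all))

    multAt-conj : ∀ j → j < suc (length rs) → mult (conj l) (bar (conj l) (suc j)) ≡ nth (reverse (gaps all)) j
    multAt-conj j lt rewrite conj-expand c all sd = trans (mult-bar c′ (cr 0 all) sd′ j (subst (j <_) (sym (cr-length 0 all)) lt))
      (cong (λ q → nth q j) (cr-mults 0 all))

  ellBar-l : ellBar l ≡ suc (length rs)
  ellBar-l = ellBar-expand c all sd

  bar-l : ∀ i → bar l i ≡ nth (vals all) (i ∸ 1)
  bar-l = bar-expand c all sd

  multAt-gaps : ∀ i → i < length rs → multAt (conj l) (suc i) ≡ nth (gaps rs) i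
  multAt-gaps i lt = trans (cong (λ q → mult (conj l) (bar (conj l) (q ∸ suc i))) ell)
    (trans (cong (λ q → mult (conj l) (bar (conj l) q)) (sym (suc-pred (length rs ∸ i) ⦃ >-nonZero (m<n⇒0<n∸m lt) ⦄)))
    (trans (multAt-conj (pred (length rs ∸ i)) (s≤s (≤-trans (pred[n]≤n {length rs ∸ i}) (m∸n≤m (length rs) i))))
    (trans (cong (nth (reverse (gaps all))) index) (nth-reverse (gaps all) (suc i) (s≤s (subst (i <_) (sym (gaps-length rs)) lt))))))
    where
    index : pred (length rs ∸ i) ≡ length (gaps all) ∸ suc (suc i)
    index = trans (pred[m∸n]≡m∸[1+n] (length rs) i) (cong (_∸ suc i) (sym (gaps-length rs)))

  Ibnc-groups : Ibnc (conj l) ≡ groups (λ i r → suc i , suc r) (gaps rs)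
  Ibnc-groups = trans (cong (λ q → concat (applyUpTo (λ i → applyUpTo (λ r → (suc i , suc r)) (multAt (conj l) (suc i))) (q ∸ 1))) ell)
    (trans (cong concat (applyUpTo-cong (length rs) (λ i lt → cong (applyUpTo (λ r → (suc i , suc r))) (multAt-gaps i lt))))
    (trans (cong (λ q → concat (applyUpTo (λ i → applyUpTo (λ r → (suc i , suc r)) (nth (gaps rs) i)) q)) (sym (gaps-length rs)))
      (groups-concat (λ i r → suc i , suc r) (gaps rs))))

  row-offs : ∀ i r → i < length rs → row l (suc i) r ≡ r + offs all (suc i)
  row-offs i r lt = cong (r +_) (trans (sumTo-cong (suc i) (λ j lt′ → cong₂ _*_ (mult-bar c all sd j (≤-trans lt′ (s≤s (<⇒≤ lt)))) (bar-l (suc j))))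
    (sumTo-offs all (suc i)))

  bnc-vals : ∀ i r → i < length rs → bnc (conj l) (suc i) (suc r) ≡ nth (vals rs) i ∸ r
  bnc-vals i r lt = cong (_∸ r) (trans (cong (λ q → sumTo (q ∸ suc i) (λ j → mult (conj l) (bar (conj l) j))) ell)
    (trans (sumTo-cong (length rs ∸ i) (λ j lt′ → multAt-conj j (≤-trans lt′ (≤-trans (m∸n≤m (length rs) i) (n≤1+n _)))))
      (sumTo-gaps c all (suc i) sd (s≤s lt))))

  opsA opsB : (ℕ → ℕ → ℕ) → List (ℕ × ℕ)
  opsA f = groups (λ i r → suc r + offs all (suc i) , f (suc i) (suc r)) (gaps rs)
  opsB f = groups (λ i r → nth (vals rs) i ∸ r , f (suc i) (suc r)) (gaps rs)

  Aof-ops : ∀ n f → Aof n l f ≡ foldl (λ t jk → pow (proj₂ jk) (A n (proj₁ jk)) t) (just (pathOf l)) (opsA f)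
  Aof-ops n f = trans (foldl-map (λ t jk → pow (proj₂ jk) (A n (proj₁ jk)) t) (λ ir → row l (proj₁ ir) (proj₂ ir) , f (proj₁ ir) (proj₂ ir)) _ (Ibnc (conj l)))
    (cong (foldl _ _) (trans (cong (map _) Ibnc-groups) (trans (map-groups _ _ (gaps rs))
      (groups-cong (gaps rs) (λ i r lt _ → cong (_, f (suc i) (suc r)) (row-offs i (suc r) (subst (i <_) (gaps-length rs) lt)))))))

  Bof-ops : ∀ n f → Bof n l f ≡ foldl (λ t jk → Bop n (proj₁ jk) (proj₂ jk) t) (just (pathOf (conj l))) (opsB f)
  Bof-ops n f = trans (foldl-map (λ t jk → Bop n (proj₁ jk) (proj₂ jk) t) (λ ir → bnc (conj l) (proj₁ ir) (proj₂ ir) , f (proj₁ ir) (proj₂ ir)) _ (Ibnc (conj l)))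
    (cong (foldl _ _) (trans (cong (map _) Ibnc-groups) (trans (map-groups _ _ (gaps rs))
      (groups-cong (gaps rs) (λ i r lt _ → cong (_, f (suc i) (suc r)) (bnc-vals i r (subst (i <_) (gaps-length rs) lt)))))))

runA : ℕ → List (ℕ × ℕ) → Maybe Path → Maybe Path
runA n ops t = foldl (λ t jk → pow (proj₂ jk) (A n (proj₁ jk)) t) t ops

-- The effect of a successful sequence of operators A

hit : ℕ → ℕ → ℕ → ℕ
hit j k i = if suc i ≡ᵇ j then k else 0

hit-≡ : ∀ i k → hit (suc i) k i ≡ k
hit-≡ i k rewrite ≡ᵇ-refl i = refl

hit-≢ : ∀ {i j} k → suc i ≢ j → hit j k i ≡ 0
hit-≢ {i} {j} k ne rewrite ≡ᵇ-false {suc i} {j} ne = refl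

hit-0 : ∀ j i → hit j 0 i ≡ 0
hit-0 j i with suc i ≡ᵇ j
... | true = refl
... | false = refl

hit-+ : ∀ j k k′ i → hit j (k + k′) i ≡ hit j k i + hit j k′ i
hit-+ j k k′ i with suc i ≡ᵇ j
... | true = refl
... | false = refl

amt : List (ℕ × ℕ) → ℕ → ℕ
amt [] i = 0
amt ((j , k) ∷ ops) i = hit j k i + amt ops i

amt-++ : ∀ o o′ i → amt (o ++ o′) i ≡ amt o i + amt o′ i
amt-++ [] o′ i = refl
amt-++ ((j , k) ∷ o) o′ i = trans (cong (hit j k i +_) (amt-++ o o′ i)) (sym (+-assoc (hit j k i) (amt o i) (amt o′ i)))

setAt-dec : ∀ l j l′ → setAt l j decM ≡ just l′ → ∀ i → nth l′ i + hit j 1 i ≡ nth l i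
setAt-dec (suc x ∷ l) (suc zero) .(x ∷ l) refl zero = +-comm x 1
setAt-dec (suc x ∷ l) (suc zero) .(x ∷ l) refl (suc i) = +-identityʳ _
setAt-dec (x ∷ l) (suc (suc j)) l′ eq i with setAt l (suc j) decM in eq′
setAt-dec (x ∷ l) (suc (suc j)) .(x ∷ l″) refl zero | just l″ = +-identityʳ x
setAt-dec (x ∷ l) (suc (suc j)) .(x ∷ l″) refl (suc i) | just l″ = setAt-dec l (suc j) l″ eq′ i

pow-nothing : ∀ k n j → pow k (A n j) nothing ≡ nothing
pow-nothing zero n j = refl
pow-nothing (suc k) n j = pow-nothing k n j

pow-A-inv : ∀ k n j p p′ → InD n p → pow k (A n j) (just p) ≡ just p′ →
  InD n p′ × ∀ i → nth (xs p′) i + hit j k i ≡ nth (xs p) i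
pow-A-inv zero n j p .p d refl = d , λ i → trans (cong (nth (xs p) i +_) (hit-0 j i)) (+-identityʳ _)
pow-A-inv (suc k) n j p p′ d eq with A n j (just p) in eq₁
... | nothing with () ← trans (sym (pow-nothing k n j)) eq
... | just q with modX-inv {n} {j} {decM} {p} {q} eq₁
...   | dq , s with pow-A-inv k n j q p′ dq eq
...     | d′ , h = d′ , λ i → trans (cong (nth (xs p′) i +_) (trans (hit-+ j 1 k i) (+-comm (hit j 1 i) _)))
            (trans (sym (+-assoc (nth (xs p′) i) (hit j k i) (hit j 1 i))) (trans (cong (_+ hit j 1 i) (h i)) (setAt-dec (xs p) j (xs q) s i)))

runA-nothing : ∀ n ops → runA n ops nothing ≡ nothing
runA-nothing n [] = refl
runA-nothing n ((j , k) ∷ ops) = trans (cong (runA n ops) (pow-nothing k n j)) (runA-nothing n ops)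

-- If no factor yields ⊥, displacements simply add up row by row, whatever the intermediate paths
-- are.
runA-inv : ∀ n ops p p′ → InD n p → runA n ops (just p) ≡ just p′ →
  InD n p′ × ∀ i → nth (xs p′) i + amt ops i ≡ nth (xs p) i
runA-inv n [] p .p d refl = d , λ i → +-identityʳ _
runA-inv n ((j , k) ∷ ops) p p′ d eq with pow k (A n j) (just p) in eq₁
... | nothing with () ← trans (sym (runA-nothing n ops)) eq
... | just q with pow-A-inv k n j p q d eq₁
...   | dq , h with runA-inv n ops q p′ dq eq
...     | d′ , h′ = d′ , λ i → trans (cong (nth (xs p′) i +_) (+-comm (hit j k i) (amt ops i)))
            (trans (sym (+-assoc (nth (xs p′) i) (amt ops i) (hit j k i))) (trans (cong (_+ hit j k i) (h′ i)) (h i)))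

amt-below : ∀ o (g : ℕ → ℕ) c i → i < o → amt (applyUpTo (λ r → suc r + o , g r) c) i ≡ 0
amt-below o g zero i lt = refl
amt-below o g (suc c) i lt = cong₂ _+_ (hit-≢ (g 0) (λ q → <⇒≢ lt (suc-injective q)))
  (trans (cong (λ l → amt l i) (applyUpTo-cong c (λ k _ → cong (_, g (suc k)) (sym (+-suc (suc k) o)))))
    (amt-below (suc o) (λ r → g (suc r)) c i (≤-trans lt (n≤1+n o))))

amt-above : ∀ o (g : ℕ → ℕ) c i → o + c ≤ i → amt (applyUpTo (λ r → suc r + o , g r) c) i ≡ 0
amt-above o g zero i le = refl
amt-above o g (suc c) i le = cong₂ _+_ (hit-≢ (g 0) (λ q → <⇒≢ (≤-trans (s≤s (m≤m+n o c)) (subst (_≤ i) (+-suc o c) le)) (sym (suc-injective q))))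
  (trans (cong (λ l → amt l i) (applyUpTo-cong c (λ k _ → cong (_, g (suc k)) (sym (+-suc (suc k) o)))))
    (amt-above (suc o) (λ r → g (suc r)) c i (subst (_≤ i) (+-suc o c) le)))

amt-at : ∀ o (g : ℕ → ℕ) c r → r < c → amt (applyUpTo (λ r → suc r + o , g r) c) (o + r) ≡ g r
amt-at o g (suc c) zero lt = trans (cong₂ _+_ (trans (cong (hit (suc o) (g 0)) (+-identityʳ o)) (hit-≡ o (g 0)))
    (trans (cong (λ l → amt l (o + 0)) (applyUpTo-cong c (λ k _ → cong (_, g (suc k)) (sym (+-suc (suc k) o)))))
      (amt-below (suc o) (λ r → g (suc r)) c (o + 0) (s≤s (≤-reflexive (+-identityʳ o))))))
  (+-identityʳ (g 0))
amt-at o g (suc c) (suc r) (s≤s lt) = trans (cong₂ _+_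
    (hit-≢ (g 0) (λ q → m≢1+m+n o (sym (trans (sym (+-suc o r)) (suc-injective q)))))
    (trans (cong₂ amt (applyUpTo-cong c (λ k _ → cong (_, g (suc k)) (sym (+-suc (suc k) o)))) (+-suc o r))
      (amt-at (suc o) (λ r → g (suc r)) c r lt)))
  refl

-- The rows and exponents of A^f when the runs of the partition start below row o + 1.
AO : ℕ → (ℕ → ℕ → ℕ) → Runs → List (ℕ × ℕ)
AO o F [] = []
AO o F ((v , m) ∷ rs) = groups (λ i r → suc r + (o + offs ((v , m) ∷ rs) (suc i)) , F i r) (gaps rs)

AO-step : ∀ o F v m v′ m′ rs → AO o F ((v , m) ∷ (v′ , m′) ∷ rs) ≡
  applyUpTo (λ r → suc r + (o + m * v) , F 0 r) (v′ ∸ hd rs) ++ AO (o + m * v) (λ i → F (suc i)) ((v′ , m′) ∷ rs)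
AO-step o F v m v′ m′ rs = cong₂ _++_
  (applyUpTo-cong (v′ ∸ hd rs) (λ r _ → cong (λ q → suc r + (o + q) , F 0 r) (+-identityʳ (m * v))))
  (groups-cong (gaps rs) (λ i r _ _ → cong (λ q → suc r + q , F (suc i) r) (sym (+-assoc o (m * v) _))))

v≤mv : ∀ m v → 0 < m → v ≤ m * v
v≤mv (suc m) v _ = m≤m+n v (m * v)

AO-low : ∀ c o F v m rs i → SD c ((v , m) ∷ rs) → i < o + m * v → amt (AO o F ((v , m) ∷ rs)) i ≡ 0
AO-low c o F v m [] i sd lt = refl
AO-low c o F v m ((v′ , m′) ∷ rs) i (_ , _ , _ , sd) lt = trans (cong (λ l → amt l i) (AO-step o F v m v′ m′ rs))
  (trans (amt-++ (applyUpTo _ (v′ ∸ hd rs)) _ i)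
    (cong₂ _+_ (amt-below (o + m * v) (F 0) (v′ ∸ hd rs) i lt) (AO-low v (o + m * v) _ v′ m′ rs i sd (≤-trans lt (m≤m+n _ _)))))

AO-high : ∀ o F v m v′ m′ rs i → o + m * v + v′ ≤ i →
  amt (AO o F ((v , m) ∷ (v′ , m′) ∷ rs)) i ≡ amt (AO (o + m * v) (λ i → F (suc i)) ((v′ , m′) ∷ rs)) i
AO-high o F v m v′ m′ rs i le = trans (cong (λ l → amt l i) (AO-step o F v m v′ m′ rs))
  (trans (amt-++ (applyUpTo _ (v′ ∸ hd rs)) _ i)
    (cong (_+ amt (AO (o + m * v) (λ i → F (suc i)) ((v′ , m′) ∷ rs)) i)
      (amt-above (o + m * v) (F 0) (v′ ∸ hd rs) i (≤-trans (+-monoʳ-≤ (o + m * v) (m∸n≤m v′ (hd rs))) le))))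

-- The groups address disjoint sets of rows: each stays inside the first block of its run, because a
-- gap is at most the value itself.
AO-amt : ∀ c o F v m rs i r → SD c ((v , m) ∷ rs) → i < length (gaps rs) → r < nth (gaps rs) i →
  amt (AO o F ((v , m) ∷ rs)) (o + offs ((v , m) ∷ rs) (suc i) + r) ≡ F i r
AO-amt c o F v m ((v′ , m′) ∷ rs) zero r (_ , _ , _ , sd@(_ , _ , pm′ , _)) lt lt′ =
  trans (cong (λ q → amt (AO o F ((v , m) ∷ (v′ , m′) ∷ rs)) (o + q + r)) (+-identityʳ (m * v)))
  (trans (cong (λ l → amt l (o + m * v + r)) (AO-step o F v m v′ m′ rs))
  (trans (amt-++ (applyUpTo _ (v′ ∸ hd rs)) _ (o + m * v + r))
  (trans (cong₂ _+_ (amt-at (o + m * v) (F 0) (v′ ∸ hd rs) r lt′)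
      (AO-low v (o + m * v) _ v′ m′ rs _ sd (+-monoʳ-< (o + m * v) (≤-trans lt′ (≤-trans (m∸n≤m v′ (hd rs)) (v≤mv m′ v′ pm′))))))
    (+-identityʳ (F 0 r)))))
AO-amt c o F v m ((v′ , m′) ∷ rs) (suc i) r (_ , _ , _ , sd@(_ , _ , pm′ , _)) (s≤s lt) lt′ =
  trans (cong (λ q → amt (AO o F ((v , m) ∷ (v′ , m′) ∷ rs)) (q + r)) (sym (+-assoc o (m * v) _)))
  (trans (AO-high o F v m v′ m′ rs _ (≤-trans (+-monoʳ-≤ (o + m * v) (≤-trans (v≤mv m′ v′ pm′) (m≤m+n (m′ * v′) (offs rs i))))
      (m≤m+n _ r)))
    (AO-amt v (o + m * v) (λ i → F (suc i)) v′ m′ rs i r sd lt lt′))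

-- The bounce composition after lowering rows

-- With `d` the displacement of the rows, row `b + a` (counted from 0) is the first one after the
-- bounce point `b + a`. Moved by less than `a`, it stays right of `b`; by monotonicity so do all
-- later rows, and the bounce points survive.
Small : (ℕ → ℕ) → ℕ → List ℕ → Set
Small d b [] = ⊤
Small d b (a ∷ []) = ⊤
Small d b (a ∷ α@(_ ∷ _)) = d (b + a) < a × Small d (b + a) α

cntLe-nth : ∀ c j b k l → VX c j l → (∀ i → i < k → nth l i ≤ b) → (k < length l → b < nth l k) → k ≤ length l → cntLe b l ≡ k
cntLe-nth c j b zero [] v lo hi le = refl
cntLe-nth c j b zero (x ∷ l) (_ , _ , v) lo hi le = cntLe-none b (x ∷ l) (hi (s≤s z≤n) ∷ All.map (≤-trans (hi (s≤s z≤n))) (VX-All l v))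
cntLe-nth c j b (suc k) (x ∷ l) (_ , _ , v) lo hi (s≤s le) = trans (cntLe-≤ l (lo 0 (s≤s z≤n)))
  (cong suc (cntLe-nth x (suc j) b k l v (λ i lt → lo (suc i) (s≤s lt)) (λ lt → hi (s≤s lt)) le))

nth-All : ∀ {b} l i → All (_≤ b) l → nth l i ≤ b
nth-All [] i _ = z≤n
nth-All (x ∷ l) zero (h ∷ _) = h
nth-All (x ∷ l) (suc i) (_ ∷ al) = nth-All l i al

BP-perturbed : ∀ n X d L b α → VX 0 0 X → length X ≡ n → (∀ i → nth X i + d i ≡ nth (L ++ toX b (zeroBlocks α)) i) →
  length L ≡ b → All (_≤ b) L → Positive α → b + sum α ≡ n → Small d b α → BP n X b α
BP-perturbed n X d L b [] v len eqs lL aL p s sm = trans (sym (+-identityʳ b)) s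
BP-perturbed n X d L b (a ∷ α) v len eqs lL aL (pa ∷ p) s sm = pa ,
  cntLe-nth 0 0 b (b + a) X v low (high α s p sm eqs′) (subst (b + a ≤_) (sym len) (subst (b + a ≤_) (trans (+-assoc b a (sum α)) s) (m≤m+n (b + a) (sum α)))) ,
  BP-perturbed n X d L′ (b + a) α v len eqs′ lenL′ (All.map (λ h → ≤-trans h (m≤m+n b a)) aL′) p (trans (+-assoc b a (sum α)) s) (rest α sm)
  where
  L′ : List ℕ
  L′ = L ++ replicate a b
  lenL′ : length L′ ≡ b + a
  lenL′ = trans (length-++ L) (cong₂ _+_ lL (length-replicate a))
  aL′ : All (_≤ b) L′
  aL′ = All.++⁺ aL (All.replicate⁺ a ≤-refl)
  shape : L ++ toX b (zeroBlocks (a ∷ α)) ≡ L′ ++ toX (b + a) (zeroBlocks α)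
  shape = trans (cong₂ (λ q r → L ++ q ++ toX (b + r) (zeroBlocks α)) (map-replicate (b ∸_) a 0) (length-replicate a))
    (sym (++-assoc L (replicate a b) _))
  eqs′ : ∀ i → nth X i + d i ≡ nth (L′ ++ toX (b + a) (zeroBlocks α)) i
  eqs′ i = trans (eqs i) (cong (λ q → nth q i) shape)
  low : ∀ i → i < b + a → nth X i ≤ b
  low i lt = ≤-trans (m≤m+n (nth X i) (d i)) (≤-trans (≤-reflexive (trans (eqs′ i) (nth-++ˡ L′ _ i (subst (i <_) (sym lenL′) lt)))) (nth-All L′ i aL′))
  high : ∀ α → b + (a + sum α) ≡ n → Positive α → Small d b (a ∷ α) → (∀ i → nth X i + d i ≡ nth (L′ ++ toX (b + a) (zeroBlocks α)) i) → b + a < length X → b < nth X (b + a)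
  high [] s _ _ eqs lt = ⊥-elim (<⇒≢ (subst (b + a <_) len lt) (trans (cong (b +_) (sym (+-identityʳ a))) s))
  high (suc a′ ∷ α) _ (_ ∷ _) (sm , _) eqs lt = +-cancelʳ-< (d (b + a)) b (nth X (b + a)) (≤-trans (+-monoʳ-< b sm)
    (≤-reflexive (sym (trans (eqs (b + a)) (trans (cong (nth (L′ ++ _)) (trans (sym lenL′) (sym (+-identityʳ _)))) (nth-++ʳ L′ _ 0))))))
  rest : ∀ α → Small d b (a ∷ α) → Small d (b + a) α
  rest [] _ = tt
  rest (_ ∷ _) (_ , sm) = sm

small-run : ∀ d v rs m b → 0 < m → (∀ k → 0 < k → k < m → d (b + k * v) < v) → (rs ≢ [] → d (b + m * v) < v) →
  Small d (b + m * v) rs → Small d b (replicate m v ++ rs)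
small-run d v [] (suc zero) b _ z e r = tt
small-run d v (x ∷ rs) (suc zero) b _ z e r = subst (λ q → d (b + q) < v) (+-identityʳ v) (e (λ ())) , subst (λ q → Small d (b + q) (x ∷ rs)) (+-identityʳ v) r
small-run d v rs (suc (suc m)) b _ z e r = subst (λ q → d (b + q) < v) (+-identityʳ v) (z 1 (s≤s z≤n) (s≤s (s≤s z≤n))) ,
  small-run d v rs (suc m) (b + v) (s≤s z≤n)
    (λ k pk lt → subst (λ q → d q < v) (sym (+-assoc b v (k * v))) (z (suc k) (s≤s z≤n) (s≤s lt)))
    (λ ne → subst (λ q → d q < v) (sym (+-assoc b v (v + m * v))) (e ne))
    (subst (λ q → Small d q rs) (sym (+-assoc b v (v + m * v))) r)

-- Inside a run the first rows of blocks do not move; where a new run starts, the first row moves by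
-- `F i 0`. Thus the condition is exactly f(i,1) < λ̄_i.
small-AO : ∀ c o F d v m rs → SD c ((v , m) ∷ rs) → (∀ i → o + v ≤ i → d i ≡ amt (AO o F ((v , m) ∷ rs)) i) →
  (∀ i → i < length rs → F i 0 < nth (vals ((v , m) ∷ rs)) i) → Small d o (expand ((v , m) ∷ rs))
small-AO c o F d v m [] (_ , pv , pm , _) eqs bd = small-run d v [] m o pm
  (λ { (suc k) _ lt → ≤-<-trans (≤-reflexive (eqs (o + suc k * v) (+-monoʳ-≤ o (m≤m+n v (k * v))))) pv }) (λ ne → ⊥-elim (ne refl)) tt
small-AO c o F d v m ((v′ , m′) ∷ rs) sd@(_ , pv , pm , sd′@(_ , pv′ , pm′ , sdr)) eqs bd =
  small-run d v (expand ((v′ , m′) ∷ rs)) m o pm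
    (λ { (suc k) _ lt → ≤-<-trans (≤-reflexive (trans (eqs (o + suc k * v) (+-monoʳ-≤ o (m≤m+n v (k * v))))
        (AO-low c o F v m ((v′ , m′) ∷ rs) (o + suc k * v) sd (+-monoʳ-< o (*-monoˡ-< v ⦃ >-nonZero pv ⦄ lt))))) pv })
    (λ _ → ≤-<-trans (≤-reflexive (trans (eqs (o + m * v) (+-monoʳ-≤ o (v≤mv m v pm))) first)) (bd 0 (s≤s z≤n)))
    (small-AO v (o + m * v) (λ i → F (suc i)) d v′ m′ rs sd′
      (λ i le → trans (eqs i (≤-trans (+-monoʳ-≤ o (v≤mv m v pm)) (≤-trans (m≤m+n _ v′) le))) (AO-high o F v m v′ m′ rs i le))
      (λ i lt → bd (suc i) (s≤s lt)))
  where
  first : amt (AO o F ((v , m) ∷ (v′ , m′) ∷ rs)) (o + m * v) ≡ F 0 0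
  first = trans (cong (amt (AO o F ((v , m) ∷ (v′ , m′) ∷ rs))) (trans (cong (o +_) (sym (+-identityʳ (m * v)))) (sym (+-identityʳ _))))
    (AO-amt c o F v m ((v′ , m′) ∷ rs) 0 0 sd (s≤s z≤n) (m<n⇒0<n∸m (hd< v′ rs pv′ sdr)))

expand-positive : ∀ c rs → SD c rs → Positive (expand rs)
expand-positive c [] _ = []
expand-positive c ((v , m) ∷ rs) (_ , pv , _ , sd) = All.++⁺ (All.replicate⁺ m pv) (expand-positive v rs sd)

Aof-amt : ∀ n v m rs c f p (sd : SD c ((v , m) ∷ rs)) → sum (expand ((v , m) ∷ rs)) ≡ n → Aof n (expand ((v , m) ∷ rs)) f ≡ just p →
  InD n p × ∀ i → nth (xs p) i + amt (AO 0 (λ i r → f (suc i) (suc r)) ((v , m) ∷ rs)) i ≡ nth (toX 0 (zeroBlocks (expand ((v , m) ∷ rs)))) i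
Aof-amt n v m rs c f p sd s eq with runA-inv n (RunList.opsA c v m rs sd f) (pathOf (expand ((v , m) ∷ rs))) p
    (pathOf-dyck {n} {expand ((v , m) ∷ rs)} s) (trans (sym (RunList.Aof-ops c v m rs sd n f)) eq)
... | d , h = d , λ i → trans (h i) (cong (λ q → nth q i) (xsGo-pathOf 0 (expand ((v , m) ∷ rs))))

-- Recovers λ from the path, the first half of the well-definedness of Φ; `Aof-determines` is the
-- second half.
Aof-bounceComp : ∀ n v m rs c f p (sd : SD c ((v , m) ∷ rs)) → sum (expand ((v , m) ∷ rs)) ≡ n →
  (∀ i → i < length rs → f (suc i) 1 < nth (vals ((v , m) ∷ rs)) i) →
  Aof n (expand ((v , m) ∷ rs)) f ≡ just p → bounceComp n p ≡ expand ((v , m) ∷ rs)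
Aof-bounceComp n v m rs c f p sd s bd eq with Aof-amt n v m rs c f p sd s eq
... | d , h with xs-valid {n} {p} d
...   | mkVX vx len = bounceComp-BP {n} {p} d (BP-perturbed n (xs p) _ [] 0 (expand ((v , m) ∷ rs)) vx len h refl []
        (expand-positive c _ sd) s (small-AO c 0 (λ i r → f (suc i) (suc r)) _ v m rs sd (λ i _ → refl) bd))

Aof-determines : ∀ n v m rs c f f′ p (sd : SD c ((v , m) ∷ rs)) → sum (expand ((v , m) ∷ rs)) ≡ n →
  Aof n (expand ((v , m) ∷ rs)) f ≡ just p → Aof n (expand ((v , m) ∷ rs)) f′ ≡ just p →
  ∀ i r → i < length (gaps rs) → r < nth (gaps rs) i → f (suc i) (suc r) ≡ f′ (suc i) (suc r)
Aof-determines n v m rs c f f′ p sd s eq eq′ i r lt lt′ =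
  trans (sym (AO-amt c 0 _ v m rs i r sd lt lt′)) (trans (+-cancelˡ-≡ (nth (xs p) j) _ _
    (trans (proj₂ (Aof-amt n v m rs c f p sd s eq) j) (sym (proj₂ (Aof-amt n v m rs c f′ p sd s eq′) j))))
    (AO-amt c 0 _ v m rs i r sd lt lt′))
  where
  j : ℕ
  j = 0 + offs ((v , m) ∷ rs) (suc i) + r

-- Realising a given path by operators A

-- OR j ops X X₀: the rows from j + 1 on have abscissae X₀, and ops lowers them to X.
data OR : ℕ → List (ℕ × ℕ) → List ℕ → List ℕ → Set where
  nil : ∀ {j} → OR j [] [] []
  skip : ∀ {j ops x X X₀} → OR (suc j) ops X X₀ → OR j ops (x ∷ X) (x ∷ X₀)
  lower : ∀ {j ops x k X X₀} → OR (suc j) ops X X₀ → OR j ((suc j , k) ∷ ops) (x ∷ X) (k + x ∷ X₀)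

-- The constraints on one entry form an interval, so a power of an operator passes through valid
-- lists only if both ends are valid.
VX-between : ∀ c j L x y z M → VX c j (L ++ x ∷ M) → VX c j (L ++ z ∷ M) → x ≤ y → y ≤ z → VX c j (L ++ y ∷ M)
VX-between c j [] x y z M (h₁ , _ , _) (_ , h₂ , v) xy yz = ≤-trans h₁ xy , ≤-trans yz h₂ , VX-weaken M yz v
VX-between c j (l ∷ L) x y z M (h₁ , h₂ , v) (_ , _ , v′) xy yz = h₁ , h₂ , VX-between l (suc j) L x y z M v v′ xy yz

-- Rows are lowered in order: the left part is already final, the right part still initial, and
-- lowering `z` to `x` only relaxes the constraint towards the right.
VX-splice : ∀ c j L x z M M′ → VX c j (L ++ x ∷ M′) → VX c j (L ++ z ∷ M) → x ≤ z → VX c j (L ++ x ∷ M)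
VX-splice c j [] x z M M′ (h₁ , _ , _) (_ , h₂ , v) xz = h₁ , ≤-trans xz h₂ , VX-weaken M xz v
VX-splice c j (l ∷ L) x z M M′ (h₁ , h₂ , v) (_ , _ , v′) xz = h₁ , h₂ , VX-splice l (suc j) L x z M M′ v v′ xz

setAt-at : ∀ g L x y M → g x ≡ just y → setAt (L ++ x ∷ M) (suc (length L)) g ≡ just (L ++ y ∷ M)
setAt-at g [] x y M eq rewrite eq = refl
setAt-at g (l ∷ L) x y M eq rewrite setAt-at g L x y M eq = refl

length-replace : ∀ (L : List ℕ) x y M → length (L ++ x ∷ M) ≡ length (L ++ y ∷ M)
length-replace [] x y M = refl
length-replace (l ∷ L) x y M = cong suc (length-replace L x y M)

pow-A : ∀ n k L x M → ValidX n (L ++ k + x ∷ M) → ValidX n (L ++ x ∷ M) →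
  pow k (A n (suc (length L))) (just (pathX n (L ++ k + x ∷ M))) ≡ just (pathX n (L ++ x ∷ M))
pow-A n zero L x M v v′ = refl
pow-A n (suc k) L x M v@(mkVX h e) v′@(mkVX h′ e′) = trans
  (cong (pow k (A n (suc (length L)))) (modX-just {n} {suc (length L)} {decM} {pathX n (L ++ suc k + x ∷ M)} mid (trans (cong (λ q → setAt q (suc (length L)) decM) (xs-pathX v)) (setAt-at decM L (suc k + x) (k + x) M refl))))
  (pow-A n k L x M mid v′)
  where
  mid : ValidX n (L ++ k + x ∷ M)
  mid = mkVX (VX-between 0 0 L x (k + x) (suc k + x) M h′ h (m≤n+m x k) (n≤1+n _)) (trans (length-replace L (k + x) x M) e′)

runA-OR : ∀ n L {ops X X₀} → OR (length L) ops X X₀ → ValidX n (L ++ X) → ValidX n (L ++ X₀) →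
  runA n ops (just (pathX n (L ++ X₀))) ≡ just (pathX n (L ++ X))
runA-OR n L nil v v′ = refl
runA-OR n L {ops} (skip {x = x} {X} {X₀} o) v v′ rewrite sym (++-assoc L (x ∷ []) X) | sym (++-assoc L (x ∷ []) X₀) =
  runA-OR n (L ∷ʳ x) (subst (λ q → OR q ops X X₀) (sym (trans (length-++ L) (+-comm _ 1))) o) v v′
runA-OR n L (lower {ops = ops} {x} {k} {X} {X₀} o) v@(mkVX h e) v′@(mkVX h′ e′) = trans
  (cong (runA n ops) (pow-A n k L x X₀ v′ mid))
  (subst₂ (λ q r → runA n ops (just (pathX n q)) ≡ just (pathX n r)) (++-assoc L (x ∷ []) X₀) (++-assoc L (x ∷ []) X)
    (runA-OR n (L ∷ʳ x) (subst (λ q → OR q ops X X₀) (sym (trans (length-++ L) (+-comm _ 1))) o)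
      (subst (ValidX n) (sym (++-assoc L (x ∷ []) X)) v) (subst (ValidX n) (sym (++-assoc L (x ∷ []) X₀)) mid)))
  where
  mid : ValidX n (L ++ x ∷ X₀)
  mid = mkVX (VX-splice 0 0 L x (k + x) X₀ X h h′ (m≤n+m x k)) (trans (length-replace L x (k + x) X₀) e′)

OR-index : ∀ {j j′ ops X X₀} → j ≡ j′ → OR j ops X X₀ → OR j′ ops X X₀
OR-index refl o = o

OR-skips : ∀ c x j ops X X₀ → OR (j + c) ops X X₀ → OR j ops (replicate c x ++ X) (replicate c x ++ X₀)
OR-skips zero x j ops X X₀ o = subst (λ q → OR q ops X X₀) (+-identityʳ j) o
OR-skips (suc c) x j ops X X₀ o = skip (OR-skips c x (suc j) ops X X₀ (subst (λ q → OR q ops X X₀) (+-suc j c) o))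

OR-group : ∀ b j gs ops X X₀ → All (_≤ b) gs → OR (j + length gs) ops X X₀ →
  OR j (applyUpTo (λ r → suc r + j , nth gs r) (length gs) ++ ops) (map (b ∸_) gs ++ X) (replicate (length gs) b ++ X₀)
OR-group b j [] ops X X₀ _ o = subst (λ q → OR q ops X X₀) (+-identityʳ j) o
OR-group b j (g ∷ gs) ops X X₀ (h ∷ al) o =
  subst₂ (λ q y → OR j ((suc j , g) ∷ q ++ ops) (b ∸ g ∷ map (b ∸_) gs ++ X) (y ∷ replicate (length gs) b ++ X₀))
    (applyUpTo-cong (length gs) (λ k _ → cong (_, nth gs k) (+-suc (suc k) j))) (m+[n∸m]≡n h)
    (lower (OR-group b (suc j) gs ops X X₀ al (subst (λ q → OR q ops X X₀) (+-suc j (length gs)) o)))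

pAt : List Level → ℕ → List ℕ
pAt [] _ = []
pAt ((p , _) ∷ D) zero = p
pAt (_ ∷ D) (suc i) = pAt D i

-- `nth` returns 0 beyond the end, which supplies the zero exponents of each level.
fOf : List Level → ℕ → ℕ → ℕ
fOf D i r = nth (pAt D (i ∸ 1)) (r ∸ 1)

runsD : List Level → Runs
runsD D = map (_, 1) (lam D)

expand-runsD : ∀ D → expand (runsD D) ≡ lam D
expand-runsD D = go (lam D)
  where
  go : ∀ l → expand (map (_, 1) l) ≡ l
  go [] = refl
  go (x ∷ l) = cong (x ∷_) (go l)

hd-runsD : ∀ D → hd (runsD D) ≡ tot D
hd-runsD [] = refl
hd-runsD (_ ∷ D) = refl

size-tot : ∀ (p : List ℕ) k D → length p + (k + tot D) ≡ length p + k + tot D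
size-tot p k D = sym (+-assoc (length p) k (tot D))

gap-runsD : ∀ (p : List ℕ) k D → tot ((p , k) ∷ D) ∸ hd (runsD D) ≡ length p + k
gap-runsD p k D = trans (cong₂ _∸_ (size-tot p k D) (hd-runsD D)) (m+n∸n≡m (length p + k) (tot D))

SD-runsD : ∀ z c D → Adm z D → tot D < c → SD c (runsD D)
SD-runsD z c [] _ _ = tt
SD-runsD z c ((p , k) ∷ D) (_ , _ , _ , s , a) h = h , ≤-trans s (subst (length p + k ≤_) (sym (size-tot p k D)) (m≤m+n _ _)) , s≤s z≤n ,
  SD-runsD k _ D a (subst (tot D <_) (sym (size-tot p k D)) (m<n+m (tot D) s))

nth-zeros : ∀ k r → nth (replicate k 0) r ≡ 0
nth-zeros zero r = refl
nth-zeros (suc k) zero = refl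
nth-zeros (suc k) (suc r) = nth-zeros k r

nth-pad : ∀ p k r → nth (p ++ replicate k 0) r ≡ nth p r
nth-pad [] k r = nth-zeros k r
nth-pad (x ∷ p) k zero = refl
nth-pad (x ∷ p) k (suc r) = nth-pad p k r

-- The operators reach only the first `length p + k` rows of a block, its gap to the next part; the
-- remaining `tot D′` rows carry amount 0 and are skipped.
OR-levels : ∀ z o v D → Adm z D → z ≤ v →
  OR (o + 1 * v) (AO o (λ i r → nth (pAt D i) r) ((v , 1) ∷ runsD D)) (toX (o + 1 * v) (blks D)) (toX (o + 1 * v) (zeroBlocks (lam D)))
OR-levels z o v [] a h = nil
OR-levels z o v D@((p , k) ∷ D′) (_ , d , _ , _ , a) h =
  subst₂ (λ q r → OR b q r (toX b (zeroBlocks (lam D)))) (sym ops≡) (sym X≡) (subst (OR b _ _) (sym X₀≡)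
    (OR-group b b gs _ _ _ gs≤b
      (OR-skips (tot D′) b (b + length gs) _ _ _ (OR-index idx (OR-levels k b u D′ a (≤-trans (m≤m+n k (tot D′)) (m≤n+m _ (length p))))))))
  where
  b u : ℕ
  b = o + 1 * v
  u = tot D
  gs : List ℕ
  gs = p ++ replicate k 0
  lenG : length gs ≡ length p + k
  lenG = trans (length-++ p) (cong (length p +_) (length-replicate k))
  gs≤b : All (_≤ b) gs
  gs≤b = All.++⁺ (All.map (λ q → ≤-trans (<⇒≤ q) (≤-trans h (≤-trans (≤-reflexive (sym (+-identityʳ v))) (m≤n+m _ o)))) (Desc-All p d)) (All.replicate⁺ k z≤n)
  idx : b + 1 * u ≡ b + length gs + tot D′
  idx = trans (cong (b +_) (trans (+-identityʳ u) (trans (size-tot p k D′) (cong (_+ tot D′) (sym lenG))))) (sym (+-assoc b (length gs) (tot D′)))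
  ops≡ : AO o (λ i r → nth (pAt D i) r) ((v , 1) ∷ runsD D) ≡
    applyUpTo (λ r → suc r + b , nth gs r) (length gs) ++ AO b (λ i r → nth (pAt D′ i) r) ((u , 1) ∷ runsD D′)
  ops≡ = trans (AO-step o (λ i r → nth (pAt D i) r) v 1 u 1 (runsD D′)) (cong (_++ AO b _ ((u , 1) ∷ runsD D′))
    (trans (cong (applyUpTo _) (trans (gap-runsD p k D′) (sym lenG))) (applyUpTo-cong (length gs) (λ r _ → cong (suc r + b ,_) (sym (nth-pad p k r))))))
  zs : ∀ j → map (b ∸_) (replicate j 0) ≡ replicate j b
  zs j = map-replicate (b ∸_) j 0
  X≡ : toX b (blks D) ≡ map (b ∸_) gs ++ replicate (tot D′) b ++ toX (b + 1 * u) (blks D′)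
  X≡ = trans (cong₂ _++_ (trans (cong (map (b ∸_)) (trans (cong (p ++_) (replicate-+ k (tot D′) 0)) (sym (++-assoc p _ _))))
      (trans (map-++ (b ∸_) gs (replicate (tot D′) 0)) (cong (map (b ∸_) gs ++_) (zs (tot D′)))))
    (cong (λ q → toX (b + q) (blks D′)) (trans (length-++ p) (trans (cong (length p +_) (length-replicate (k + tot D′))) (sym (+-identityʳ u))))))
    (++-assoc (map (b ∸_) gs) _ _)
  X₀≡ : toX b (zeroBlocks (lam D)) ≡ replicate (length gs) b ++ replicate (tot D′) b ++ toX (b + 1 * u) (zeroBlocks (lam D′))
  X₀≡ = trans (cong₂ _++_ (trans (zs u) (trans (cong (λ q → replicate q b) (trans (size-tot p k D′) (cong (_+ tot D′) (sym lenG)))) (replicate-+ (length gs) (tot D′) b)))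
    (cong (λ q → toX (b + q) (zeroBlocks (lam D′))) (trans (length-replicate u) (sym (+-identityʳ u)))))
    (++-assoc (replicate (length gs) b) _ _)

-- Paths and their lists of east-step ordinates

pathH : ℕ → List ℕ → Path
pathH n l = fromHGo n 0 l

VH : ℕ → ℕ → ℕ → List ℕ → Set
VH n c j [] = ⊤
VH n c j (h ∷ l) = c ≤ h × suc j ≤ h × h ≤ n × VH n h (suc j) l

VH-weaken : ∀ {n c c′ j} l → c ≤ c′ → VH n c′ j l → VH n c j l
VH-weaken [] _ _ = tt
VH-weaken (x ∷ l) h (h₁ , r) = ≤-trans h h₁ , r

hsGo-valid : ∀ n a b p → T (dyckGo n a b p) → VH n a b (hsGo a p)
hsGo-valid n a b [] t = tt
hsGo-valid n a b (N ∷ p) t = VH-weaken _ (n≤1+n a) (hsGo-valid n (suc a) b p t)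
hsGo-valid n a b (E ∷ p) t with T-∧⁻ {suc b ≤ᵇ a} t
... | t₁ , t₂ = ≤-refl , ≤ᵇ⇒≤ (suc b) a t₁ , proj₂ (dyckGo-end n a (suc b) p t₂) , hsGo-valid n a (suc b) p t₂

hsGo-length : ∀ n a b p → T (dyckGo n a b p) → b + length (hsGo a p) ≡ n
hsGo-length n a b [] t = trans (+-identityʳ b) (≡ᵇ⇒≡ b n (proj₂ (T-∧⁻ {a ≡ᵇ n} t)))
hsGo-length n a b (N ∷ p) t = hsGo-length n (suc a) b p t
hsGo-length n a b (E ∷ p) t = trans (+-suc b _) (hsGo-length n a (suc b) p (proj₂ (T-∧⁻ {suc b ≤ᵇ a} t)))

fromHGo-N : ∀ n a j l → suc a ≤ n → VH n (suc a) j l → fromHGo n a l ≡ N ∷ fromHGo n (suc a) l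
fromHGo-N n a j [] h v with m≤n⇒∃[o]m+o≡n h
... | k , refl = cong (λ q → replicate q N) (trans (cong (_∸ a) (sym (+-suc a k))) (trans (m+n∸m≡n a (suc k)) (cong suc (sym (m+n∸m≡n a k)))))
fromHGo-N n a j (x ∷ l) h (a<x , _) with m≤n⇒∃[o]m+o≡n a<x
... | k , refl = trans (cong₂ (λ u v → replicate u N ++ E ∷ fromHGo n v l)
        (trans (cong (_∸ a) (sym (+-suc a k))) (m+n∸m≡n a (suc k)))
        (trans (m≤n⇒m⊔n≡n (≤-trans (n≤1+n a) a<x)) (sym (m≤n⇒m⊔n≡n a<x))))
      (cong (λ u → N ∷ replicate u N ++ E ∷ fromHGo n (suc a ⊔ (suc a + k)) l) (sym (m+n∸m≡n a k)))

fromHGo-hsGo : ∀ n a b p → T (dyckGo n a b p) → fromHGo n a (hsGo a p) ≡ p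
fromHGo-hsGo n a b [] t rewrite ≡ᵇ⇒≡ a n (proj₁ (T-∧⁻ {a ≡ᵇ n} t)) | n∸n≡0 n = refl
fromHGo-hsGo n a b (N ∷ p) t = trans (fromHGo-N n a b (hsGo (suc a) p) (proj₂ (dyckGo-end n (suc a) b p t)) (hsGo-valid n (suc a) b p t))
  (cong (N ∷_) (fromHGo-hsGo n (suc a) b p t))
fromHGo-hsGo n a b (E ∷ p) t rewrite n∸n≡0 a | ⊔-idem a = cong (E ∷_) (fromHGo-hsGo n a (suc b) p (proj₂ (T-∧⁻ {suc b ≤ᵇ a} t)))

hsGo-Ns : ∀ a k s → hsGo a (replicate k N ++ s) ≡ hsGo (a + k) s
hsGo-Ns a zero s = cong (λ q → hsGo q s) (sym (+-identityʳ a))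
hsGo-Ns a (suc k) s = trans (hsGo-Ns (suc a) k s) (cong (λ q → hsGo q s) (sym (+-suc a k)))

hsGo-Es : ∀ a k s → hsGo a (replicate k E ++ s) ≡ replicate k a ++ hsGo a s
hsGo-Es a zero s = refl
hsGo-Es a (suc k) s = cong (a ∷_) (hsGo-Es a k s)

fromHGo-dyck : ∀ n c j l → c ≤ n → VH n c j l → j + length l ≡ n → T (dyckGo n c j (fromHGo n c l))
fromHGo-dyck n c j [] h v eq rewrite trans (sym (+-identityʳ j)) eq =
  subst (λ q → T (dyckGo n c n q)) (++-identityʳ (replicate (n ∸ c) N))
    (dyckGo-Ns n c n (n ∸ c) [] (subst (λ q → T (dyckGo n q n [])) (sym (m∸n+n≡m h)) (T-∧⁺ (≡⇒≡ᵇ n n refl) (≡⇒≡ᵇ n n refl))))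
fromHGo-dyck n c j (x ∷ l) h (c≤x , j<x , x≤n , v) eq =
  dyckGo-Ns n c j (x ∸ c) _ (subst₂ (λ q r → T (dyckGo n q j (E ∷ fromHGo n r l))) (sym (m∸n+n≡m c≤x)) (sym (m≤n⇒m⊔n≡n c≤x))
    (T-∧⁺ (≤⇒≤ᵇ j<x) (fromHGo-dyck n x (suc j) l x≤n v (trans (sym (+-suc j (length l))) eq))))

hsGo-fromHGo : ∀ n c j l → VH n c j l → hsGo c (fromHGo n c l) ≡ l
hsGo-fromHGo n c j [] v = trans (cong (hsGo c) (sym (++-identityʳ (replicate (n ∸ c) N)))) (hsGo-Ns c (n ∸ c) [])
hsGo-fromHGo n c j (x ∷ l) (c≤x , _ , _ , v) = trans (hsGo-Ns c (x ∸ c) _)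
  (trans (cong₂ (λ q r → hsGo q (E ∷ fromHGo n r l)) (m+[n∸m]≡n c≤x) (m≤n⇒m⊔n≡n c≤x))
    (cong (x ∷_) (hsGo-fromHGo n x (suc j) l v)))

record ValidH (n : ℕ) (l : List ℕ) : Set where
  constructor mkVH
  field
    valid : VH n 0 0 l
    len : length l ≡ n

hs-valid : ∀ {n p} → InD n p → ValidH n (hs p)
hs-valid {n} {p} d = mkVH (hsGo-valid n 0 0 p d) (hsGo-length n 0 0 p d)

pathH-hs : ∀ {n p} → InD n p → pathH n (hs p) ≡ p
pathH-hs {n} {p} d = fromHGo-hsGo n 0 0 p d

hs-pathH : ∀ {n l} → ValidH n l → hs (pathH n l) ≡ l
hs-pathH {n} {l} (mkVH v _) = hsGo-fromHGo n 0 0 l v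

pathH-dyck : ∀ {n l} → ValidH n l → InD n (pathH n l)
pathH-dyck {n} {l} (mkVH v e) = fromHGo-dyck n 0 0 l z≤n v e

modH-just : ∀ {n i g p l} → ValidH n l → setAt (hs p) i g ≡ just l → modH n i g (just p) ≡ just (pathH n l)
modH-just {n} {i} {g} {p} {l} v eq with setAt (hs p) i g | eq
... | just .l | refl
  rewrite T⇒≡ (T-∧⁺ (subst (λ q → T (eqL q l)) (sym (hs-pathH v)) (eqL-refl l)) (pathH-dyck v)) = refl

VH-between : ∀ n c j L x y z M → VH n c j (L ++ x ∷ M) → VH n c j (L ++ z ∷ M) → x ≤ y → y ≤ z → VH n c j (L ++ y ∷ M)
VH-between n c j [] x y z M (h₁ , h₂ , _) (_ , _ , h₃ , v) xy yz = ≤-trans h₁ xy , ≤-trans h₂ xy , ≤-trans yz h₃ , VH-weaken M yz v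
VH-between n c j (l ∷ L) x y z M (h₁ , h₂ , h₃ , v) (_ , _ , _ , v′) xy yz = h₁ , h₂ , h₃ , VH-between n l (suc j) L x y z M v v′ xy yz

pow-Ainv : ∀ n k L x M → ValidX n (L ++ x ∷ M) → ValidX n (L ++ k + x ∷ M) →
  pow k (Ainv n (suc (length L))) (just (pathX n (L ++ x ∷ M))) ≡ just (pathX n (L ++ k + x ∷ M))
pow-Ainv n zero L x M v v′ = refl
pow-Ainv n (suc k) L x M v@(mkVX h e) v′@(mkVX h′ e′) = trans
  (cong (pow k (Ainv n (suc (length L)))) (modX-just {n} {suc (length L)} {incM} {pathX n (L ++ x ∷ M)} mid
    (trans (cong (λ q → setAt q (suc (length L)) incM) (xs-pathX v)) (setAt-at incM L x (suc x) M refl))))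
  (subst (λ q → pow k (Ainv n (suc (length L))) (just (pathX n (L ++ suc x ∷ M))) ≡ just (pathX n (L ++ q ∷ M))) (+-suc k x)
    (pow-Ainv n k L (suc x) M mid (subst (λ q → ValidX n (L ++ q ∷ M)) (sym (+-suc k x)) v′)))
  where
  mid : ValidX n (L ++ suc x ∷ M)
  mid = mkVX (VX-between 0 0 L x (suc x) (suc k + x) M h h′ (n≤1+n x) (s≤s (m≤n+m x k))) (trans (length-replace L (suc x) x M) e)

pow-C : ∀ n k L x M → ValidH n (L ++ x ∷ M) → ValidH n (L ++ k + x ∷ M) →
  pow k (C n (suc (length L))) (just (pathH n (L ++ x ∷ M))) ≡ just (pathH n (L ++ k + x ∷ M))
pow-C n zero L x M v v′ = refl
pow-C n (suc k) L x M v@(mkVH h e) v′@(mkVH h′ e′) = trans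
  (cong (pow k (C n (suc (length L)))) (modH-just {n} {suc (length L)} {incM} {pathH n (L ++ x ∷ M)} mid
    (trans (cong (λ q → setAt q (suc (length L)) incM) (hs-pathH v)) (setAt-at incM L x (suc x) M refl))))
  (subst (λ q → pow k (C n (suc (length L))) (just (pathH n (L ++ suc x ∷ M))) ≡ just (pathH n (L ++ q ∷ M))) (+-suc k x)
    (pow-C n k L (suc x) M mid (subst (λ q → ValidH n (L ++ q ∷ M)) (sym (+-suc k x)) v′)))
  where
  mid : ValidH n (L ++ suc x ∷ M)
  mid = mkVH (VH-between n 0 0 L x (suc x) (suc k + x) M h h′ (n≤1+n x) (s≤s (m≤n+m x k))) (trans (length-replace L (suc x) x M) e)

-- Coordinates of composition paths

zX : ℕ → List ℕ → List ℕ
zX b [] = []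
zX b (a ∷ α) = replicate a b ++ zX (b + a) α

toH : ℕ → List ℕ → List ℕ
toH b [] = []
toH b (a ∷ α) = replicate a (b + a) ++ toH (b + a) α

xsGo-zX : ∀ b α → xsGo b (pathOf α) ≡ zX b α
xsGo-zX b [] = refl
xsGo-zX b (a ∷ α) = trans (cong (xsGo b) (++-assoc (replicate a N) (replicate a E) (pathOf α)))
  (trans (xsGo-Ns b a _) (cong (replicate a b ++_) (trans (xsGo-Es b a (pathOf α)) (xsGo-zX (b + a) α))))

hsGo-toH : ∀ b α → hsGo b (pathOf α) ≡ toH b α
hsGo-toH b [] = refl
hsGo-toH b (a ∷ α) = trans (cong (hsGo b) (++-assoc (replicate a N) (replicate a E) (pathOf α)))
  (trans (hsGo-Ns b a _) (trans (hsGo-Es (b + a) a _) (cong (replicate a (b + a) ++_) (hsGo-toH (b + a) α))))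

zX-++ : ∀ b α β → zX b (α ++ β) ≡ zX b α ++ zX (b + sum α) β
zX-++ b [] β = cong (λ q → zX q β) (sym (+-identityʳ b))
zX-++ b (a ∷ α) β = trans (cong (replicate a b ++_) (trans (zX-++ (b + a) α β) (cong (λ q → zX (b + a) α ++ zX q β) (+-assoc b a (sum α)))))
  (sym (++-assoc (replicate a b) _ _))

toH-++ : ∀ b α β → toH b (α ++ β) ≡ toH b α ++ toH (b + sum α) β
toH-++ b [] β = cong (λ q → toH q β) (sym (+-identityʳ b))
toH-++ b (a ∷ α) β = trans (cong (replicate a (b + a) ++_) (trans (toH-++ (b + a) α β) (cong (λ q → toH (b + a) α ++ toH q β) (+-assoc b a (sum α)))))
  (sym (++-assoc (replicate a (b + a)) _ _))

zX-length : ∀ b α → length (zX b α) ≡ sum α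
zX-length b [] = refl
zX-length b (a ∷ α) = trans (length-++ (replicate a b)) (cong₂ _+_ (length-replicate a) (zX-length (b + a) α))

toH-length : ∀ b α → length (toH b α) ≡ sum α
toH-length b [] = refl
toH-length b (a ∷ α) = trans (length-++ (replicate a (b + a))) (cong₂ _+_ (length-replicate a) (toH-length (b + a) α))

zX-< : ∀ b α → Positive α → All (_< b + sum α) (zX b α)
zX-< b [] _ = []
zX-< b (a ∷ α) (pa ∷ p) = All.++⁺ (All.replicate⁺ a (m<m+n b (≤-trans pa (m≤m+n a (sum α)))))
  (subst (λ q → All (_< q) (zX (b + a) α)) (+-assoc b a (sum α)) (zX-< (b + a) α p))

zX-≥ : ∀ b α → All (b ≤_) (zX b α)
zX-≥ b [] = []
zX-≥ b (a ∷ α) = All.++⁺ (All.replicate⁺ a ≤-refl) (All.map (≤-trans (m≤m+n b a)) (zX-≥ (b + a) α))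

-- The rows with abscissa below `sum P` are exactly those of `P`. The case 0 is the convention h_0 =
-- 0.
hAt-boundary : ∀ n P Q → Positive P → sum (P ++ Q) ≡ n → hAt (pathOf (P ++ Q)) (sum P) ≡ sum P
hAt-boundary n P Q p eq with sum P in s
... | zero = refl
... | suc b = trans (hAt-cntLe {n} {pathOf (P ++ Q)} b (pathOf-dyck {n} {P ++ Q} eq) b<n)
  (trans (cong (cntLe b) (trans (xsGo-zX 0 (P ++ Q)) (zX-++ 0 P Q)))
  (trans (cntLe-all b (zX 0 P) _ (All.map s≤s⁻¹ (subst (λ q → All (_< q) (zX 0 P)) s (zX-< 0 P p))))
  (trans (cong₂ _+_ (trans (zX-length 0 P) s) (cntLe-none b _ (subst (λ q → All (b <_) (zX q Q)) (sym s) (zX-≥ (suc b) Q)))) (+-identityʳ _))))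
  where
  b<n : b < n
  b<n = subst (suc b ≤_) (trans (sym (cong (_+ sum Q) s)) (trans (sym (sum-++ P Q)) eq)) (m≤m+n (suc b) (sum Q))

psums-nth : ∀ b P Q → nth (b ∷ psums b (P ++ Q)) (length P) ≡ b + sum P
psums-nth b [] Q = sym (+-identityʳ b)
psums-nth b (a ∷ P) Q = trans (psums-nth (b + a) P Q) (+-assoc b a (sum P))

psums-nth₁ : ∀ b P x Q → nth (b ∷ psums b (P ++ x ∷ Q)) (suc (length P)) ≡ b + sum P + x
psums-nth₁ b [] x Q = cong (_+ x) (sym (+-identityʳ b))
psums-nth₁ b (a ∷ P) x Q = trans (psums-nth₁ (b + a) P x Q) (cong (_+ x) (+-assoc b a (sum P)))

psums-nth₂ : ∀ b P x y Q → nth (b ∷ psums b (P ++ x ∷ y ∷ Q)) (suc (suc (length P))) ≡ b + sum P + x + y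
psums-nth₂ b [] x y Q = cong (λ q → q + x + y) (sym (+-identityʳ b))
psums-nth₂ b (a ∷ P) x y Q = trans (psums-nth₂ (b + a) P x y Q) (cong (λ q → q + x + y) (+-assoc b a (sum P)))

psums-length : ∀ b α → length (psums b α) ≡ length α
psums-length b [] = refl
psums-length b (a ∷ α) = cong suc (psums-length (b + a) α)

-- The operator S exchanges adjacent parts v + 1 and v

private
  choose : ℕ → Path → Bool → Bool → ℕ → ℕ → Maybe Path
  choose n p c h s b = if c then (if h then nothing else (pow s (Ainv n b) ⨾ pow s (C n b)) (just p)) else nothing

  S-choose : ∀ n i p bs → bouncePts n p ≡ bs → S n i (just p) ≡
    choose n p ((1 ≤ᵇ i) ∧ (suc (suc i) ≤ᵇ length bs)) (hAt p (nth bs (i ∸ 1)) ≡ᵇ nth bs i) (nth bs (suc i) ∸ hAt p (nth bs i)) (nth bs i)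
  S-choose n i p .(bouncePts n p) refl = refl

module _ (n v : ℕ) (P Q : List ℕ) (pv : 0 < v) (pP : Positive P) (pQ : Positive Q) (eq : sum (P ++ suc v ∷ v ∷ Q) ≡ n) where
  private
    α β γ : List ℕ
    α = P ++ suc v ∷ v ∷ Q
    β = P ++ v ∷ 1 ∷ v ∷ Q
    γ = P ++ v ∷ suc v ∷ Q
    b : ℕ
    b = sum P
    dα : InD n (pathOf α)
    dα = pathOf-dyck {n} {α} eq
    pα : Positive α
    pα = All.++⁺ pP (s≤s z≤n ∷ pv ∷ pQ)
    sβ : sum β ≡ n
    sβ = trans (sum-++ P _) (trans (cong (sum P +_) (+-suc v (v + sum Q))) (trans (sym (sum-++ P _)) eq))
    sγ : sum γ ≡ n
    sγ = trans (sum-++ P _) (trans (cong (sum P +_) (+-suc v (v + sum Q))) (trans (sym (sum-++ P _)) eq))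
    dβ : InD n (pathOf β)
    dβ = pathOf-dyck {n} {β} sβ
    dγ : InD n (pathOf γ)
    dγ = pathOf-dyck {n} {γ} sγ

    L H MX MH : List ℕ
    L = zX 0 P ++ replicate v b
    MX = replicate v (b + suc v) ++ zX (b + suc v + v) Q
    H = toH 0 P ++ replicate v (b + v)
    MH = replicate v (b + suc v + v) ++ toH (b + suc v + v) Q

    lenL : suc (length L) ≡ b + suc v
    lenL = trans (cong suc (trans (length-++ (zX 0 P)) (cong₂ _+_ (zX-length 0 P) (length-replicate v)))) (sym (+-suc b v))
    lenH : suc (length H) ≡ b + suc v
    lenH = trans (cong suc (trans (length-++ (toH 0 P)) (cong₂ _+_ (toH-length 0 P) (length-replicate v)))) (sym (+-suc b v))

    b+v+1 : b + v + 1 ≡ b + suc v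
    b+v+1 = trans (+-assoc b v 1) (cong (b +_) (+-comm v 1))

    xα : xs (pathOf α) ≡ L ++ b ∷ MX
    xα = trans (xsGo-zX 0 α) (trans (zX-++ 0 P _) (trans (cong (zX 0 P ++_) (replicate-snoc v b MX)) (sym (++-assoc (zX 0 P) (replicate v b) (b ∷ MX)))))
    xβ : xs (pathOf β) ≡ L ++ v + b ∷ MX
    xβ = trans (xsGo-zX 0 β) (trans (zX-++ 0 P _) (trans (cong (zX 0 P ++_)
      (cong₂ (λ q r → replicate v b ++ q ∷ replicate v r ++ zX (r + v) Q) (+-comm b v) b+v+1))
      (sym (++-assoc (zX 0 P) (replicate v b) _))))
    hβ : hs (pathOf β) ≡ H ++ b + suc v ∷ MH
    hβ = trans (hsGo-toH 0 β) (trans (toH-++ 0 P _) (trans (cong (toH 0 P ++_)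
      (cong (λ r → replicate v (b + v) ++ r ∷ replicate v (r + v) ++ toH (r + v) Q) b+v+1))
      (sym (++-assoc (toH 0 P) (replicate v (b + v)) _))))
    hγ : hs (pathOf γ) ≡ H ++ v + (b + suc v) ∷ MH
    hγ = trans (hsGo-toH 0 γ) (trans (toH-++ 0 P _) (trans (cong (toH 0 P ++_) (cong₂ (λ q r → replicate v (b + v) ++ q ∷ replicate v r ++ toH r Q) (c₁ b v) (c₂ b v)))
      (sym (++-assoc (toH 0 P) (replicate v (b + v)) _))))
      where
      c₁ : ∀ b v → b + v + suc v ≡ v + (b + suc v)
      c₁ = solve-∀
      c₂ : ∀ b v → b + v + suc v ≡ b + suc v + v
      c₂ = solve-∀

    up : pow v (Ainv n (b + suc v)) (just (pathOf α)) ≡ just (pathOf β)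
    up = subst₂ (λ q r → pow v (Ainv n (b + suc v)) (just q) ≡ just r)
      (trans (cong (pathX n) (sym xα)) (pathX-xs {n} {pathOf α} dα)) (trans (cong (pathX n) (sym xβ)) (pathX-xs {n} {pathOf β} dβ))
      (subst (λ q → pow v (Ainv n q) (just (pathX n (L ++ b ∷ MX))) ≡ just (pathX n (L ++ v + b ∷ MX))) lenL
        (pow-Ainv n v L b MX (subst (ValidX n) xα (xs-valid {n} {pathOf α} dα)) (subst (ValidX n) xβ (xs-valid {n} {pathOf β} dβ))))

    across : pow v (C n (b + suc v)) (just (pathOf β)) ≡ just (pathOf γ)
    across = subst₂ (λ q r → pow v (C n (b + suc v)) (just q) ≡ just r)
      (trans (cong (pathH n) (sym hβ)) (pathH-hs {n} {pathOf β} dβ)) (trans (cong (pathH n) (sym hγ)) (pathH-hs {n} {pathOf γ} dγ))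
      (subst (λ q → pow v (C n q) (just (pathH n (H ++ b + suc v ∷ MH))) ≡ just (pathH n (H ++ v + (b + suc v) ∷ MH))) lenH
        (pow-C n v H (b + suc v) MH (subst (ValidH n) hβ (hs-valid {n} {pathOf β} dβ)) (subst (ValidH n) hγ (hs-valid {n} {pathOf γ} dγ))))

    bs : List ℕ
    bs = 0 ∷ psums 0 α

    bs≡ : bouncePts n (pathOf α) ≡ bs
    bs≡ = cong (0 ∷_) (bounceGo-psums {n} {pathOf α} dα (pathOf-BP pα eq))

    cond : (suc (suc (suc (length P))) ≤ᵇ length bs) ≡ true
    cond = T⇒≡ (≤⇒≤ᵇ (s≤s (subst (suc (suc (length P)) ≤_) (sym (trans (psums-length 0 α) (length-++ P)))
      (subst (suc (suc (length P)) ≤_) (trans (cong suc (sym (+-suc (length P) (length Q)))) (sym (+-suc (length P) (suc (length Q)))))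
        (s≤s (s≤s (m≤m+n (length P) (length Q))))))))

    h₀ : hAt (pathOf α) b ≡ b
    h₀ = hAt-boundary n P (suc v ∷ v ∷ Q) pP eq

    h₁ : hAt (pathOf α) (b + suc v) ≡ b + suc v
    h₁ = subst₂ (λ q r → hAt (pathOf q) r ≡ r) (++-assoc P (suc v ∷ []) (v ∷ Q)) (trans (sum-++ P (suc v ∷ [])) (cong (b +_) (+-identityʳ (suc v))))
      (hAt-boundary n (P ∷ʳ suc v) (v ∷ Q) (All.++⁺ pP (s≤s z≤n ∷ [])) (trans (cong sum (++-assoc P (suc v ∷ []) (v ∷ Q))) eq))

  -- The exponent s is `v`, and the path between the two powers is again a composition path,
  -- `pathOf β`: moving the last north step of the block `suc v` to the right splits this block into
  -- `v` and 1, and raising the east step of the block 1 merges it with the following `v`.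
  S-swap : S n (suc (length P)) (just (pathOf α)) ≡ just (pathOf γ)
  S-swap = trans (S-choose n (suc (length P)) (pathOf α) bs bs≡) (trans
    (cong₂ (λ c h → choose n (pathOf α) c h s B) cond
      (trans (cong₂ (λ x y → hAt (pathOf α) x ≡ᵇ y) (psums-nth 0 P _) n₁) (trans (cong (_≡ᵇ b + suc v) h₀) (≡ᵇ-false (λ q → m≢1+m+n b (trans q (+-suc b v)))))))
    (trans (cong₂ (λ s b → (pow s (Ainv n b) ⨾ pow s (C n b)) (just (pathOf α)))
        (trans (cong₂ _∸_ (psums-nth₂ 0 P (suc v) v Q) (trans (cong (hAt (pathOf α)) n₁) h₁)) (m+n∸m≡n (b + suc v) v)) n₁)
      (trans (cong (pow v (C n (b + suc v))) up) across)))
    where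
    B s : ℕ
    B = nth bs (suc (length P))
    s = nth bs (suc (suc (length P))) ∸ hAt (pathOf α) B
    n₁ : B ≡ b + suc v
    n₁ = psums-nth₁ 0 P (suc v) (v ∷ Q)

-- The operator B moves a part v + 1 to the right through parts v

plan-zero : ∀ n j cs t → runPlan n (plan j 0 cs) t ≡ t
plan-zero n j [] t = refl
plan-zero n j (zero ∷ cs) t = plan-zero n (suc j) cs t
plan-zero n j (suc c ∷ cs) t = refl

sum-swap : ∀ P v Q → sum (P ++ suc v ∷ v ∷ Q) ≡ sum ((P ∷ʳ v) ++ suc v ∷ Q)
sum-swap P v Q = trans (sum-++ P _) (trans (cong (sum P +_) (sym (+-suc v (v + sum Q)))) (trans (sym (sum-++ P (v ∷ suc v ∷ Q))) (cong sum (sym (++-assoc P (v ∷ []) _)))))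

-- Each exchange leaves the travelling part one place further right, where the next factor of the
-- plan acts.
runPlan-pass : ∀ n v g z P R cs → 0 < v → Positive P → Positive R → sum (P ++ suc v ∷ replicate z v ++ R) ≡ n → g ≤ z →
  runPlan n (plan (suc (length P)) g (replicate z 1 ++ cs)) (just (pathOf (P ++ suc v ∷ replicate z v ++ R)))
    ≡ just (pathOf (P ++ replicate g v ++ suc v ∷ replicate (z ∸ g) v ++ R))
runPlan-pass n v zero z P R cs pv pP pR eq h = plan-zero n (suc (length P)) (replicate z 1 ++ cs) _
runPlan-pass n v (suc g) (suc z) P R cs pv pP pR eq (s≤s h) = trans
  (cong (runPlan n (plan (suc (suc (length P))) g (replicate z 1 ++ cs)))
    (trans (S-swap n v P (replicate z v ++ R) pv pP (All.++⁺ (All.replicate⁺ z pv) pR) eq) (cong (λ q → just (pathOf q)) (sym (++-assoc P (v ∷ []) _)))))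
  (trans (cong (λ j → runPlan n (plan (suc j) g (replicate z 1 ++ cs)) (just (pathOf ((P ∷ʳ v) ++ suc v ∷ replicate z v ++ R))))
      (sym (trans (length-++ P) (+-comm (length P) 1))))
    (trans (runPlan-pass n v g z (P ∷ʳ v) R cs pv (All.++⁺ pP (pv ∷ [])) pR (trans (sym (sum-swap P v (replicate z v ++ R))) eq) h)
      (cong (λ q → just (pathOf q)) (++-assoc P (v ∷ []) _))))

private
  chooseB : ℕ → Path → Bool → ℕ → ℕ → List ℕ → Maybe Path
  chooseB n p c i k cs = if c then runPlan n (plan i k cs) (just p) else nothing

  Bop-choose : ∀ n i k p α → bounceComp n p ≡ α → Bop n i k (just p) ≡
    chooseB n p ((1 ≤ᵇ i) ∧ (suc i ≤ᵇ length α)) i k (applyUpTo (λ j → nth α (i ∸ 1) ∸ nth α (i + j)) (length α ∸ i))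
  Bop-choose n i k p .(bounceComp n p) refl = refl

applyUpTo-nth : ∀ (f : ℕ → ℕ) Y → applyUpTo (λ j → f (nth Y j)) (length Y) ≡ map f Y
applyUpTo-nth f [] = refl
applyUpTo-nth f (y ∷ Y) = cong (f y ∷_) (applyUpTo-nth f Y)

-- All costs along the run of `v` are 1, so the budget `g` buys exactly `g` exchanges and is used up
-- before the costs of `R` matter.
Bop-pass : ∀ n v g z P R → 0 < v → Positive P → Positive R → sum (P ++ suc v ∷ replicate z v ++ R) ≡ n → g ≤ z → 0 < z + length R →
  Bop n (suc (length P)) g (just (pathOf (P ++ suc v ∷ replicate z v ++ R)))
    ≡ just (pathOf (P ++ replicate g v ++ suc v ∷ replicate (z ∸ g) v ++ R))
Bop-pass n v g z P R pv pP pR eq h ne = trans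
  (Bop-choose n (suc (length P)) g (pathOf α) α (bounceComp-BP {n} {pathOf α} (pathOf-dyck {n} {α} eq) (pathOf-BP pα eq)))
  (trans (cong₂ (λ c cs → chooseB n (pathOf α) c (suc (length P)) g cs) cond costs)
    (runPlan-pass n v g z P R (map (suc v ∸_) R) pv pP pR eq h))
  where
  Y α : List ℕ
  Y = replicate z v ++ R
  α = P ++ suc v ∷ Y
  pα : Positive α
  pα = All.++⁺ pP (s≤s z≤n ∷ All.++⁺ (All.replicate⁺ z pv) pR)
  lenα : length α ≡ suc (length P) + length Y
  lenα = trans (length-++ P) (+-suc (length P) (length Y))
  lenY : length Y ≡ z + length R
  lenY = trans (length-++ (replicate z v)) (cong (_+ length R) (length-replicate z))
  cond : (suc (suc (length P)) ≤ᵇ length α) ≡ true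
  cond = T⇒≡ (≤⇒≤ᵇ (subst (suc (suc (length P)) ≤_) (sym lenα) (m<m+n (suc (length P)) (subst (0 <_) (sym lenY) ne))))
  costs : applyUpTo (λ j → nth α (length P) ∸ nth α (suc (length P) + j)) (length α ∸ suc (length P)) ≡ replicate z 1 ++ map (suc v ∸_) R
  costs = trans (cong (applyUpTo _) (trans (cong (_∸ suc (length P)) lenα) (m+n∸m≡n (suc (length P)) (length Y))))
    (trans (applyUpTo-cong (length Y) (λ j _ → cong₂ _∸_
        (trans (cong (nth α) (sym (+-identityʳ (length P)))) (nth-++ʳ P (suc v ∷ Y) 0))
        (trans (cong (nth α) (sym (+-suc (length P) j))) (nth-++ʳ P (suc v ∷ Y) (suc j)))))
    (trans (applyUpTo-nth (suc v ∸_) Y) (trans (map-++ (suc v ∸_) (replicate z v) R)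
      (cong (_++ map (suc v ∸_) R) (trans (map-replicate (suc v ∸_) z v) (cong (replicate z) (m+n∸n≡m 1 v)))))))

runB : ℕ → List (ℕ × ℕ) → Maybe Path → Maybe Path
runB n ops t = foldl (λ t jk → Bop n (proj₁ jk) (proj₂ jk) t) t ops

-- The indices decrease within a group: the rightmost `suc v` moves first, which is the order in
-- which `insG` creates the parts.
runB-group : ∀ n v gs T z R → 0 < v → Positive T → Positive R → sum (T ++ replicate (length gs) (suc v) ++ replicate z v ++ R) ≡ n →
  Desc (suc z) gs → 0 < z + length R →
  runB n (applyUpTo (λ r → length T + length gs ∸ r , nth gs r) (length gs)) (just (pathOf (T ++ replicate (length gs) (suc v) ++ replicate z v ++ R)))
    ≡ just (pathOf (T ++ insG v R z gs))
runB-group n v [] T z R pv pT pR eq d ne = refl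
runB-group n v (g ∷ gs) T z R pv pT pR eq (s≤s h , d) ne = trans
  (cong₂ (runB n) (applyUpTo-cong (length gs) (λ r _ → cong (λ q → q ∸ suc r , nth gs r) (+-suc (length T) (length gs)))) first)
  (runB-group n v gs T g (suc v ∷ replicate (z ∸ g) v ++ R) pv pT (s≤s z≤n ∷ All.++⁺ (All.replicate⁺ (z ∸ g) pv) pR)
    (trans (Shift.sum≡ (shift-++ T (shift-++ (replicate (length gs) (suc v)) pass))) (trans (cong sum (sym start)) eq)) d
    (≤-trans (s≤s z≤n) (m≤n+m _ g)))
  where
  P : List ℕ
  P = T ++ replicate (length gs) (suc v)
  pass : Shift g (suc v ∷ replicate z v ++ R) (replicate g v ++ suc v ∷ replicate (z ∸ g) v ++ R)
  pass = shift-≡ (cong (suc v ∷_) (replicate-∸ v R h)) (shift-pass v g (replicate (z ∸ g) v ++ R))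
  start : T ++ replicate (suc (length gs)) (suc v) ++ replicate z v ++ R ≡ T ++ replicate (length gs) (suc v) ++ suc v ∷ replicate z v ++ R
  start = cong (T ++_) (replicate-snoc (length gs) (suc v) _)
  start′ : T ++ replicate (suc (length gs)) (suc v) ++ replicate z v ++ R ≡ P ++ suc v ∷ replicate z v ++ R
  start′ = trans start (sym (++-assoc T (replicate (length gs) (suc v)) _))
  index : length T + suc (length gs) ≡ suc (length P)
  index = trans (+-suc (length T) (length gs)) (cong suc (sym (trans (length-++ T) (cong (length T +_) (length-replicate (length gs))))))
  first : Bop n (length T + suc (length gs)) g (just (pathOf (T ++ replicate (suc (length gs)) (suc v) ++ replicate z v ++ R)))
    ≡ just (pathOf (T ++ replicate (length gs) (suc v) ++ replicate g v ++ suc v ∷ replicate (z ∸ g) v ++ R))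
  first = trans (cong₂ (λ i q → Bop n i g (just (pathOf q))) index start′)
    (trans (Bop-pass n v g z P R pv (All.++⁺ pT (All.replicate⁺ (length gs) (s≤s z≤n))) pR (trans (cong sum (sym start′)) eq) h ne)
      (cong (λ q → just (pathOf q)) (++-assoc T (replicate (length gs) (suc v)) _)))

top-length : ∀ i D → length (top i D) ≡ tot D
top-length i D = trans (cong length (top-cw i D)) (trans (length-map (i +_) (cw D)) (cw-length D))

top-positive : ∀ i D → Positive (top i D)
top-positive i [] = []
top-positive i ((p , k) ∷ D) = All.++⁺ (top-positive (suc i) D) (All.replicate⁺ (length p + k) (s≤s z≤n))

-- Small parts move first, so the larger ones still form a sorted prefix. Zero exponents leave the
-- `k` open copies that the next group may pass.
runB-levels : ∀ n v z R D → 0 < v → Positive R → Adm z D → sum (top v D ++ replicate z v ++ R) ≡ n →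
  runB n (groups (λ i r → nth (lam D) i ∸ r , nth (pAt D i) r) (gaps (runsD D))) (just (pathOf (top v D ++ replicate z v ++ R)))
    ≡ just (pathOf (word v z R D))
runB-levels n v z R [] pv pR a eq = refl
runB-levels n v z R ((p , k) ∷ D) pv pR (pz , d , pp , s , a) eq = trans
  (trans (foldl-++ (λ t jk → Bop n (proj₁ jk) (proj₂ jk) t) _ (applyUpTo (λ r → tot ((p , k) ∷ D) ∸ r , nth p r) (tot ((p , k) ∷ D) ∸ hd (runsD D))) _)
    (cong (runB n (groups (λ i r → nth (lam D) i ∸ r , nth (pAt D i) r) (gaps (runsD D)))) group))
  (runB-levels n (suc v) k (insG v R z p) D (s≤s z≤n) (insG-All v R z p pv (s≤s z≤n) pR) a
    (trans (cong (λ q → sum (U ++ q)) (sym (insG-zeros v R z p k)))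
      (trans (Shift.sum≡ (shift-++ U (insG-shift v R z gs (Desc-suc gs dgs)))) (trans (cong sum (sym start)) eq))))
  where
  U gs : List ℕ
  U = top (suc v) D
  gs = p ++ replicate k 0
  lenG : length gs ≡ length p + k
  lenG = trans (length-++ p) (cong (length p +_) (length-replicate k))
  dgs : Desc z gs
  dgs = Desc-++zeros z p k pz d
  start : (U ++ replicate (length p + k) (suc v)) ++ replicate z v ++ R ≡ U ++ replicate (length gs) (suc v) ++ replicate z v ++ R
  start = trans (++-assoc U _ _) (cong (λ q → U ++ replicate q (suc v) ++ replicate z v ++ R) (sym lenG))
  index : tot ((p , k) ∷ D) ≡ length U + length gs
  index = trans (size-tot p k D) (trans (+-comm (length p + k) (tot D)) (cong₂ _+_ (sym (top-length (suc v) D)) (sym lenG)))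
  ops≡ : applyUpTo (λ r → tot ((p , k) ∷ D) ∸ r , nth p r) (tot ((p , k) ∷ D) ∸ hd (runsD D)) ≡ applyUpTo (λ r → length U + length gs ∸ r , nth gs r) (length gs)
  ops≡ = trans (cong (applyUpTo _) (trans (gap-runsD p k D) (sym lenG)))
    (applyUpTo-cong (length gs) (λ r _ → cong₂ (λ x y → x ∸ r , y) index (sym (nth-pad p k r))))
  group : runB n (applyUpTo (λ r → tot ((p , k) ∷ D) ∸ r , nth p r) (tot ((p , k) ∷ D) ∸ hd (runsD D))) (just (pathOf ((U ++ replicate (length p + k) (suc v)) ++ replicate z v ++ R)))
    ≡ just (pathOf (U ++ replicate k (suc v) ++ insG v R z p))
  group = trans (cong₂ (λ o q → runB n o (just (pathOf q))) ops≡ start)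
    (trans (runB-group n v gs U z R pv (top-positive (suc v) D) pR (trans (cong sum (sym start)) eq) (Desc-suc gs dgs) (≤-trans pz (m≤m+n z (length R))))
      (cong (λ q → just (pathOf (U ++ q))) (insG-zeros v R z p k)))

lam-linked : ∀ D → Linked (λ a b → b ≤ a) (lam D)
lam-linked [] = []
lam-linked (_ ∷ []) = [-]
lam-linked ((p , k) ∷ L ∷ D) = ≤-trans (m≤n+m (tot (L ∷ D)) k) (m≤n+m _ (length p)) ∷ lam-linked (L ∷ D)

vals-runsD : ∀ D → vals (runsD D) ≡ lam D
vals-runsD D = trans (sym (map-∘ (lam D))) (map-id (lam D))

expand-cr : ∀ i D → expand (cr i (runsD D)) ≡ top i D
expand-cr i [] = refl
expand-cr i ((p , k) ∷ D) rewrite +-comm i 1 = trans (expand-++ (cr (suc i) (runsD D)) _)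
  (cong₂ _++_ (expand-cr (suc i) D) (trans (++-identityʳ _) (cong (λ q → replicate q (suc i)) (gap-runsD p k D))))

exponent-small : ∀ z x D i → Adm z D → z ≤ x → i < length (lam D) → nth (pAt D i) 0 < nth (x ∷ lam D) i
exponent-small z x (([] , k) ∷ D) zero (pz , _) h lt = ≤-trans pz h
exponent-small z x ((_ ∷ _ , k) ∷ D) zero (_ , (g<z , _) , _) h lt = ≤-trans g<z h
exponent-small z x ((p , k) ∷ D) (suc i) (_ , _ , _ , _ , a) h (s≤s lt) =
  exponent-small k _ D i a (≤-trans (m≤m+n k (tot D)) (m≤n+m _ (length p))) lt

exponent-desc : ∀ z D i r → Adm z D → nth (pAt D i) (suc r) ≤ nth (pAt D i) r
exponent-desc z [] i r a = z≤n
exponent-desc z ((p , k) ∷ D) zero r (_ , d , _) = go z p r d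
  where
  go : ∀ c p r → Desc c p → nth p (suc r) ≤ nth p r
  go c [] r d = z≤n
  go c (x ∷ []) zero d = z≤n
  go c (x ∷ y ∷ p) zero (_ , y≤x , _) = s≤s⁻¹ y≤x
  go c (x ∷ p) (suc r) (_ , d) = go (suc x) p r d
exponent-desc z ((p , k) ∷ D) (suc i) r (_ , _ , _ , _ , a) = exponent-desc k D i r a

-- The two paths of a datum and their correspondence under Φ

module Image {n : ℕ} (d : Data n) where
  open Data d

  f : ℕ → ℕ → ℕ
  f = fOf D

  l w : List ℕ
  l = expand (runsD levels)
  w = wordOf m D

  π τ : Path
  π = pathG n (blks levels)
  τ = pathOf w

  private
    v : ℕ
    v = m + tot D

    sd : SD (suc v) (runsD levels)
    sd = SD-runsD 1 (suc v) levels (s≤s z≤n , tt , [] , m>0 , adm) ≤-refl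

    module R = RunList (suc v) v 1 (runsD D) sd

    l≡ : l ≡ lam levels
    l≡ = expand-runsD levels

    sum-l : sum l ≡ n
    sum-l = trans (cong sum l≡) sum≡

    chain : Chain 1 (blks levels)
    chain = chain-levels d

    len : sum (lengths (blks levels)) ≡ n
    len = sum-levels d

    length-runs : length (runsD D) ≡ length (lam D)
    length-runs = length-map (_, 1) (lam D)

  Aof≡ : Aof n l f ≡ just π
  Aof≡ = trans (R.Aof-ops n f) (subst₂ (λ q X → runA n (R.opsA f) (just q) ≡ just (pathX n X)) X₀≡ X≡
    (runA-OR n [] (OR-skips v 0 0 (R.opsA f) _ _ (OR-index (+-identityʳ v) (OR-levels m 0 v D adm (m≤m+n m (tot D)))))
      (subst (ValidX n) (sym X≡) (toX-valid chain len))
      (subst (ValidX n) (sym zero≡) (toX-valid (chain-zeroBlocks 1 (lam levels) (s≤s z≤n) pos) (trans (cong sum (lengths-zeroBlocks (lam levels))) sum≡)))))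
    where
    pos : Positive (lam levels)
    pos = subst Positive l≡ (expand-positive (suc v) (runsD levels) sd)
    X≡ : replicate v 0 ++ toX (0 + 1 * v) (blks D) ≡ toX 0 (blks levels)
    X≡ = cong₂ _++_ (sym (map-replicate (0 ∸_) v 0)) (cong (λ q → toX q (blks D)) (trans (+-identityʳ v) (sym (length-replicate v))))
    zero≡ : replicate v 0 ++ toX (0 + 1 * v) (zeroBlocks (lam D)) ≡ toX 0 (zeroBlocks (lam levels))
    zero≡ = cong₂ _++_ (sym (map-replicate (0 ∸_) v 0)) (cong (λ q → toX q (zeroBlocks (lam D))) (trans (+-identityʳ v) (sym (length-replicate v))))
    X₀≡ : pathX n (replicate v 0 ++ toX (0 + 1 * v) (zeroBlocks (lam D))) ≡ pathOf l
    X₀≡ = trans (cong (pathX n) zero≡) (trans (pathG-zeroBlocks pos sum≡) (cong pathOf (sym l≡)))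

  conj-l : conj l ≡ cw levels
  conj-l = trans (conj-expand (suc v) (runsD levels) sd) (trans (expand-cr 0 levels) (sym (cw-bottom m D)))

  private
    shift : Shift (exc D) (cw levels) w
    shift = wordOf-shift m D adm

  w-positive : Positive w
  w-positive = word-positive 0 m [] D []

  w-sum : sum w ≡ n
  w-sum = trans (Shift.sum≡ shift) (trans (cw-sum levels) sum≡)

  Bof≡ : Bof n l f ≡ just τ
  Bof≡ = trans (R.Bof-ops n f) (trans
    (cong₂ (λ o q → runB n o (just (pathOf q)))
      (groups-cong (gaps (runsD D)) (λ i r _ _ → cong (λ q → nth q i ∸ r , f (suc i) (suc r)) (vals-runsD D)))
      (trans conj-l start))
    (runB-levels n 1 m [] D (s≤s z≤n) [] adm (trans (cong sum (sym start)) (trans (cw-sum levels) sum≡))))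
    where
    start : cw levels ≡ top 1 D ++ replicate m 1 ++ []
    start = trans (cw-bottom m D) (cong (top 1 D ++_) (sym (++-identityʳ (replicate m 1))))

  inF : InF n f l
  inF = (sum-l , expand-positive (suc v) (runsD levels) sd , subst (Linked _) (sym l≡) (lam-linked levels)) ,
    (λ { (suc i) _ h → subst (nth (pAt D i) 0 <_) (sym (trans (R.bar-l (suc i)) (cong (λ q → nth q i) (vals-runsD levels))))
           (exponent-small m v D i adm (m≤m+n m (tot D)) (subst (i <_) length-runs (subst (λ q → suc i ≤ q ∸ 1) R.ellBar-l h))) ,
         λ { (suc r) _ _ → exponent-desc m D i r adm } }) ,
    (w , (w-positive , w-sum) , Bof≡)

  phi : PhiRel n π τ
  phi = f , l , inF , Aof≡ , Bof≡

  π-dyck : InD n π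
  π-dyck = pathG-dyck chain len

  τ-dyck : InD n τ
  τ-dyck = pathOf-dyck {n} {w} w-sum

  bounce-π : bounce n π ≡ area τ
  bounce-π = trans (pathG-bounce chain len) (trans (cong wt (lengths-blks levels))
    (sym (trans (pathOf-area w-positive w-sum) (trans (Shift.tris≡ shift) (cw-tris levels)))))

  area-π : area π ≡ bounce n τ
  area-π = trans (pathG-area chain len) (trans (cong₂ _+_ (cong tris (lengths-blks levels)) (total-blks levels))
    (sym (trans (pathOf-bounce w-positive w-sum) (trans (sym (Shift.wt≡ shift)) (cong (_+ exc D) (cw-wt levels))))))

  ab-swap : ab n π ≡ ab n τ
  ab-swap = trans (cong₂ _+_ area-π bounce-π) (+-comm (bounce n τ) (area τ))

  -- In any representation of `π` the partition is the bounce composition of `π`, and the exponents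
  -- agree with `f` wherever the operators use them.
  phi-unique : ∀ {σ} → 0 < n → PhiRel n π σ → σ ≡ τ
  phi-unique {σ} pn (g , l′ , ((s , pos , lk) , bound , _) , eqA , eqB) = just-injective
    (trans (sym eqB) (trans (cong (λ q → Bof n q g) l′≡l) (trans same Bof≡)))
    where
    comp : bounceComp n π ≡ l′
    comp with partition-runs l′ pos lk
    ... | [] , _ , eq = ⊥-elim (<⇒≢ pn (trans (sym (cong sum eq)) s))
    ... | (v′ , m′) ∷ rs , sd′ , refl = Aof-bounceComp n v′ m′ rs _ g π sd′ s
        (λ i lt → subst (g (suc i) 1 <_) (R′.bar-l (suc i))
          (proj₁ (bound (suc i) (s≤s z≤n) (subst (λ q → suc i ≤ q ∸ 1) (sym R′.ellBar-l) lt)))) eqA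
      where
      module R′ = RunList _ v′ m′ rs sd′
    l′≡l : l′ ≡ l
    l′≡l = trans (sym comp) (trans (pathG-bounceComp chain len) (trans (lengths-blks levels) (sym l≡)))
    same : Bof n l g ≡ Bof n l f
    same = trans (R.Bof-ops n g) (trans (cong (λ o → runB n o (just (pathOf (conj l)))) (groups-cong (gaps (runsD D)) (λ i r lt lt′ →
        cong (nth (vals (runsD D)) i ∸ r ,_)
          (Aof-determines n v 1 (runsD D) (suc v) g f π sd sum-l (trans (cong (λ q → Aof n q g) (sym l′≡l)) eqA) Aof≡ i r lt lt′))))
      (sym (R.Bof-ops n f)))

-- Transfer of minimality and the bijection

ND-data : ∀ {n α} → 0 < n → Positive α → sum α ≡ n → ND α → Σ (Data n) λ d → α ≡ Image.w d
ND-data {n} {α} pn pos eq nd with decode-ND α (subst (0 <_) (sym eq) pn) pos nd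
... | m , D , m>0 , a , refl = mkData m D m>0 a
      (trans (sym (cw-sum (bottom m ∷ D))) (trans (sym (Shift.sum≡ (wordOf-shift m D a))) eq)) , refl

InB-data : ∀ {n π} → 0 < n → InB n π → Σ (Data n) λ d → π ≡ Image.π d
InB-data {n} {π} pn b with InB-Gapped {n} {π} b
... | Gs , ch , s , eq , g with gapped-data Gs pn ch s g
...   | d , refl = d , eq

InA-data : ∀ {n τ} → 0 < n → InA n τ → Σ (Data n) λ d → τ ≡ Image.τ d
InA-data {n} {τ} pn a with InA-ND {n} {τ} a
... | α , eq , pos , s , nd with ND-data pn pos s nd
...   | d , refl = d , eq

-- A competitor `σ` of `Image.τ d` descends to `Image.τ d′` of no larger area. Its partner
-- `Image.π d′` competes with `Image.π d`, and the bounces compared there are the areas wanted here.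
image-InA : ∀ {n} (d : Data n) → 0 < n → InB n (Image.π d) → InA n (Image.τ d)
image-InA {n} d pn (_ , min) = Image.τ-dyck d , λ σ dσ eq → go σ dσ eq
  where
  go : ∀ σ → InD n σ → ab n σ ≡ ab n (Image.τ d) → area (Image.τ d) ≤ area σ
  go σ dσ eq with area-min {n} {σ} dσ
  ... | α , pos , s , nd , le , eq′ with ND-data pn pos s nd
  ...   | d′ , refl = ≤-trans (subst₂ _≤_ (Image.bounce-π d) (trans (Image.bounce-π d′) a≡)
            (min (Image.π d′) (Image.π-dyck d′) (trans (Image.ab-swap d′)
              (trans (cong₂ _+_ a≡ (pathOf-bounce (Image.w-positive d′) (Image.w-sum d′))) (trans eq′ (trans eq (sym (Image.ab-swap d)))))))) le
    where
    a≡ : area (Image.τ d′) ≡ tris (Image.w d′)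
    a≡ = pathOf-area (Image.w-positive d′) (Image.w-sum d′)

preimage-InB : ∀ {n} (d : Data n) → 0 < n → InA n (Image.τ d) → InB n (Image.π d)
preimage-InB {n} d pn (_ , min) = Image.π-dyck d , λ σ dσ eq → go σ dσ eq
  where
  go : ∀ σ → InD n σ → ab n σ ≡ ab n (Image.π d) → bounce n (Image.π d) ≤ bounce n σ
  go σ dσ eq with bounce-min {n} {σ} dσ
  ... | Gs , ch , s , g , le , eq′ with gapped-data Gs pn ch s g
  ...   | d′ , refl = ≤-trans (subst₂ _≤_ (sym (Image.bounce-π d)) (sym (Image.bounce-π d′))
            (min (Image.τ d′) (Image.τ-dyck d′) (trans (sym (Image.ab-swap d′)) (trans eq′ (trans eq (Image.ab-swap d)))))) le

-- The word gives back the levels, and the size `n` then fixes the width of the bottom level.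
τ-injective : ∀ {n} (d d′ : Data n) → Image.τ d ≡ Image.τ d′ → Image.π d ≡ Image.π d′
τ-injective {n} d@(mkData m D _ a s) d′@(mkData m′ D′ _ a′ s′) eq
  with wordOf-levels m m′ D D′ a a′ (pathOf-injective {n} (Image.w-positive d) (Image.w-sum d) (Image.w-positive d′) (Image.w-sum d′) eq)
... | refl with sum-lam-bottom m m′ D (trans s (sym s′))
...   | refl = refl

theorem4p12 : (n : ℕ) → 1 ≤ n →
    ((π : Path) → InB n π → InAF n π) ×
    ((π τ τ′ : Path) → InB n π → PhiRel n π τ → PhiRel n π τ′ → τ ≡ τ′) ×
    ((π τ : Path) → InB n π → PhiRel n π τ → InA n τ) ×
    ((π π′ τ : Path) → InB n π → InB n π′ → PhiRel n π τ → PhiRel n π′ τ → π ≡ π′) ×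
    ((τ : Path) → InA n τ → Σ Path (λ π → InB n π × PhiRel n π τ))
theorem4p12 n pn = inAF , functional , maps , injective , surjective
  where
  inAF : (π : Path) → InB n π → InAF n π
  inAF π b with InB-data {n} {π} pn b
  ... | d , refl = Image.f d , Image.l d , Image.inF d , Image.Aof≡ d

  functional : (π τ τ′ : Path) → InB n π → PhiRel n π τ → PhiRel n π τ′ → τ ≡ τ′
  functional π τ τ′ b r r′ with InB-data {n} {π} pn b
  ... | d , refl = trans (Image.phi-unique d pn r) (sym (Image.phi-unique d pn r′))

  maps : (π τ : Path) → InB n π → PhiRel n π τ → InA n τ
  maps π τ b r with InB-data {n} {π} pn b
  ... | d , refl = subst (InA n) (sym (Image.phi-unique d pn r)) (image-InA d pn b)

  injective : (π π′ τ : Path) → InB n π → InB n π′ → PhiRel n π τ → PhiRel n π′ τ → π ≡ π′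
  injective π π′ τ b b′ r r′ with InB-data {n} {π} pn b | InB-data {n} {π′} pn b′
  ... | d , refl | d′ , refl = τ-injective d d′ (trans (sym (Image.phi-unique d pn r)) (Image.phi-unique d′ pn r′))

  surjective : (τ : Path) → InA n τ → Σ Path (λ π → InB n π × PhiRel n π τ)
  surjective τ a with InA-data {n} {τ} pn a
  ... | d , refl = Image.π d , preimage-InB d pn a , Image.phi d
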